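{- Let $\lambda\supseteq\mu$ be partitions and $N=|\lambda/\mu|$. For each right snake $S$ of $\lambda/\mu$ fix a set $F_S$ of $\ell(S)/2$ links of $S$, no two consecutive, and let $F=\bigcup_S F_S$. Let $Q_F$ be the set of all minimal border strip decompositions of $\lambda/\mu$ that use every link in $F$. Then for each $\sigma\vdash N$, $Q_F$ contains exactly $\mathrm{is}_\sigma(\lambda/\mu)$ minimal border strip decompositions of type $\sigma$.
   Context: Skew diagram $\lambda/\mu=\{(i,j):\mu_i<j\le\lambda_i\}$; square $(i,j)$ drawn as $[j-1,j]\times[-i,-i+1]$. $r=\mathrm{rank}(\lambda/\mu)$: an outside top corner is $(i,j)\in\lambda/\mu$ with $(i-1,j),(i,j-1)\notin\lambda/\mu$; an inside top corner is $(i,j)\in\lambda/\mu$ with $(i-1,j),(i,j-1)\in\lambda/\mu$, $(i-1,j-1)\notin\lambda/\mu$; the diagonal of corner $(i,j)$ is $\{(i+p,j+p)\in\lambda/\mu:p\ge0\}$; rank = number of squares on outside diagonals minus number on inside diagonals. A border strip is a nonempty edge-connected skew diagram with no $2\times2$ block; a border strip decomposition is a partition of the squares of $\lambda/\mu$ into border strips, minimal if it has the fewest strips; its type is the partition of $N$ given by the strip sizes. Snakes: for a partition $\alpha$, its boundary path goes up $x=0$ from $y=-\infty$ to $(0,-\ell(\alpha))$, follows the lower-right boundary of $\alpha$ to $(\alpha_1,0)$, then right along $y=0$; the step starting at $(x,y)$ has index $x+y$. For $k\in\mathbb{Z}$ let $e_k$ be step $k$ of the path of $\lambda$. If $e_k$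 is also a step of the path of $\mu$, $S_k=\emptyset$. Otherwise, if $e_k$ is horizontal it is the lower edge of $(i,j)\in\lambda/\mu$ and $S_k=(\lambda/\mu)\cap\{(i,j),(i,j-1),(i-1,j-1),(i-1,j-2),\dots\}$; if vertical it is the right edge of $(i,j)\in\lambda/\mu$ and $S_k=(\lambda/\mu)\cap\{(i,j),(i-1,j),(i-1,j-1),(i-2,j-1),\dots\}$. $\ell(S_k)=|S_k|-1$. $S_k$ is a left snake if $e_k$ horizontal and $\ell(S_k)\ge0$ even; a right snake if $e_k$ vertical and $\ell(S_k)\ge0$ even. A link of a snake is a pair of its squares sharing an edge; two links are consecutive if they share a square; a border strip decomposition uses a link if some strip contains both of its squares. An interval set is a set $\{(u_1,v_1),\dots,(u_r,v_r)\}$ of pairs of integers, the $2r$ integers distinct, $u_i<v_i$, each $S_{u_i}$ a left snake and each $S_{v_i}$ a right snake; its type is the partition with parts $v_i-u_i$. $\mathrm{is}_\sigma(\lambda/\mu)$ is the number of interval sets of type $\sigma$. -}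

module Defs where

open import Data.Bool using (Bool; true; false; _∧_; not; T; if_then_else_)
open import Data.Nat using (ℕ; zero; suc; _+_; _∸_; _≤_; _<_; _⊔_; _≤ᵇ_; _<ᵇ_; _≡ᵇ_; _%_; ⌊_/2⌋)
open import Data.Integer using (ℤ; +_; _-_) renaming (_<_ to _<ℤ_)
open import Data.List using (List; []; _∷_; length; map; zip; filter; foldr; upTo; concatMap)
open import Data.Nat.ListAction using (sum)
open import Data.List.Membership.Propositional using (_∈_)
open import Data.List.Relation.Unary.All using (All)
open import Data.List.Relation.Unary.Linked using (Linked)
open import Data.List.Relation.Unary.AllPairs using (AllPairs)
open import Data.List.Relation.Unary.Unique.Propositional using (Unique)
open import Data.List.Relation.Binary.Permutation.Propositional using (_↭_)
open import Data.Product using (Σ; _×_; _,_; proj₁; proj₂)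
open import Data.Sum using (_⊎_)
open import Data.Empty using (⊥)
open import Relation.Nullary using (¬_)
open import Relation.Binary.PropositionalEquality using (_≡_; _≢_)

IsPartition : List ℕ → Set
IsPartition α = Linked (λ a b → b ≤ a) α × All (λ a → 0 < a) α

-- part α i = α_i  (1-indexed; 0 for i = 0 and for i > ℓ(α))
part : List ℕ → ℕ → ℕ
part []       _             = 0
part (a ∷ as) zero          = 0
part (a ∷ as) (suc zero)    = a
part (a ∷ as) (suc (suc i)) = part as (suc i)

conj : List ℕ → ℕ → ℕ
conj α j = length (filter (λ a → j Data.Nat.≤? a) α)

Contains : List ℕ → List ℕ → Set
Contains la mu = (i : ℕ) → part mu i ≤ part la i

-- Cells (i , j): row i, column j (both ≥ 1 for actual cells).

Cell : Set
Cell = ℕ × ℕ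

inSkew : List ℕ → List ℕ → Cell → Bool
inSkew la mu (i , j) = (part mu i <ᵇ j) ∧ (j ≤ᵇ part la i)

cells : List ℕ → List ℕ → List Cell
cells la mu =
  concatMap (λ i → map (λ t → (i , suc (part mu i + t))) (upTo (part la i ∸ part mu i)))
            (map suc (upTo (length la)))

size : List ℕ → List ℕ → ℕ
size la mu = length (cells la mu)

IsSkewDiagram : (Cell → Set) → Set
IsSkewDiagram S =
  Σ (List ℕ) λ la' → Σ (List ℕ) λ mu' →
    IsPartition la' × IsPartition mu' × Contains la' mu' ×
    ((c : Cell) → (S c → T (inSkew la' mu' c)) × (T (inSkew la' mu' c) → S c))

-- c' is the right neighbour or the lower neighbour of c
-- (each unordered pair of edge-adjacent squares arises exactly once this way)
Adj : Cell → Cell → Set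
Adj (i , j) c' = c' ≡ (i , suc j) ⊎ c' ≡ (suc i , j)

ShareEdge : Cell → Cell → Set
ShareEdge c c' = Adj c c' ⊎ Adj c' c

data Conn (S : Cell → Set) : Cell → Cell → Set where
  here : ∀ {a} → S a → Conn S a a
  step : ∀ {a b c} → Conn S a b → S c → ShareEdge b c → Conn S a c

EdgeConnected : (Cell → Set) → Set
EdgeConnected S = (c c' : Cell) → S c → S c' → Conn S c c'

No2x2 : (Cell → Set) → Set
No2x2 S = (i j : ℕ) →
  ¬ (S (i , j) × S (i , suc j) × S (suc i , j) × S (suc i , suc j))

IsBorderStrip : (Cell → Set) → Set
IsBorderStrip S = (Σ Cell S) × IsSkewDiagram S × EdgeConnected S × No2x2 S

-- Border strip decompositions.
-- A decomposition (= set partition of the squares of λ/μ) is encoded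
-- canonically as a restricted growth string: a list d of labels, d_k being
-- the label of the k-th square of (cells λ μ); the first square gets label 0
-- and each label is at most one more than the largest label used before.
-- The strips are the label classes.

RGSfrom : ℕ → List ℕ → Set
RGSfrom m []       = Data.Unit.⊤ where import Data.Unit
RGSfrom m (x ∷ xs) = x ≤ m × RGSfrom (m ⊔ suc x) xs

IsRGS : List ℕ → Set
IsRGS = RGSfrom 0

nblocks : List ℕ → ℕ
nblocks = foldr (λ x m → suc x ⊔ m) 0

InBlock : List ℕ → List ℕ → List ℕ → ℕ → Cell → Set
InBlock la mu d b c = (c , b) ∈ zip (cells la mu) d

IsBSD : List ℕ → List ℕ → List ℕ → Set
IsBSD la mu d =
  length d ≡ size la mu × IsRGS d ×
  ((b : ℕ) → b < nblocks d → IsBorderStrip (InBlock la mu d b))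

IsMinimalBSD : List ℕ → List ℕ → List ℕ → Set
IsMinimalBSD la mu d =
  IsBSD la mu d × ((d' : List ℕ) → IsBSD la mu d' → nblocks d ≤ nblocks d')

countL : ℕ → List ℕ → ℕ
countL b d = length (filter (λ x → b Data.Nat.≟ x) d)

HasType : List ℕ → List ℕ → Set
HasType d σ = map (λ b → countL b d) (upTo (nblocks d)) ↭ σ

Link : Set
Link = Cell × Cell

Uses : List ℕ → List ℕ → List ℕ → Link → Set
Uses la mu d (c , c') = Σ ℕ λ b → InBlock la mu d b c × InBlock la mu d b c'

outsideTop : List ℕ → List ℕ → Cell → Bool
outsideTop la mu (i , j) =
  inSkew la mu (i , j) ∧ not (inSkew la mu (i ∸ 1 , j)) ∧ not (inSkew la mu (i , j ∸ 1))

insideTop : List ℕ → List ℕ → Cell → Bool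
insideTop la mu (i , j) =
  inSkew la mu (i , j) ∧ inSkew la mu (i ∸ 1 , j) ∧ inSkew la mu (i , j ∸ 1)
  ∧ not (inSkew la mu (i ∸ 1 , j ∸ 1))

-- number of squares on the diagonal {(i+p, j+p) ∈ λ/μ : p ≥ 0}
-- (rows beyond ℓ(λ) are empty, so p ≤ ℓ(λ) suffices)
diagLen : List ℕ → List ℕ → Cell → ℕ
diagLen la mu (i , j) =
  length (filter (λ c → T? (inSkew la mu c))
                 (map (λ p → (i + p , j + p)) (upTo (suc (length la)))))
  where
  open import Relation.Nullary.Decidable using () renaming (T? to T?)

rank : List ℕ → List ℕ → ℤ
rank la mu =
  (+ sum (map (λ c → if outsideTop la mu c then diagLen la mu c else 0) (cells la mu)))
  - (+ sum (map (λ c → if insideTop la mu c then diagLen la mu c else 0) (cells la mu)))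

-- Snakes.
-- The vertical step of the boundary path of α in row i ≥ 1 is the segment
-- from (α_i, -i) to (α_i, -i+1); its index is α_i - i.
-- The horizontal step in column j ≥ 1 is the segment from (j-1, -α'_j) to
-- (j, -α'_j); its index is j - 1 - α'_j.  Every step of the path is of one of
-- these forms.  The step of λ in row i (column j) is a step of μ iff
-- μ_i = λ_i (μ'_j = λ'_j); otherwise it is the right edge of (i, λ_i)
-- (lower edge of (λ'_j, j)) ∈ λ/μ.

vIndex : List ℕ → ℕ → ℤ
vIndex α i = (+ part α i) - (+ i)

hIndex : List ℕ → ℕ → ℤ
hIndex α j = (+ j) - (+ suc (conj α j))

-- (i,j), (i,j-1), (i-1,j-1), (i-1,j-2), ...   (with fuel; entries with a
-- zero coordinate are never in λ/μ)
stairL : ℕ → Cell → List Cell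
stairL zero    _       = []
stairL (suc n) (i , j) = (i , j) ∷ (i , j ∸ 1) ∷ stairL n (i ∸ 1 , j ∸ 1)

stairR : ℕ → Cell → List Cell
stairR zero    _       = []
stairR (suc n) (i , j) = (i , j) ∷ (i ∸ 1 , j) ∷ stairR n (i ∸ 1 , j ∸ 1)

skewPart : List ℕ → List ℕ → List Cell → List Cell
skewPart la mu cs = filter (λ c → T? (inSkew la mu c)) cs
  where
  open import Relation.Nullary.Decidable using () renaming (T? to T?)

-- S_k for the horizontal step of λ in column j (when it is not a step of μ)
snakeL : List ℕ → List ℕ → ℕ → List Cell
snakeL la mu j = skewPart la mu (stairL (suc (conj la j)) (conj la j , j))

-- S_k for the vertical step of λ in row i (when it is not a step of μ)
snakeR : List ℕ → List ℕ → ℕ → List Cell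
snakeR la mu i = skewPart la mu (stairR (suc i) (i , part la i))

-- ℓ(S) ≥ 0 and even  ⇔  |S| odd
-- S_k is a left snake, where k is the index of the horizontal step of λ in column j
LeftSnakeCol : List ℕ → List ℕ → ℕ → Set
LeftSnakeCol la mu j =
  1 ≤ j × conj mu j ≢ conj la j × length (snakeL la mu j) % 2 ≡ 1

RightSnakeRow : List ℕ → List ℕ → ℕ → Set
RightSnakeRow la mu i =
  1 ≤ i × part mu i ≢ part la i × length (snakeR la mu i) % 2 ≡ 1

LeftSnakeAt : List ℕ → List ℕ → ℤ → Set
LeftSnakeAt la mu k = Σ ℕ λ j → LeftSnakeCol la mu j × hIndex la j ≡ k

RightSnakeAt : List ℕ → List ℕ → ℤ → Set
RightSnakeAt la mu k = Σ ℕ λ i → RightSnakeRow la mu i × vIndex la i ≡ k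

IsLinkOf : List Cell → Link → Set
IsLinkOf S (c , c') = c ∈ S × c' ∈ S × Adj c c'

-- consecutive: distinct links sharing a square
SharesSquare : Link → Link → Set
SharesSquare (a , b) (c , d) = a ≡ c ⊎ a ≡ d ⊎ b ≡ c ⊎ b ≡ d

GoodLinkSet : List Cell → List Link → Set
GoodLinkSet S FS =
  Unique FS ×
  All (IsLinkOf S) FS ×
  length FS ≡ ⌊ (length S ∸ 1) /2⌋ ×
  ((l l' : Link) → l ∈ FS → l' ∈ FS → l ≢ l' → ¬ SharesSquare l l')

-- d ∈ Q_F, where F_S for the right snake in row i is F i
InQF : List ℕ → List ℕ → (ℕ → List Link) → List ℕ → Set
InQF la mu F d =
  IsMinimalBSD la mu d ×
  ((i : ℕ) → RightSnakeRow la mu i → (l : Link) → l ∈ F i → Uses la mu d l)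

-- Interval sets, encoded as lists of pairs sorted strictly by first entry.

IsIntervalSet : List ℕ → List ℕ → List (ℤ × ℤ) → Set
IsIntervalSet la mu I =
  AllPairs (λ p q → proj₁ p <ℤ proj₁ q) I ×
  (+ length I) ≡ rank la mu ×
  Unique (concatMap (λ p → proj₁ p ∷ proj₂ p ∷ []) I) ×
  All (λ p → proj₁ p <ℤ proj₂ p × LeftSnakeAt la mu (proj₁ p) × RightSnakeAt la mu (proj₂ p)) I

IntervalSetOfType : List ℕ → List ℕ → List ℕ → List (ℤ × ℤ) → Set
IntervalSetOfType la mu σ I =
  IsIntervalSet la mu I × map (λ p → Data.Integer.∣ proj₂ p - proj₁ p ∣) I ↭ σ

HasCard : {A : Set} → (A → Set) → ℕ → Set
HasCard {A} P n =
  Σ (List A) λ xs → Unique xs × ((x : A) → x ∈ xs → P x) × ((x : A) → P x → x ∈ xs)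
    × length xs ≡ n

{-# OPTIONS --safe #-}
module Submission where

-- The squares of λ/μ are grouped by diagonals; the snake S_k is the zigzag formed by the diagonals
-- k and k + 1, so the second one has one square more (left snake), one square fewer (right snake)
-- or as many squares.  A border strip has one square on each of an interval of diagonals, hence a
-- decomposition into border strips is a choice of a matching of links in every snake.  At a right
-- snake some strip has to end; therefore a decomposition is minimal iff exactly one strip ends at
-- every right snake and no strip ends elsewhere, i.e. iff all the matchings are maximum.  A maximum
-- matching is unique in a snake with evenly many squares, it is prescribed by F in a right snake,
-- and in a left snake it is given by the one square q of the second diagonal left unmatched, where a
-- new strip starts.  Thus Q_F is in bijection with the families of such squares q.
--
-- Read the snakes from right to left.  The squares of the second diagonal of a left snake u lie on
-- strips ending at distinct right snakes v > u, namely at those not yet used by a left snake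
-- u′ > u; so choosing q amounts to choosing the partner v of u in an interval set.  The strip
-- starting at q has a square on each of the diagonals u + 1, …, v, so it has v - u squares.

open import Defs
open import Data.Bool using (Bool; true; false; if_then_else_; not) renaming (_∧_ to _∧ᵇ_; T to Tr)
open import Data.Bool.Properties using (T-∧; ∧-zeroʳ; ∧-identityʳ)
open import Data.Empty using (⊥; ⊥-elim)
open import Data.Integer as ℤ using (ℤ; _⊖_)
import Data.Integer.Properties as ℤ
import Data.Integer.Solver as ℤ
open import Data.List using (List; []; _∷_; _++_; length; map; zip; filter; upTo; applyUpTo; drop; cartesianProductWith; concatMap)
open import Data.List.Membership.Propositional using (_∈_; _∉_; lose; find)
open import Data.List.Membership.Propositional.Properties using (∈-∃++; ∈-++⁺ˡ; ∈-++⁺ʳ; ∈-++⁻; ∈-map⁺; ∈-map⁻; ∈-upTo⁺; ∈-upTo⁻; ∈-filter⁺; ∈-filter⁻; ∈-cartesianProductWith⁺; ∈-cartesianProductWith⁻; ∈-concat⁺′; ∈-concatMap⁻)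
open import Data.List.Membership.Propositional.Properties.WithK using (unique∧set⇒bag)
open import Data.List.Properties using (∷-injective; length-map; length-++; length-upTo; length-filter; map-cong; map-cong-local; map-injective; map-∘; map-++; map-upTo; filter-accept; filter-reject; filter-++)
open import Data.List.Relation.Binary.BagAndSetEquality using (∼bag⇒↭)
open import Data.List.Relation.Binary.Permutation.Propositional using (_↭_; ↭-refl; ↭-sym; ↭-trans; prep)
open import Data.List.Relation.Binary.Permutation.Propositional.Properties using (shift; drop-∷; ↭-length; ¬x∷xs↭[]; ∈-resp-↭; map⁺; filter-↭)
open import Data.List.Relation.Unary.All as All using (All; []; _∷_)
open import Data.List.Relation.Unary.All.Properties as AllP using (all-filter)
open import Data.List.Relation.Unary.AllPairs as AllPairs using (AllPairs; []; _∷_)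
import Data.List.Relation.Unary.AllPairs.Properties as AllPairsP
open import Data.List.Relation.Unary.Any using (here; there; any?)
open import Data.List.Relation.Unary.Linked as Linked using (Linked; []; [-]; _∷_)
open import Data.List.Relation.Unary.Unique.Propositional using (Unique)
open import Data.List.Relation.Unary.Unique.Propositional.Properties as Unique using (upTo⁺; Unique[x∷xs]⇒x∉xs)
open import Data.Maybe using (Maybe; just; nothing; maybe′)
open import Data.Nat
open import Data.Nat.DivMod using (m*n%n≡0; [m+kn]%n≡m%n)
open import Data.Nat.ListAction using (sum)
open import Data.Nat.ListAction.Properties using (sum-++; sum-↭)
open import Data.Nat.Properties
open import Data.Nat.Solver using (module +-*-Solver)
open import Data.List.Membership.DecPropositional _≟_ using (_∈?_)
open import Data.Product using (Σ; ∃; _×_; _,_; proj₁; proj₂; uncurry)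
open import Data.Product.Properties using (≡-dec)
open import Data.Sum using (_⊎_; inj₁; inj₂; [_,_]′)
open import Data.Unit using (tt)
open import Function using (_∘_; mk⇔; Equivalence)
open import Relation.Binary.Definitions using (tri<; tri≈; tri>)
open import Relation.Binary.PropositionalEquality
open import Relation.Nullary using (¬_; Dec; yes; no; does; contradiction; ¬?)
open import Relation.Nullary.Decidable using (T?; dec-true; dec-false)

-- Finite sets as lists

-- One row describes a maximum matching of an odd snake. Going to the next diagonal, a strip keeps
-- its row or goes up one row. In a left snake row `i` staying and row `i + 1` going up would enter
-- the same square, and in a right snake an up link and the stay link one row lower would leave from
-- the same square. So the matching switches once between the two kinds of links, next to the square
-- that it leaves free; this is all that F_S records. A strip is named by the right snake at which
-- it ends. Names on one diagonal are then distinct, they are the second entries of the intervals,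
-- and the frequency of a name is the size of its strip. Three gaps separate this picture from the
-- definitions. Classes of equal names have to be skew diagrams, which holds because a path going
-- only right and up is order-convex. Minimality compares with all decompositions, so a lower bound
-- and one decomposition attaining it are required. The rank is defined by corners and has to be
-- recognised as the number of left snakes, so that an interval set uses every left snake.

unique∧⊆⇒length≤ : {A : Set} {xs ys : List A} → Unique xs → (∀ {x} → x ∈ xs → x ∈ ys) →
  length xs ≤ length ys
unique∧⊆⇒length≤ [] _ = z≤n
unique∧⊆⇒length≤ {xs = x ∷ xs} u@(_ ∷ uxs) sub with ∈-∃++ (sub (here refl))
... | as , bs , refl = ≤-trans (s≤s (unique∧⊆⇒length≤ uxs sub′))
        (≤-reflexive (↭-length (↭-sym (shift x as bs))))
  where
  sub′ : ∀ {y} → y ∈ xs → y ∈ as ++ bs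
  sub′ y∈ with ∈-++⁻ as (sub (there y∈))
  ... | inj₁ p = ∈-++⁺ˡ p
  ... | inj₂ (here refl) = contradiction y∈ (Unique[x∷xs]⇒x∉xs u)
  ... | inj₂ (there p) = ∈-++⁺ʳ as p

∉⇒All≢ : {A : Set} {x : A} {xs : List A} → x ∉ xs → All (x ≢_) xs
∉⇒All≢ x∉ = All.tabulate λ y∈ x≡y → x∉ (subst (_∈ _) (sym x≡y) y∈)

unique-⊆-≥⇒⊇ : {xs ys : List ℕ} → Unique xs → (∀ {x} → x ∈ xs → x ∈ ys) →
  length ys ≤ length xs → ∀ {y} → y ∈ ys → y ∈ xs
unique-⊆-≥⇒⊇ {xs} {ys} u sub len {y} y∈ with y ∈? xs
... | yes p = p
... | no y∉ = contradiction (≤-trans (unique∧⊆⇒length≤ (∉⇒All≢ y∉ ∷ u) sub′) len) 1+n≰n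
  where
  sub′ : ∀ {x} → x ∈ y ∷ xs → x ∈ ys
  sub′ (here refl) = y∈
  sub′ (there p) = sub p

pigeonhole-∉ : {xs ys : List ℕ} → Unique xs → length ys < length xs → ∃ λ x → x ∈ xs × x ∉ ys
pigeonhole-∉ {xs} {ys} u len with any? (λ x → ¬? (x ∈? ys)) xs
... | yes p = find p
... | no ¬p = contradiction (unique∧⊆⇒length≤ u all∈) (<⇒≱ len)
  where
  all∈ : ∀ {x} → x ∈ xs → x ∈ ys
  all∈ {x} x∈ with x ∈? ys
  ... | yes q = q
  ... | no q = contradiction (lose x∈ q) ¬p

unique-set⇒↭ : {A : Set} {xs ys : List A} → Unique xs → Unique ys →
  (∀ {x} → x ∈ xs → x ∈ ys) → (∀ {x} → x ∈ ys → x ∈ xs) → xs ↭ ys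
unique-set⇒↭ ux uy f g = ∼bag⇒↭ (unique∧set⇒bag ux uy (mk⇔ f g))

infix 4 _↭?_
-- Decidability makes it possible to select the choices whose strips have type σ from a finite list.
_↭?_ : (xs ys : List ℕ) → Dec (xs ↭ ys)
[] ↭? [] = yes ↭-refl
[] ↭? (y ∷ ys) = no λ p → ¬x∷xs↭[] (↭-sym p)
(x ∷ xs) ↭? ys with x ∈? ys
... | no x∉ = no λ p → x∉ (∈-resp-↭ p (here refl))
... | yes x∈ with ∈-∃++ x∈
... | as , bs , refl with xs ↭? (as ++ bs)
... | yes p = yes (↭-trans (prep x p) (↭-sym (shift x as bs)))
... | no ¬p = no λ p → ¬p (drop-∷ (↭-trans p (shift x as bs)))

unique-map⁺-local : {A B : Set} {f : A → B} {xs : List A} →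
  (∀ {x y} → x ∈ xs → y ∈ xs → f x ≡ f y → x ≡ y) → Unique xs → Unique (map f xs)
unique-map⁺-local inj [] = []
unique-map⁺-local {f = f} {x ∷ xs} inj (x≢ ∷ u) =
  ∉⇒All≢ fx∉ ∷ unique-map⁺-local (λ p q → inj (there p) (there q)) u
  where
  fx∉ : f x ∉ map f xs
  fx∉ fx∈ with ∈-map⁻ f fx∈
  ... | y , y∈ , eq = All.lookup x≢ y∈ (inj (here refl) (there y∈) eq)

-- As the squares are listed without repetition, a label list of the right length is a function on
-- squares. Decompositions can thus be handled without positions in the list.
Unique⇒image : {A : Set} (≟A : (x y : A) → Dec (x ≡ y)) {xs : List A} → Unique xs →
  (ds : List ℕ) → length ds ≡ length xs → ∃ λ (f : A → ℕ) → ds ≡ map f xs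
Unique⇒image ≟A [] [] len = (λ _ → 0) , refl
Unique⇒image {A} ≟A {x ∷ xs} (x≢ ∷ u) (d ∷ ds) len
  with Unique⇒image ≟A u ds (suc-injective len)
... | f , eq = g , cong₂ _∷_ (sym gx) (trans eq (map-cong-local (All.map (sym ∘ g≢) x≢)))
  where
  g : A → ℕ
  g y with ≟A x y
  ... | yes _ = d
  ... | no _ = f y
  gx : g x ≡ d
  gx with ≟A x x
  ... | yes _ = refl
  ... | no ¬p = contradiction refl ¬p
  g≢ : ∀ {y} → x ≢ y → g y ≡ f y
  g≢ {y} x≢y with ≟A x y
  ... | yes p = contradiction p x≢y
  ... | no _ = refl

∈-zip-map⁺ : {A : Set} (f : A → ℕ) {xs : List A} {x : A} → x ∈ xs → (x , f x) ∈ zip xs (map f xs)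
∈-zip-map⁺ f (here refl) = here refl
∈-zip-map⁺ f (there p) = there (∈-zip-map⁺ f p)

∈-zip-map⁻ : {A : Set} (f : A → ℕ) (xs : List A) {x : A} {b : ℕ} →
  (x , b) ∈ zip xs (map f xs) → x ∈ xs × b ≡ f x
∈-zip-map⁻ f (x ∷ xs) (here refl) = here refl , refl
∈-zip-map⁻ f (x ∷ xs) (there p) with ∈-zip-map⁻ f xs p
... | q , r = there q , r

sum-zero : {A : Set} (g : A → ℕ) (xs : List A) → (∀ {x} → x ∈ xs → g x ≡ 0) → sum (map g xs) ≡ 0
sum-zero g [] _ = refl
sum-zero g (x ∷ xs) z = cong₂ _+_ (z (here refl)) (sum-zero g xs (z ∘ there))

map-≡⁻ : {A B : Set} {f g : A → B} {xs : List A} {x : A} → map f xs ≡ map g xs → x ∈ xs → f x ≡ g x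
map-≡⁻ {xs = _ ∷ _} e (here refl) = proj₁ (∷-injective e)
map-≡⁻ {xs = _ ∷ _} e (there p) = map-≡⁻ (proj₂ (∷-injective e)) p

flatten : {A : Set} → List (A × A) → List A
flatten = concatMap (λ p → proj₁ p ∷ proj₂ p ∷ [])

∈-flatten⁻ : {A : Set} {x : A} (I : List (A × A)) → x ∈ flatten I → x ∈ map proj₁ I ⊎ x ∈ map proj₂ I
∈-flatten⁻ (_ ∷ I) (here e) = inj₁ (here e)
∈-flatten⁻ (_ ∷ I) (there (here e)) = inj₂ (here e)
∈-flatten⁻ (_ ∷ I) (there (there p)) = [ inj₁ ∘ there , inj₂ ∘ there ]′ (∈-flatten⁻ I p)

∈-flatten₂ : {A : Set} {x : A} (I : List (A × A)) → x ∈ map proj₂ I → x ∈ flatten I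
∈-flatten₂ (_ ∷ I) (here e) = there (here e)
∈-flatten₂ (_ ∷ I) (there p) = there (there (∈-flatten₂ I p))

flatten-unique⁺ : {A : Set} (I : List (A × A)) → Unique (map proj₁ I) → Unique (map proj₂ I) →
  (∀ {x y} → x ∈ map proj₁ I → y ∈ map proj₂ I → x ≢ y) → Unique (flatten I)
flatten-unique⁺ [] _ _ _ = []
flatten-unique⁺ ((u , v) ∷ I) u₁@(_ ∷ us) u₂@(_ ∷ vs) d =
  ∉⇒All≢ u∉ ∷ ∉⇒All≢ v∉ ∷ flatten-unique⁺ I us vs (λ p q → d (there p) (there q))
  where
  u∉ : u ∉ v ∷ flatten I
  u∉ (here e) = d (here refl) (here refl) e
  u∉ (there p) = [ Unique[x∷xs]⇒x∉xs u₁ , (λ q → d (here refl) (there q) refl) ]′ (∈-flatten⁻ I p)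
  v∉ : v ∉ flatten I
  v∉ p = [ (λ q → d (there q) (here refl) refl) , Unique[x∷xs]⇒x∉xs u₂ ]′ (∈-flatten⁻ I p)

flatten-unique₂ : {A : Set} (I : List (A × A)) → Unique (flatten I) → Unique (map proj₂ I)
flatten-unique₂ [] _ = []
flatten-unique₂ (_ ∷ I) (_ ∷ u@(_ ∷ us)) =
  ∉⇒All≢ (Unique[x∷xs]⇒x∉xs u ∘ ∈-flatten₂ I) ∷ flatten-unique₂ I us

preimages : {A B : Set} {P : B → Set} {Q : A → Set} (h : A → B) → (∀ {y} → P y → ∃ λ x → y ≡ h x × Q x) →
  ∀ {ys} → All P ys → ∃ λ xs → ys ≡ map h xs × All Q xs
preimages h f [] = [] , refl , []
preimages h f (p ∷ ps) with f p | preimages h f ps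
... | x , refl , q | xs , refl , qs = x ∷ xs , refl , q ∷ qs

-- Both sides of the theorem are counted as injective images of one list of parameters, so
-- decompositions and interval sets never have to be compared directly.
HasCard-image : {A B : Set} {P : B → Set} (xs : List A) (f : A → B) → Unique xs →
  (∀ {x y} → x ∈ xs → y ∈ xs → f x ≡ f y → x ≡ y) → (∀ {x} → x ∈ xs → P (f x)) →
  (∀ {y} → P y → ∃ λ x → x ∈ xs × y ≡ f x) → HasCard P (length xs)
HasCard-image {P = P} xs f u inj sound complete = map f xs , unique-map⁺-local inj u , to , from , length-map f xs
  where
  to : ∀ y → y ∈ map f xs → P y
  to y y∈ with ∈-map⁻ f y∈
  ... | x , x∈ , refl = sound x∈
  from : ∀ y → P y → y ∈ map f xs
  from y py with complete py
  ... | x , x∈ , refl = ∈-map⁺ f x∈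

-- Restricted growth strings

∈⇒<nblocks : ∀ {b d} → b ∈ d → b < nblocks d
∈⇒<nblocks {d = x ∷ d} (here refl) = m≤m⊔n (suc x) (nblocks d)
∈⇒<nblocks {d = x ∷ d} (there p) = ≤-trans (∈⇒<nblocks p) (m≤n⊔m (suc x) (nblocks d))

<⊔⇒⊎ : ∀ {b} m n → b < m ⊔ n → b < m ⊎ b < n
<⊔⇒⊎ m n p with ⊔-sel m n
... | inj₁ eq = inj₁ (subst (_ <_) eq p)
... | inj₂ eq = inj₂ (subst (_ <_) eq p)

RGSfrom⇒onto : ∀ n d → RGSfrom n d → ∀ {b} → b < nblocks d → b < n ⊎ b ∈ d
RGSfrom⇒onto n (x ∷ d) (x≤n , r) {b} b< with <⊔⇒⊎ (suc x) (nblocks d) b<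
... | inj₁ b<sx = below b<sx
  where
  below : b < suc x → b < n ⊎ b ∈ x ∷ d
  below b<sx with m≤n⇒m<n∨m≡n (s≤s⁻¹ b<sx)
  ... | inj₁ b<x = inj₁ (<-≤-trans b<x x≤n)
  ... | inj₂ b≡x = inj₂ (here b≡x)
... | inj₂ b<′ with RGSfrom⇒onto (n ⊔ suc x) d r b<′
... | inj₂ b∈ = inj₂ (there b∈)
... | inj₁ b<⊔ with <⊔⇒⊎ n (suc x) b<⊔
... | inj₁ b<n = inj₁ b<n
... | inj₂ b<sx with m≤n⇒m<n∨m≡n (s≤s⁻¹ b<sx)
... | inj₁ b<x = inj₁ (<-≤-trans b<x x≤n)
... | inj₂ b≡x = inj₂ (here b≡x)

RGS⇒onto : ∀ {d b} → IsRGS d → b < nblocks d → b ∈ d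
RGS⇒onto {d} r b< with RGSfrom⇒onto 0 d r b<
... | inj₂ p = p

SameKernel : {A : Set} → (A → ℕ) → (A → ℕ) → List A → Set
SameKernel f g xs = ∀ {x y} → x ∈ xs → y ∈ xs → (f x ≡ f y → g x ≡ g y) × (g x ≡ g y → f x ≡ f y)

-- A label is at most `n`, so it is either old, where the two strings agree by hypothesis, or equal
-- to `n` in both. Hence only the partition into equal labels matters.
RGSfrom-unique : {A : Set} (f g : A → ℕ) (n : ℕ) (xs : List A) →
  RGSfrom n (map f xs) → RGSfrom n (map g xs) → SameKernel f g xs →
  (∀ {x} → x ∈ xs → f x < n ⊎ g x < n → f x ≡ g x) → map f xs ≡ map g xs
RGSfrom-unique f g n [] _ _ _ _ = refl
RGSfrom-unique f g n (x ∷ xs) (fx≤ , rf) (gx≤ , rg) ker old =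
  cong₂ _∷_ fx≡gx
    (RGSfrom-unique f g (n ⊔ suc (f x)) xs rf
      (subst (λ z → RGSfrom (n ⊔ suc z) (map g xs)) (sym fx≡gx) rg)
      (λ p q → ker (there p) (there q)) old′)
  where
  fx≡gx : f x ≡ g x
  fx≡gx with m≤n⇒m<n∨m≡n fx≤ | m≤n⇒m<n∨m≡n gx≤
  ... | inj₁ p | _ = old (here refl) (inj₁ p)
  ... | inj₂ _ | inj₁ p = old (here refl) (inj₂ p)
  ... | inj₂ p | inj₂ q = trans p (sym q)
  old′ : ∀ {y} → y ∈ xs → f y < n ⊔ suc (f x) ⊎ g y < n ⊔ suc (f x) → f y ≡ g y
  old′ {y} y∈ (inj₁ p) with <⊔⇒⊎ n (suc (f x)) p
  ... | inj₁ q = old (there y∈) (inj₁ q)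
  ... | inj₂ q with m≤n⇒m<n∨m≡n (s≤s⁻¹ q)
  ... | inj₁ q′ = old (there y∈) (inj₁ (<-≤-trans q′ fx≤))
  ... | inj₂ q′ = trans q′ (trans fx≡gx (sym (proj₁ (ker (there y∈) (here refl)) q′)))
  old′ {y} y∈ (inj₂ p) with <⊔⇒⊎ n (suc (f x)) p
  ... | inj₁ q = old (there y∈) (inj₂ q)
  ... | inj₂ q with m≤n⇒m<n∨m≡n (s≤s⁻¹ q)
  ... | inj₁ q′ = old (there y∈) (inj₂ (<-≤-trans q′ fx≤))
  ... | inj₂ q′ = trans (proj₂ (ker (there y∈) (here refl)) (trans q′ fx≡gx)) (sym q′)

RGS-unique : {A : Set} (f g : A → ℕ) (xs : List A) →
  IsRGS (map f xs) → IsRGS (map g xs) → SameKernel f g xs → map f xs ≡ map g xs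
RGS-unique f g xs rf rg ker = RGSfrom-unique f g 0 xs rf rg ker λ { _ (inj₁ ()) ; _ (inj₂ ()) }

-- The labels in order of first appearance, the most recent one first.
seen : List ℕ → List ℕ → List ℕ
seen ss [] = ss
seen ss (x ∷ xs) with x ∈? ss
... | yes _ = seen ss xs
... | no _ = seen (x ∷ ss) xs

-- The number of labels that appeared before `x`. Since the newest label stands in front, this is
-- the length of the tail behind `x` and does not change when further labels are added.
age : List ℕ → ℕ → ℕ
age [] x = 0
age (s ∷ ss) x with x ≟ s
... | yes _ = length ss
... | no _ = age ss x

canon : List ℕ → List ℕ
canon xs = map (age (seen [] xs)) xs

age-< : ∀ {ss x} → x ∈ ss → age ss x < length ss
age-< {s ∷ ss} {x} x∈ with x ≟ s
... | yes _ = ≤-refl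
age-< {s ∷ ss} (here p) | no ¬p = contradiction p ¬p
age-< {s ∷ ss} (there p) | no _ = m≤n⇒m≤1+n (age-< p)

age-inj : ∀ {ss x y} → x ∈ ss → y ∈ ss → age ss x ≡ age ss y → x ≡ y
age-inj {s ∷ ss} {x} {y} x∈ y∈ eq with x ≟ s | y ≟ s
... | yes p | yes q = trans p (sym q)
age-inj {s ∷ ss} x∈ (here q) eq | yes p | no ¬q = contradiction q ¬q
age-inj {s ∷ ss} x∈ (there q) eq | yes p | no _ = contradiction (sym eq) (<⇒≢ (age-< q))
age-inj {s ∷ ss} (here p) y∈ eq | no ¬p | _ = contradiction p ¬p
age-inj {s ∷ ss} (there p) y∈ eq | no _ | yes _ = contradiction eq (<⇒≢ (age-< p))
age-inj {s ∷ ss} (there p) (here q) eq | no _ | no ¬q = contradiction q ¬q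
age-inj {s ∷ ss} (there p) (there q) eq | no _ | no _ = age-inj p q eq

age-head : ∀ x ss → age (x ∷ ss) x ≡ length ss
age-head x ss with x ≟ x
... | yes _ = refl
... | no ¬p = contradiction refl ¬p

age-tail : ∀ {x s} ss → x ≢ s → age (s ∷ ss) x ≡ age ss x
age-tail {x} {s} ss ne with x ≟ s
... | yes p = contradiction p ne
... | no _ = refl

age-seen : ∀ {ss x} xs → x ∈ ss → age (seen ss xs) x ≡ age ss x
age-seen [] x∈ = refl
age-seen {ss} {x} (y ∷ xs) x∈ with y ∈? ss
... | yes _ = age-seen xs x∈
... | no y∉ = trans (age-seen xs (there x∈)) (age-tail ss λ { refl → y∉ x∈ })

seen-⊇ˡ : ∀ {ss x} xs → x ∈ ss → x ∈ seen ss xs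
seen-⊇ˡ [] p = p
seen-⊇ˡ {ss} (y ∷ xs) p with y ∈? ss
... | yes _ = seen-⊇ˡ xs p
... | no _ = seen-⊇ˡ xs (there p)

seen-⊇ʳ : ∀ ss {x xs} → x ∈ xs → x ∈ seen ss xs
seen-⊇ʳ ss {x} {y ∷ xs} p with y ∈? ss
seen-⊇ʳ ss {x} {y ∷ xs} (here refl) | yes q = seen-⊇ˡ xs q
seen-⊇ʳ ss {x} {y ∷ xs} (there p) | yes _ = seen-⊇ʳ ss p
seen-⊇ʳ ss {x} {y ∷ xs} (here refl) | no _ = seen-⊇ˡ xs (here refl)
seen-⊇ʳ ss {x} {y ∷ xs} (there p) | no _ = seen-⊇ʳ (y ∷ ss) p

RGSfrom-age-seen : ∀ ss xs → RGSfrom (length ss) (map (age (seen ss xs)) xs)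
RGSfrom-age-seen ss [] = tt
RGSfrom-age-seen ss (x ∷ xs) with x ∈? ss
... | yes x∈ = <⇒≤ lt , subst (λ n → RGSfrom n (map (age (seen ss xs)) xs))
                 (sym (m≥n⇒m⊔n≡m lt)) (RGSfrom-age-seen ss xs)
  where
  lt : age (seen ss xs) x < length ss
  lt = subst (_< length ss) (sym (age-seen xs x∈)) (age-< x∈)
... | no x∉ = ≤-reflexive eq , subst (λ n → RGSfrom n (map (age (seen (x ∷ ss) xs)) xs))
                 (sym (trans (cong (λ z → length ss ⊔ suc z) eq) (m≤n⇒m⊔n≡n (n≤1+n _))))
                 (RGSfrom-age-seen (x ∷ ss) xs)
  where
  eq : age (seen (x ∷ ss) xs) x ≡ length ss
  eq = trans (age-seen xs (here refl)) (age-head x ss)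

canon-RGS : ∀ xs → IsRGS (canon xs)
canon-RGS xs = RGSfrom-age-seen [] xs

canon-inj : ∀ xs {x y} → x ∈ xs → y ∈ xs → age (seen [] xs) x ≡ age (seen [] xs) y → x ≡ y
canon-inj xs p q = age-inj (seen-⊇ʳ [] p) (seen-⊇ʳ [] q)

countL-++ : ∀ b xs ys → countL b (xs ++ ys) ≡ countL b xs + countL b ys
countL-++ b xs ys = trans (cong length (filter-++ (b ≟_) xs ys)) (length-++ (filter (b ≟_) xs))

countL-yes : ∀ {b x} xs → b ≡ x → countL b (x ∷ xs) ≡ suc (countL b xs)
countL-yes {b} xs eq = cong length (filter-accept (b ≟_) eq)

countL-no : ∀ {b x} xs → b ≢ x → countL b (x ∷ xs) ≡ countL b xs
countL-no {b} xs ne = cong length (filter-reject (b ≟_) ne)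

countL-map-inj : (f : ℕ → ℕ) (v : ℕ) (xs : List ℕ) → (∀ {x} → x ∈ xs → f v ≡ f x → v ≡ x) →
  countL (f v) (map f xs) ≡ countL v xs
countL-map-inj f v [] inj = refl
countL-map-inj f v (x ∷ xs) inj = go (v ≟ x)
  where
  ih : countL (f v) (map f xs) ≡ countL v xs
  ih = countL-map-inj f v xs (inj ∘ there)
  go : Dec (v ≡ x) → countL (f v) (map f (x ∷ xs)) ≡ countL v (x ∷ xs)
  go (yes eq) = trans (countL-yes (map f xs) (cong f eq)) (trans (cong suc ih) (sym (countL-yes xs eq)))
  go (no ne) = trans (countL-no (map f xs) (ne ∘ inj (here refl))) (trans ih (sym (countL-no xs ne)))

countL-∉ : ∀ {b xs} → b ∉ xs → countL b xs ≡ 0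
countL-∉ {b} {[]} b∉ = refl
countL-∉ {b} {x ∷ xs} b∉ = trans (countL-no xs (b∉ ∘ here)) (countL-∉ (b∉ ∘ there))

countL-unique : ∀ {b xs} → Unique xs → b ∈ xs → countL b xs ≡ 1
countL-unique {b} {x ∷ xs} u@(_ ∷ _) (here refl) =
  trans (countL-yes xs refl) (cong suc (countL-∉ (Unique[x∷xs]⇒x∉xs u)))
countL-unique {b} {x ∷ xs} (x≢ ∷ u) (there p) =
  trans (countL-no xs (λ b≡x → All.lookup x≢ p (sym b≡x))) (countL-unique u p)

-- Renumbering the labels only permutes the classes, so the block sizes can be read off the original
-- labels.
canon-blocks : ∀ es vs → Unique vs → (∀ {v} → v ∈ vs → v ∈ es) → (∀ {v} → v ∈ es → v ∈ vs) →
  map (λ b → countL b (canon es)) (upTo (nblocks (canon es))) ↭ map (λ v → countL v es) vs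
canon-blocks es vs uvs vs⊆ es⊆ =
  ↭-trans (map⁺ (λ b → countL b (canon es)) (↭-sym labels))
    (subst (_↭ map (λ v → countL v es) vs)
      (trans (sym counts) (map-∘ vs)) ↭-refl)
  where
  g = age (seen [] es)
  from : ∀ {b} → b ∈ map g vs → b ∈ upTo (nblocks (canon es))
  from p with ∈-map⁻ g p
  ... | v , v∈ , refl = ∈-upTo⁺ (∈⇒<nblocks (∈-map⁺ g (vs⊆ v∈)))
  to : ∀ {b} → b ∈ upTo (nblocks (canon es)) → b ∈ map g vs
  to p with ∈-map⁻ g (RGS⇒onto (canon-RGS es) (∈-upTo⁻ p))
  ... | v , v∈ , refl = ∈-map⁺ g (es⊆ v∈)
  labels : map g vs ↭ upTo (nblocks (canon es))
  labels = unique-set⇒↭ (unique-map⁺-local (λ p q → canon-inj es (vs⊆ p) (vs⊆ q)) uvs)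
             (upTo⁺ _) from to
  counts : map ((λ b → countL b (canon es)) ∘ g) vs ≡ map (λ v → countL v es) vs
  counts = map-cong-local (All.tabulate λ {v} v∈ →
    countL-map-inj g v es (λ x∈ → canon-inj es (vs⊆ v∈) x∈))

nblocks-canon≤ : ∀ es vs → (∀ {v} → v ∈ es → v ∈ vs) → nblocks (canon es) ≤ length vs
nblocks-canon≤ es vs es⊆ =
  subst₂ _≤_ (length-upTo _) (length-map g vs) (unique∧⊆⇒length≤ (upTo⁺ _) to)
  where
  g = age (seen [] es)
  to : ∀ {b} → b ∈ upTo (nblocks (canon es)) → b ∈ map g vs
  to p with ∈-map⁻ g (RGS⇒onto (canon-RGS es) (∈-upTo⁻ p))
  ... | v , v∈ , refl = ∈-map⁺ g (es⊆ v∈)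

-- Strips as labellings of the diagonals

rows : ℕ → ℕ → List ℕ
rows a b = map (λ p → suc (a + p)) (upTo (b ∸ a))

∈-rows⁺ : ∀ {a b i} → a < i → i ≤ b → i ∈ rows a b
∈-rows⁺ {a} {b} {suc i} (s≤s a≤i) i≤b =
  subst (_∈ rows a b) (cong suc (m+[n∸m]≡n a≤i))
    (∈-map⁺ (λ p → suc (a + p)) (∈-upTo⁺ (∸-monoˡ-< i≤b a≤i)))

∈-rows⁻ : ∀ a b {i} → i ∈ rows a b → a < i × i ≤ b
∈-rows⁻ a b p with ∈-map⁻ (λ p → suc (a + p)) p
... | x , x∈ , refl = s≤s (m≤m+n a x) ,
  subst (_≤ b) (cong suc (+-comm x a)) (m≤o∸n⇒m+n≤o (suc x) a≤b (∈-upTo⁻ x∈))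
  where
  a≤b : a ≤ b
  a≤b with a ≤? b
  ... | yes p = p
  ... | no ¬p = contradiction (subst (x <_) (m≤n⇒m∸n≡0 (<⇒≤ (≰⇒> ¬p))) (∈-upTo⁻ x∈)) n≮0

rows-unique : ∀ a b → Unique (rows a b)
rows-unique a b = Unique.map⁺ (+-cancelˡ-≡ a _ _ ∘ suc-injective) (upTo⁺ _)

length-rows : ∀ a b → length (rows a b) ≡ b ∸ a
length-rows a b = trans (length-map _ (upTo (b ∸ a))) (length-upTo _)

-- By `excl` an index with `Q` is never followed by one with `P`, so all indices with `P` come
-- before the switch. This is applied to the moves of strips between two diagonals and to the links
-- of a right snake.
threshold : (P Q : ℕ → Set) (a b : ℕ) → a ≤ b →
  (∀ i → a < i → i ≤ b → P i ⊎ Q i) →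
  (∀ i → a < i → i < b → Q i → P (suc i) → ⊥) →
  ∃ λ c → a ≤ c × c ≤ b × (∀ i → a < i → i ≤ c → P i) × (∀ i → c < i → i ≤ b → Q i)
threshold P Q a b a≤b dec excl with m≤n⇒m<n∨m≡n a≤b
... | inj₂ refl = a , ≤-refl , ≤-refl ,
  (λ i a<i i≤a → contradiction (<-≤-trans a<i i≤a) (<-irrefl refl)) ,
  (λ i a<i i≤a → contradiction (<-≤-trans a<i i≤a) (<-irrefl refl))
threshold P Q a (suc b) a≤b dec excl | inj₁ (s≤s a≤b′)
  with threshold P Q a b a≤b′ (λ i p q → dec i p (m≤n⇒m≤1+n q)) (λ i p q → excl i p (m≤n⇒m≤1+n q))
     | dec (suc b) (s≤s a≤b′) ≤-refl
... | c , a≤c , c≤b , ps , qs | inj₂ q = c , a≤c , m≤n⇒m≤1+n c≤b , ps , qs′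
  where
  qs′ : ∀ i → c < i → i ≤ suc b → Q i
  qs′ i c<i i≤ with m≤n⇒m<n∨m≡n i≤
  ... | inj₁ (s≤s i≤b) = qs i c<i i≤b
  ... | inj₂ refl = q
... | c , a≤c , c≤b , ps , qs | inj₁ p with m≤n⇒m<n∨m≡n c≤b
... | inj₁ c<b = ⊥-elim (excl b (≤-<-trans a≤c c<b) ≤-refl (qs b c<b ≤-refl) p)
... | inj₂ refl = suc c , m≤n⇒m≤1+n a≤c , ≤-refl , ps′ ,
  (λ i c<i i≤ → contradiction (<-≤-trans c<i i≤) (<-irrefl refl))
  where
  ps′ : ∀ i → a < i → i ≤ suc c → P i
  ps′ i a<i i≤ with m≤n⇒m<n∨m≡n i≤
  ... | inj₁ (s≤s i≤c) = ps i a<i i≤c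
  ... | inj₂ refl = p

sorted⇒unique : ∀ {xs} → AllPairs _<_ xs → Unique xs
sorted⇒unique = AllPairs.map <⇒≢

sorted-set⇒≡ : ∀ {xs ys} → AllPairs _<_ xs → AllPairs _<_ ys →
  (∀ {x} → x ∈ xs → x ∈ ys) → (∀ {y} → y ∈ ys → y ∈ xs) → xs ≡ ys
sorted-set⇒≡ [] [] f g = refl
sorted-set⇒≡ [] (_ ∷ _) f g = contradiction (g (here refl)) λ ()
sorted-set⇒≡ (_ ∷ _) [] f g = contradiction (f (here refl)) λ ()
sorted-set⇒≡ {x ∷ xs} {y ∷ ys} (x< ∷ sx) (y< ∷ sy) f g =
  cong₂ _∷_ x≡y (sorted-set⇒≡ sx sy f′ g′)
  where
  head≤ : ∀ {z zs w} → All (z <_) zs → w ∈ z ∷ zs → z ≤ w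
  head≤ _ (here refl) = ≤-refl
  head≤ z< (there p) = <⇒≤ (All.lookup z< p)
  x≡y : x ≡ y
  x≡y = ≤-antisym (head≤ x< (g (here refl))) (head≤ y< (f (here refl)))
  f′ : ∀ {z} → z ∈ xs → z ∈ ys
  f′ p with f (there p)
  ... | there q = q
  ... | here refl = contradiction x≡y (<⇒≢ (All.lookup x< p))
  g′ : ∀ {z} → z ∈ ys → z ∈ xs
  g′ p with g (there p)
  ... | there q = q
  ... | here refl = contradiction (sym x≡y) (<⇒≢ (All.lookup y< p))

sorted-⊆-length⇒≡ : ∀ {xs ys} → AllPairs _<_ xs → AllPairs _<_ ys →
  (∀ {x} → x ∈ xs → x ∈ ys) → length ys ≤ length xs → xs ≡ ys
sorted-⊆-length⇒≡ sx sy f len = sorted-set⇒≡ sx sy f (unique-⊆-≥⇒⊇ (sorted⇒unique sx) f len)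

-- The squares of diagonal t are those in the rows m t + 1, …, l t.
module Profile (m l : ℕ → ℕ) where

  In : ℕ → ℕ → Set
  In t i = m t < i × i ≤ l t

  -- A profile drops at a vertical step of the boundary path and is constant at a horizontal one.
  -- Here the path of μ goes up while that of λ goes right, so the second diagonal gains a square.
  IsLeft : ℕ → Set
  IsLeft t = m t ≡ suc (m (suc t)) × l t ≡ l (suc t)

  IsRight : ℕ → Set
  IsRight t = m t ≡ m (suc t) × l t ≡ suc (l (suc t))

  left? : ∀ t → Dec (IsLeft t)
  left? t with m t ≟ suc (m (suc t)) | l t ≟ l (suc t)
  ... | yes p | yes q = yes (p , q)
  ... | no ¬p | _ = no (¬p ∘ proj₁)
  ... | _ | no ¬q = no (¬q ∘ proj₂)

  right? : ∀ t → Dec (IsRight t)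
  right? t with m t ≟ m (suc t) | l t ≟ suc (l (suc t))
  ... | yes p | yes q = yes (p , q)
  ... | no ¬p | _ = no (¬p ∘ proj₁)
  ... | _ | no ¬q = no (¬q ∘ proj₂)

  left⇒¬right : ∀ {t} → IsLeft t → ¬ IsRight t
  left⇒¬right (p , _) (q , _) = contradiction (trans (sym p) q) 1+n≢n

  data Kind (t : ℕ) : Set where
    flat : m t ≡ m (suc t) → l t ≡ l (suc t) → Kind t
    rise : m t ≡ suc (m (suc t)) → l t ≡ suc (l (suc t)) → Kind t
    left : IsLeft t → Kind t
    right : IsRight t → Kind t

  lefts : ℕ → ℕ → List ℕ
  lefts zero t = []
  lefts (suc n) t with left? t
  ... | yes _ = t ∷ lefts n (suc t)
  ... | no _ = lefts n (suc t)

  ∈-lefts⁻ : ∀ n t {u} → u ∈ lefts n t → t ≤ u × IsLeft u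
  ∈-lefts⁻ (suc n) t u∈ with left? t
  ∈-lefts⁻ (suc n) t (here refl) | yes L = ≤-refl , L
  ∈-lefts⁻ (suc n) t (there p) | yes _ = let (a , b) = ∈-lefts⁻ n (suc t) p in <⇒≤ a , b
  ∈-lefts⁻ (suc n) t p | no _ = let (a , b) = ∈-lefts⁻ n (suc t) p in <⇒≤ a , b

  ∈-lefts⁺ : ∀ n t {u} → t ≤ u → u < n + t → IsLeft u → u ∈ lefts n t
  ∈-lefts⁺ zero t t≤u u< _ = contradiction (<-≤-trans u< t≤u) (<-irrefl refl)
  ∈-lefts⁺ (suc n) t {u} t≤u u< L with left? t | m≤n⇒m<n∨m≡n t≤u
  ... | yes _ | inj₂ refl = here refl
  ... | no ¬L | inj₂ refl = contradiction L ¬L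
  ... | yes _ | inj₁ t<u = there (∈-lefts⁺ n (suc t) t<u (subst (u <_) (sym (+-suc n t)) u<) L)
  ... | no _ | inj₁ t<u = ∈-lefts⁺ n (suc t) t<u (subst (u <_) (sym (+-suc n t)) u<) L

  lefts-sorted : ∀ n t → AllPairs _<_ (lefts n t)
  lefts-sorted zero t = []
  lefts-sorted (suc n) t with left? t
  ... | yes _ = All.tabulate (λ p → proj₁ (∈-lefts⁻ n (suc t) p)) ∷ lefts-sorted n (suc t)
  ... | no _ = lefts-sorted n (suc t)

  diagPairs : ℕ → ℕ → List (ℕ × ℕ)
  diagPairs zero t = []
  diagPairs (suc n) t = map (t ,_) (rows (m t) (l t)) ++ diagPairs n (suc t)

  ∈-diagPairs⁺ : ∀ n t {s i} → t ≤ s → s < n + t → In s i → (s , i) ∈ diagPairs n t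
  ∈-diagPairs⁺ zero t t≤s s< _ = contradiction (<-≤-trans s< t≤s) (<-irrefl refl)
  ∈-diagPairs⁺ (suc n) t {s} t≤s s< i∈ with m≤n⇒m<n∨m≡n t≤s
  ... | inj₂ refl = ∈-++⁺ˡ (∈-map⁺ (t ,_) (∈-rows⁺ (proj₁ i∈) (proj₂ i∈)))
  ... | inj₁ t<s = ∈-++⁺ʳ (map (t ,_) (rows (m t) (l t)))
        (∈-diagPairs⁺ n (suc t) t<s (subst (s <_) (sym (+-suc n t)) s<) i∈)

  ∈-diagPairs⁻ : ∀ n t {s i} → (s , i) ∈ diagPairs n t → t ≤ s × In s i
  ∈-diagPairs⁻ (suc n) t p with ∈-++⁻ (map (t ,_) (rows (m t) (l t))) p
  ... | inj₂ q = let (a , b) = ∈-diagPairs⁻ n (suc t) q in <⇒≤ a , b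
  ... | inj₁ q with ∈-map⁻ (t ,_) q
  ... | i , i∈ , refl = ≤-refl , ∈-rows⁻ _ _ i∈

  diagPairs-unique : ∀ n t → Unique (diagPairs n t)
  diagPairs-unique zero t = []
  diagPairs-unique (suc n) t = Unique.++⁺ (Unique.map⁺ (λ { refl → refl }) (rows-unique _ _)) (diagPairs-unique n (suc t)) disj
    where
    disj : ∀ {p} → ¬ (p ∈ map (t ,_) (rows (m t) (l t)) × p ∈ diagPairs n (suc t))
    disj (p , q) with ∈-map⁻ (t ,_) p
    ... | i , _ , refl = contradiction (proj₁ (∈-diagPairs⁻ n (suc t) q)) 1+n≰n

  -- Strips built from choices at the snakes

  module Threads (T : ℕ)
    (m-step : ∀ t → m t ≡ m (suc t) ⊎ m t ≡ suc (m (suc t)))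
    (l-step : ∀ t → l t ≡ l (suc t) ⊎ l t ≡ suc (l (suc t)))
    (start : l 0 ≡ m 0) (end : l T ≡ 0)
    (fq : ℕ → ℕ) (fq-in : ∀ t → IsRight t → In t (fq t)) where

    kind : ∀ t → Kind t
    kind t with m-step t | l-step t
    ... | inj₁ p | inj₁ q = flat p q
    ... | inj₁ p | inj₂ q = right (p , q)
    ... | inj₂ p | inj₁ q = left (p , q)
    ... | inj₂ p | inj₂ q = rise p q

    -- A strip through row i of diagonal t continues in row nxt k q i of diagonal t + 1; at a left
    -- snake q is the row of diagonal t + 1 where a strip starts, at a right snake the row of
    -- diagonal t where a strip ends.
    nxt : ∀ {t} → Kind t → ℕ → ℕ → Maybe ℕ
    nxt (flat _ _) q i = just i
    nxt (rise _ _) q i = just (pred i)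
    nxt (left _) q i with i ≤? q
    ... | yes _ = just (pred i)
    ... | no _ = just i
    nxt (right _) q i with <-cmp i q
    ... | tri< _ _ _ = just i
    ... | tri≈ _ _ _ = nothing
    ... | tri> _ _ _ = just (pred i)

    -- Where nothing can be chosen the entry is pinned, to the placeholder `0` or to `fq t`; thus
    -- different lists differ at some left snake.
    Ok : ∀ {t} → Kind t → ℕ → Set
    Ok (flat _ _) q = q ≡ 0
    Ok (rise _ _) q = q ≡ 0
    Ok {t} (left _) q = In (suc t) q
    Ok {t} (right _) q = q ≡ fq t

    opts : ∀ {t} → Kind t → List ℕ
    opts (flat _ _) = 0 ∷ []
    opts (rise _ _) = 0 ∷ []
    opts {t} (left _) = rows (m (suc t)) (l (suc t))
    opts {t} (right _) = fq t ∷ []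

    ∈-opts⁺ : ∀ {t q} (k : Kind t) → Ok k q → q ∈ opts k
    ∈-opts⁺ (flat _ _) refl = here refl
    ∈-opts⁺ (rise _ _) refl = here refl
    ∈-opts⁺ (left _) (p , q) = ∈-rows⁺ p q
    ∈-opts⁺ (right _) refl = here refl

    ∈-opts⁻ : ∀ {t q} (k : Kind t) → q ∈ opts k → Ok k q
    ∈-opts⁻ (flat _ _) (here refl) = refl
    ∈-opts⁻ (rise _ _) (here refl) = refl
    ∈-opts⁻ (left _) p = ∈-rows⁻ _ _ p
    ∈-opts⁻ (right _) (here refl) = refl

    opts-unique : ∀ {t} (k : Kind t) → Unique (opts k)
    opts-unique (flat _ _) = [] ∷ []
    opts-unique (rise _ _) = [] ∷ []
    opts-unique (left _) = rows-unique _ _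
    opts-unique (right _) = [] ∷ []

    nxt-in : ∀ {t q i i′} (k : Kind t) → Ok k q → In t i → nxt k q i ≡ just i′ →
      In (suc t) i′ × (i′ ≡ i ⊎ i ≡ suc i′)
    nxt-in (flat p q) ok (a , b) refl = (subst (_< _) p a , subst (_ ≤_) q b) , inj₁ refl
    nxt-in {i = suc i} (rise p q) ok (a , b) refl =
      (s≤s⁻¹ (subst (_< suc i) p a) , s≤s⁻¹ (subst (suc i ≤_) q b)) , inj₂ refl
    nxt-in {q = q₀} {suc i} (left (p , q)) (c , d) (a , b) eq with suc i ≤? q₀
    nxt-in {q = q₀} {suc i} (left (p , q)) (c , d) (a , b) refl | yes r =
      (s≤s⁻¹ (subst (_< suc i) p a) , ≤-trans (n≤1+n i) (subst (suc i ≤_) q b)) , inj₂ refl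
    nxt-in {q = q₀} {suc i} (left (p , q)) (c , d) (a , b) refl | no r =
      (<-trans (n<1+n _) (subst (_< suc i) p a) , subst (suc i ≤_) q b) , inj₁ refl
    nxt-in {t} {q₀} {i} (right (p , q)) refl (a , b) eq with <-cmp i q₀
    nxt-in {t} {q₀} {i} (right (p , q)) refl (a , b) refl | tri< r _ _ =
      (subst (_< i) p a , s≤s⁻¹ (subst (i <_) q (<-≤-trans r (proj₂ (fq-in t (p , q)))))) , inj₁ refl
    nxt-in {t} {q₀} {suc i} (right (p , q)) refl (a , b) refl | tri> _ _ (s≤s r) =
      (subst (_< i) p (<-≤-trans (proj₁ (fq-in t (p , q))) r) , s≤s⁻¹ (subst (suc i ≤_) q b)) , inj₂ refl

    nxt-inj : ∀ {t q i j r} (k : Kind t) → Ok k q → In t i → In t j →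
      nxt k q i ≡ just r → nxt k q j ≡ just r → i ≡ j
    nxt-inj (flat _ _) ok _ _ refl refl = refl
    nxt-inj {i = suc i} {suc j} (rise _ _) ok _ _ refl refl = refl
    nxt-inj {q = q} {suc i} {suc j} (left _) ok _ _ e f with suc i ≤? q | suc j ≤? q
    nxt-inj {i = suc i} {suc j} (left _) ok _ _ refl refl | yes a | yes b = refl
    nxt-inj {i = suc i} {suc j} (left _) ok _ _ refl refl | yes a | no b = contradiction (<⇒≤ a) b
    nxt-inj {i = suc i} {suc j} (left _) ok _ _ refl refl | no a | yes b = contradiction (<⇒≤ b) a
    nxt-inj {i = suc i} {suc j} (left _) ok _ _ refl refl | no a | no b = refl
    nxt-inj {q = q} {suc i} {suc j} (right _) ok _ _ e f with <-cmp (suc i) q | <-cmp (suc j) q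
    nxt-inj {i = suc i} {suc j} (right _) ok _ _ refl refl | tri< a _ _ | tri< b _ _ = refl
    nxt-inj {i = suc i} {suc j} (right _) ok _ _ refl refl | tri< a _ _ | tri> _ _ b =
      contradiction (<-≤-trans a (s≤s⁻¹ b)) (<-irrefl refl)
    nxt-inj {i = suc i} {suc j} (right _) ok _ _ refl refl | tri> _ _ a | tri< b _ _ =
      contradiction (<-≤-trans b (s≤s⁻¹ a)) (<-irrefl refl)
    nxt-inj {i = suc i} {suc j} (right _) ok _ _ refl refl | tri> _ _ a | tri> _ _ b = refl

    nxt-nothing : ∀ {t q i} (k : Kind t) → Ok k q → nxt k q i ≡ nothing → IsRight t × i ≡ fq t
    nxt-nothing {q = q} {i} (left _) ok eq with i ≤? q
    nxt-nothing {q = q} {i} (left _) ok () | yes _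
    nxt-nothing {q = q} {i} (left _) ok () | no _
    nxt-nothing {q = q} {i} (right r) refl eq with <-cmp i q
    ... | tri≈ _ p _ = r , p

    nxt-fq : ∀ {t q} (k : Kind t) → Ok k q → IsRight t → nxt k q (fq t) ≡ nothing
    nxt-fq (flat _ q) ok (_ , r) = contradiction (trans (sym r) q) 1+n≢n
    nxt-fq (rise p _) ok (r , _) = contradiction (trans (sym p) r) 1+n≢n
    nxt-fq (left p) ok r = contradiction r (left⇒¬right p)
    nxt-fq {t} (right _) refl r with <-cmp (fq t) (fq t)
    ... | tri< _ ne _ = contradiction refl ne
    ... | tri≈ _ _ _ = refl
    ... | tri> _ ne _ = contradiction refl ne

    -- Pulls a row of diagonal `t + 1` back to diagonal `t`. This carries information about strips
    -- from the right end of the diagram to the left; only a row where a strip starts has no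
    -- predecessor.
    nxt-onto : ∀ {t q r} (k : Kind t) → Ok k q → In (suc t) r → (IsLeft t → r ≢ q) →
      ∃ λ i → In t i × nxt k q i ≡ just r
    nxt-onto {r = r} (flat p q) ok (a , b) _ = r , (subst (_< r) (sym p) a , subst (r ≤_) (sym q) b) , refl
    nxt-onto {r = r} (rise p q) ok (a , b) _ =
      suc r , (subst (_< suc r) (sym p) (s≤s a) , subst (suc r ≤_) (sym q) (s≤s b)) , refl
    nxt-onto {t} {q₀} {r} (left L@(p , q)) (c , d) (a , b) ne with <-cmp r q₀
    ... | tri≈ _ eq _ = contradiction eq (ne L)
    ... | tri< r< _ _ = suc r , (subst (_< suc r) (sym p) (s≤s a) , subst (suc r ≤_) (sym q) (≤-trans r< d)) , lem
      where
      lem : nxt (left L) q₀ (suc r) ≡ just r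
      lem with suc r ≤? q₀
      ... | yes _ = refl
      ... | no ¬r = contradiction r< ¬r
    ... | tri> _ _ r> = r , (subst (_< r) (sym p) (≤-<-trans c r>) , subst (r ≤_) (sym q) b) , lem
      where
      lem : nxt (left L) q₀ r ≡ just r
      lem with r ≤? q₀
      ... | yes r≤ = contradiction r≤ (<⇒≱ r>)
      ... | no _ = refl
    nxt-onto {t} {q₀} {r} (right R@(p , q)) refl (a , b) ne with r <? q₀
    ... | yes r< = r , (subst (_< r) (sym p) a , subst (r ≤_) (sym q) (m≤n⇒m≤1+n b)) , lem
      where
      lem : nxt (right R) q₀ r ≡ just r
      lem with <-cmp r q₀
      ... | tri< _ _ _ = refl
      ... | tri≈ ¬r _ _ = contradiction r< ¬r
      ... | tri> ¬r _ _ = contradiction r< ¬r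
    ... | no r≮ = suc r , (subst (_< suc r) (sym p) (m<n⇒m<1+n a) , subst (suc r ≤_) (sym q) (s≤s b)) , lem
      where
      lem : nxt (right R) q₀ (suc r) ≡ just r
      lem with <-cmp (suc r) q₀
      ... | tri< r< _ _ = contradiction (<-trans (n<1+n r) r<) r≮
      ... | tri≈ _ eq _ = contradiction (subst (r <_) eq (n<1+n r)) r≮
      ... | tri> _ _ _ = refl

    nxt-left-≢ : ∀ {t q i} (k : Kind t) → Ok k q → In t i → IsLeft t → nxt k q i ≢ just q
    nxt-left-≢ (flat p _) ok _ (r , _) eq = contradiction (trans (sym r) p) 1+n≢n
    nxt-left-≢ (rise _ q) ok _ (_ , r) eq = contradiction (trans (sym q) r) 1+n≢n
    nxt-left-≢ {q = q} {suc i} (left _) ok _ _ eq with suc i ≤? q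
    nxt-left-≢ {i = suc i} (left _) ok _ _ refl | yes a = 1+n≰n a
    nxt-left-≢ {i = suc i} (left _) ok _ _ refl | no a = a ≤-refl
    nxt-left-≢ (right p) ok _ r eq = left⇒¬right r p

    nxt-stay : ∀ {t q i} (k : Kind t) → Ok k q → IsRight t → i < fq t → nxt k q i ≡ just i
    nxt-stay (flat _ q) ok (_ , r) = contradiction (trans (sym r) q) 1+n≢n
    nxt-stay (rise p _) ok (r , _) = contradiction (trans (sym p) r) 1+n≢n
    nxt-stay (left p) ok r = contradiction r (left⇒¬right p)
    nxt-stay {t} {i = i} (right _) refl _ lt with <-cmp i (fq t)
    ... | tri< _ _ _ = refl
    ... | tri≈ ¬lt _ _ = contradiction lt ¬lt
    ... | tri> ¬lt _ _ = contradiction lt ¬lt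

    nxt-up : ∀ {t q i} (k : Kind t) → Ok k q → IsRight t → fq t < suc i → nxt k q (suc i) ≡ just i
    nxt-up (flat _ q) ok (_ , r) = contradiction (trans (sym r) q) 1+n≢n
    nxt-up (rise p _) ok (r , _) = contradiction (trans (sym p) r) 1+n≢n
    nxt-up (left p) ok r = contradiction r (left⇒¬right p)
    nxt-up {t} {i = i} (right _) refl _ gt with <-cmp (suc i) (fq t)
    ... | tri< _ _ ¬gt = contradiction gt ¬gt
    ... | tri≈ _ _ ¬gt = contradiction gt ¬gt
    ... | tri> _ _ _ = refl

    -- The right snake at which the strip through row i of diagonal t ends, given the choices cs made
    -- at the snakes t, t + 1, …
    E : List ℕ → ℕ → ℕ → ℕ
    E [] t i = t
    E (q ∷ cs) t i = maybe′ (E cs (suc t)) t (nxt (kind t) q i)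

    data Valid : ℕ → List ℕ → Set where
      done : Valid T []
      _∷_ : ∀ {t q cs} → Ok (kind t) q → Valid (suc t) cs → Valid t (q ∷ cs)

    valid-≤ : ∀ {t cs} → Valid t cs → t ≤ T
    valid-≤ done = ≤-refl
    valid-≤ (_ ∷ v) = <⇒≤ (valid-≤ v)

    in-end : ∀ {i} → ¬ In T i
    in-end (a , b) = contradiction (<-≤-trans a (subst (_ ≤_) end b)) n≮0

    l-end : ∀ {v} → T ≤ v → l v ≡ 0
    l-end {v} T≤v with m≤n⇒m<n∨m≡n T≤v
    ... | inj₂ refl = end
    l-end {suc v} T≤v | inj₁ (s≤s T≤v′) with l-step v | l-end T≤v′
    ... | inj₁ e | z = trans (sym e) z
    ... | inj₂ e | z = contradiction (trans (sym e) z) λ ()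

    in⇒<T : ∀ {t i} → In t i → t < T
    in⇒<T {t} (a , b) with t <? T
    ... | yes p = p
    ... | no ¬p = contradiction (<-≤-trans a (subst (_ ≤_) (l-end (≮⇒≥ ¬p)) b)) n≮0

    in-start : ∀ {i} → ¬ In 0 i
    in-start (a , b) = contradiction (<-≤-trans a (subst (_ ≤_) start b)) (<-irrefl refl)

    E-just : ∀ {q cs t i j} → nxt (kind t) q i ≡ just j → E (q ∷ cs) t i ≡ E cs (suc t) j
    E-just {cs = cs} {t} eq = cong (maybe′ (E cs (suc t)) t) eq

    E-nothing : ∀ {q cs t i} → nxt (kind t) q i ≡ nothing → E (q ∷ cs) t i ≡ t
    E-nothing {cs = cs} {t} eq = cong (maybe′ (E cs (suc t)) t) eq

    -- No membership of `i` in the diagonal is required: on the empty list `E` takes the current `t`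
    -- as a filler value.
    E-≥ : ∀ {t cs i} → Valid t cs → t ≤ E cs t i
    E-≥ done = ≤-refl
    E-≥ {t} {q ∷ cs} {i} (_ ∷ v) with nxt (kind t) q i
    ... | nothing = ≤-refl
    ... | just j = <⇒≤ (E-≥ {i = j} v)

    E-right : ∀ {t cs i} → Valid t cs → In t i → IsRight (E cs t i)
    E-right done i∈ = contradiction i∈ in-end
    E-right {t} {q ∷ cs} {i} (ok ∷ v) i∈ with nxt (kind t) q i in eq
    ... | nothing = proj₁ (nxt-nothing (kind t) ok eq)
    ... | just j = E-right v (proj₁ (nxt-in (kind t) ok i∈ eq))

    -- At most one row of a diagonal ends at each snake, and `nxt` is injective on the others. A
    -- strip that ends now cannot share its name with one that goes on, because the latter ends
    -- strictly later.
    E-inj : ∀ {t cs i j} → Valid t cs → In t i → In t j → E cs t i ≡ E cs t j → i ≡ j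
    E-inj done i∈ _ _ = contradiction i∈ in-end
    E-inj {t} {q ∷ cs} {i} {j} (ok ∷ v) i∈ j∈ e
      with nxt (kind t) q i in p | nxt (kind t) q j in r
    ... | nothing | nothing = trans (proj₂ (nxt-nothing (kind t) ok p)) (sym (proj₂ (nxt-nothing (kind t) ok r)))
    ... | nothing | just j′ = contradiction e (<⇒≢ (E-≥ {i = j′} v))
    ... | just i′ | nothing = contradiction (sym e) (<⇒≢ (E-≥ {i = i′} v))
    ... | just i′ | just j′ = nxt-inj (kind t) ok i∈ j∈ p (trans r (cong just (sym i′≡j′)))
      where
      i′≡j′ : i′ ≡ j′
      i′≡j′ = E-inj v (proj₁ (nxt-in (kind t) ok i∈ p)) (proj₁ (nxt-in (kind t) ok j∈ r)) e

    -- The intervals recorded by the starting squares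

    intervals : List ℕ → ℕ → List (ℕ × ℕ)
    intervals [] t = []
    intervals (q ∷ cs) t with left? t
    ... | yes _ = (t , E cs (suc t) q) ∷ intervals cs (suc t)
    ... | no _ = intervals cs (suc t)

    Ok-left : ∀ {t q} (k : Kind t) → Ok k q → IsLeft t → In (suc t) q
    Ok-left (flat p _) ok (r , _) = contradiction (trans (sym r) p) 1+n≢n
    Ok-left (rise _ q) ok (_ , r) = contradiction (trans (sym q) r) 1+n≢n
    Ok-left (left _) ok _ = ok
    Ok-left (right p) ok r = contradiction p (left⇒¬right r)

    left-Ok : ∀ {t q} (k : Kind t) → IsLeft t → In (suc t) q → Ok k q
    left-Ok (flat p _) (r , _) _ = contradiction (trans (sym r) p) 1+n≢n
    left-Ok (rise _ q) (_ , r) _ = contradiction (trans (sym q) r) 1+n≢n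
    left-Ok (left _) _ i∈ = i∈
    left-Ok (right p) r _ = contradiction p (left⇒¬right r)

    IsInterval : ℕ → ℕ × ℕ → Set
    IsInterval t (u , v) = t ≤ u × u < v × IsLeft u × IsRight v

    intervals-are : ∀ {t cs} → Valid t cs → All (IsInterval t) (intervals cs t)
    intervals-are done = []
    intervals-are {t} {q ∷ cs} (ok ∷ v) with left? t
    ... | yes L = (≤-refl , E-≥ {i = q} v , L , E-right v (Ok-left (kind t) ok L)) ∷ rest
      where
      rest : All (IsInterval t) (intervals cs (suc t))
      rest = All.map (λ (a , b) → <⇒≤ a , b) (intervals-are v)
    ... | no _ = All.map (λ (a , b) → <⇒≤ a , b) (intervals-are v)

    intervals-firsts : ∀ {t cs} → Valid t cs → map proj₁ (intervals cs t) ≡ lefts (length cs) t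
    intervals-firsts done = refl
    intervals-firsts {t} {q ∷ cs} (ok ∷ v) with left? t
    ... | yes _ = cong (t ∷_) (intervals-firsts v)
    ... | no _ = intervals-firsts v

    -- A strip already present on diagonal `t` never enters the starting row of a left snake, by
    -- `nxt-left-≢`, and a different row has a different name, by `E-inj`. This makes the second
    -- entries of the intervals distinct.
    intervals-fresh : ∀ {t cs i u v} → Valid t cs → In t i → (u , v) ∈ intervals cs t → E cs t i ≢ v
    intervals-fresh done i∈ p = contradiction i∈ in-end
    intervals-fresh {t} {q ∷ cs} {i} (ok ∷ va) i∈ p e with left? t | nxt (kind t) q i in eq
    intervals-fresh {t} {q ∷ cs} {i} (ok ∷ va) i∈ p e | yes L | nothing =
      left⇒¬right L (proj₁ (nxt-nothing (kind t) ok eq))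
    intervals-fresh {t} {q ∷ cs} {i} (ok ∷ va) i∈ (here refl) e | yes L | just j =
      nxt-left-≢ (kind t) ok i∈ L (trans eq (cong just
        (E-inj va (proj₁ (nxt-in (kind t) ok i∈ eq)) (Ok-left (kind t) ok L) e)))
    intervals-fresh {t} {q ∷ cs} {i} (ok ∷ va) i∈ (there p) e | yes L | just j =
      intervals-fresh va (proj₁ (nxt-in (kind t) ok i∈ eq)) p e
    intervals-fresh {t} {q ∷ cs} {i} (ok ∷ va) i∈ p e | no _ | nothing with All.lookup (intervals-are va) p
    ... | a , b , _ = contradiction e (<⇒≢ (<-trans a b))
    intervals-fresh {t} {q ∷ cs} {i} (ok ∷ va) i∈ p e | no _ | just j =
      intervals-fresh va (proj₁ (nxt-in (kind t) ok i∈ eq)) p e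

    intervals-seconds-unique : ∀ {t cs} → Valid t cs → Unique (map proj₂ (intervals cs t))
    intervals-seconds-unique done = []
    intervals-seconds-unique {t} {q ∷ cs} (ok ∷ v) with left? t
    ... | no _ = intervals-seconds-unique v
    ... | yes L = ∉⇒All≢ fresh ∷ intervals-seconds-unique v
      where
      fresh : E cs (suc t) q ∉ map proj₂ (intervals cs (suc t))
      fresh p with ∈-map⁻ proj₂ p
      ... | (u , w) , uw∈ , eq = intervals-fresh v (Ok-left (kind t) ok L) uw∈ eq

    -- Names of all squares and sizes of strips

    labels : List ℕ → ℕ → List ℕ
    labels [] t = []
    labels (q ∷ cs) t = map (E (q ∷ cs) t) (rows (m t) (l t)) ++ labels cs (suc t)

    state-unique : ∀ {t cs} → Valid t cs → Unique (map (E cs t) (rows (m t) (l t)))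
    state-unique {t} v = unique-map⁺-local
      (λ p q → E-inj v (∈-rows⁻ _ _ p) (∈-rows⁻ _ _ q)) (rows-unique _ _)

    ∈-state⁺ : ∀ {t i} cs → In t i → E cs t i ∈ map (E cs t) (rows (m t) (l t))
    ∈-state⁺ {t} cs (a , b) = ∈-map⁺ (E cs t) (∈-rows⁺ a b)

    ∈-state⁻ : ∀ {t v} cs → v ∈ map (E cs t) (rows (m t) (l t)) → ∃ λ i → In t i × v ≡ E cs t i
    ∈-state⁻ {t} cs p with ∈-map⁻ (E cs t) p
    ... | i , i∈ , eq = i , ∈-rows⁻ _ _ i∈ , eq

    labels-≥ : ∀ {t cs v} → Valid t cs → v ∈ labels cs t → t ≤ v
    labels-≥ {t} {q ∷ cs} va@(_ ∷ va′) p with ∈-++⁻ (map (E (q ∷ cs) t) (rows (m t) (l t))) p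
    ... | inj₁ r = let (i , _ , eq) = ∈-state⁻ (q ∷ cs) r in subst (t ≤_) (sym eq) (E-≥ {i = i} va)
    ... | inj₂ r = <⇒≤ (labels-≥ va′ r)

    -- The strip has one square on each diagonal from `t` to its end. The current diagonal
    -- contributes exactly one since its names are distinct; once the strip has ended, all later
    -- names are larger.
    count-state : ∀ {t cs i} → Valid t cs → In t i → countL (E cs t i) (labels cs t) + t ≡ suc (E cs t i)
    count-state done i∈ = contradiction i∈ in-end
    count-state {t} {q ∷ cs} {i} va@(ok ∷ va′) i∈ = trans (cong (_+ t) count₁) (lem (nxt (kind t) q i) refl)
      where
      v = E (q ∷ cs) t i
      count₁ : countL v (labels (q ∷ cs) t) ≡ suc (countL v (labels cs (suc t)))
      count₁ = trans (countL-++ v (map (E (q ∷ cs) t) (rows (m t) (l t))) _)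
                 (cong (_+ countL v (labels cs (suc t))) (countL-unique (state-unique va) (∈-state⁺ (q ∷ cs) i∈)))
      lem : ∀ r → nxt (kind t) q i ≡ r → suc (countL v (labels cs (suc t))) + t ≡ suc v
      lem nothing eq = cong suc (trans (cong (_+ t) (countL-∉ v∉)) (sym v≡t))
        where
        v≡t : v ≡ t
        v≡t = E-nothing {q} {cs} eq
        v∉ : v ∉ labels cs (suc t)
        v∉ p = contradiction (subst (suc t ≤_) v≡t (labels-≥ va′ p)) 1+n≰n
      lem (just j) eq = trans (sym (+-suc _ t))
        (subst (λ z → countL z (labels cs (suc t)) + suc t ≡ suc z) (sym (E-just {q} {cs} eq))
          (count-state va′ (proj₁ (nxt-in (kind t) ok i∈ eq))))

    -- Diagonals up to `u` contain no square of this name by `intervals-fresh`; from `u + 1` on,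
    -- `count-state` applies. The sum form avoids truncated subtraction.
    count-interval : ∀ {t cs u v} → Valid t cs → (u , v) ∈ intervals cs t → countL v (labels cs t) + u ≡ v
    count-interval {t} {q ∷ cs} {u} {v} va@(ok ∷ va′) p = trans (cong (_+ u) count₀) (lem p)
      where
      v∉ : v ∉ map (E (q ∷ cs) t) (rows (m t) (l t))
      v∉ r with ∈-state⁻ (q ∷ cs) r
      ... | i , i∈ , eq = intervals-fresh va i∈ p (sym eq)
      count₀ : countL v (labels (q ∷ cs) t) ≡ countL v (labels cs (suc t))
      count₀ = trans (countL-++ v (map (E (q ∷ cs) t) (rows (m t) (l t))) _)
                 (cong (_+ countL v (labels cs (suc t))) (countL-∉ v∉))
      lem : (u , v) ∈ intervals (q ∷ cs) t → countL v (labels cs (suc t)) + u ≡ v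
      lem p with left? t
      lem (here refl) | yes L = suc-injective (trans (sym (+-suc _ t)) (count-state va′ (Ok-left (kind t) ok L)))
      lem (there p′) | yes L = count-interval va′ p′
      lem p | no _ = count-interval va′ p

    -- At `t = 0` the diagonal is empty, so only the second alternative remains and every name is
    -- the second entry of an interval.
    labels-cover : ∀ {t cs v} → Valid t cs → v ∈ labels cs t →
      (∃ λ i → In t i × E cs t i ≡ v) ⊎ v ∈ map proj₂ (intervals cs t)
    labels-cover {t} {q ∷ cs} {v} (ok ∷ va) p with ∈-++⁻ (map (E (q ∷ cs) t) (rows (m t) (l t))) p
    ... | inj₁ r = let (i , i∈ , eq) = ∈-state⁻ (q ∷ cs) r in inj₁ (i , i∈ , sym eq)
    ... | inj₂ r with labels-cover va r
    ... | inj₂ s = inj₂ s′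
      where
      s′ : v ∈ map proj₂ (intervals (q ∷ cs) t)
      s′ with left? t
      ... | yes _ = there s
      ... | no _ = s
    ... | inj₁ (j , j∈ , eq) with left? t
    ... | no ¬L = let (i , i∈ , e) = nxt-onto (kind t) ok j∈ (λ L → contradiction L ¬L)
                  in inj₁ (i , i∈ , trans (E-just {q} {cs} e) eq)
    ... | yes L with j ≟ q
    ... | yes refl = inj₂ (here (sym eq))
    ... | no j≢q = let (i , i∈ , e) = nxt-onto (kind t) ok j∈ (λ _ → j≢q)
                   in inj₁ (i , i∈ , trans (E-just {q} {cs} e) eq)

    E∈labels : ∀ {t cs i} → Valid t cs → In t i → E cs t i ∈ labels cs t
    E∈labels done i∈ = contradiction i∈ in-end
    E∈labels {t} {q ∷ cs} (_ ∷ _) i∈ = ∈-++⁺ˡ (∈-state⁺ (q ∷ cs) i∈)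

    seconds⊆labels : ∀ {t cs v} → Valid t cs → v ∈ map proj₂ (intervals cs t) → v ∈ labels cs t
    seconds⊆labels {t} {q ∷ cs} {v} (ok ∷ va) p = ∈-++⁺ʳ (map (E (q ∷ cs) t) (rows (m t) (l t))) (lem p)
      where
      lem : v ∈ map proj₂ (intervals (q ∷ cs) t) → v ∈ labels cs (suc t)
      lem p with left? t
      lem (here refl) | yes L = E∈labels va (Ok-left (kind t) ok L)
      lem (there p′) | yes L = seconds⊆labels va p′
      lem p | no _ = seconds⊆labels va p

    -- Enumerating the choices and recovering them from intervals

    choices : ℕ → ℕ → List (List ℕ)
    choices zero t = [] ∷ []
    choices (suc n) t = cartesianProductWith _∷_ (opts (kind t)) (choices n (suc t))

    choices-unique : ∀ n t → Unique (choices n t)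
    choices-unique zero t = [] ∷ []
    choices-unique (suc n) t = Unique.cartesianProductWith⁺ _∷_ (λ { refl → refl , refl })
      (opts-unique (kind t)) (choices-unique n (suc t))

    ∈-choices⁻ : ∀ n t {cs} → n + t ≡ T → cs ∈ choices n t → Valid t cs
    ∈-choices⁻ zero t refl (here refl) = done
    ∈-choices⁻ (suc n) t eq p with ∈-cartesianProductWith⁻ _∷_ (opts (kind t)) (choices n (suc t)) p
    ... | q , cs , q∈ , cs∈ , refl = ∈-opts⁻ (kind t) q∈ ∷ ∈-choices⁻ n (suc t) (trans (+-suc n t) eq) cs∈

    valid-length : ∀ {t cs} → Valid t cs → length cs + t ≡ T
    valid-length done = refl
    valid-length {t} {q ∷ cs} (_ ∷ v) = trans (sym (+-suc (length cs) t)) (valid-length v)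

    ∈-choices⁺ : ∀ {t cs} → Valid t cs → cs ∈ choices (length cs) t
    ∈-choices⁺ done = here refl
    ∈-choices⁺ {t} (ok ∷ v) = ∈-cartesianProductWith⁺ _∷_ (∈-opts⁺ (kind t) ok) (∈-choices⁺ v)

    Ok-unique : ∀ {t q q′} (k : Kind t) → ¬ IsLeft t → Ok k q → Ok k q′ → q ≡ q′
    Ok-unique (flat _ _) _ refl refl = refl
    Ok-unique (rise _ _) _ refl refl = refl
    Ok-unique (left L) ¬L _ _ = contradiction L ¬L
    Ok-unique (right _) _ refl refl = refl

    -- Once the later choices are known to agree, `E-inj` recovers the starting row from the name of
    -- its strip.
    intervals-inj : ∀ {t cs cs′} → Valid t cs → Valid t cs′ → intervals cs t ≡ intervals cs′ t → cs ≡ cs′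
    intervals-inj done done _ = refl
    intervals-inj done (_ ∷ v) _ = contradiction (valid-≤ v) 1+n≰n
    intervals-inj (_ ∷ v) done _ = contradiction (valid-≤ v) 1+n≰n
    intervals-inj {t} {q ∷ cs} {q′ ∷ cs′} (ok ∷ v) (ok′ ∷ v′) eq with left? t
    ... | no ¬L = cong₂ _∷_ (Ok-unique (kind t) ¬L ok ok′) (intervals-inj v v′ eq)
    ... | yes L with ∷-injective eq
    ... | e , rest with intervals-inj v v′ rest
    ... | refl = cong (_∷ cs) (E-inj v (Ok-left (kind t) ok L) (Ok-left (kind t) ok′ L) (cong proj₂ e))

    someOk : ∀ {t} (k : Kind t) → ¬ IsLeft t → ∃ (Ok k)
    someOk (flat _ _) _ = 0 , refl
    someOk (rise _ _) _ = 0 , refl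
    someOk (left L) ¬L = contradiction L ¬L
    someOk {t} (right _) _ = fq t , refl

    -- Supplies the decomposition with which a minimal one is compared.
    someValid : (∀ t → m t ≤ l t) → ∀ n t → n + t ≡ T → ∃ (Valid t)
    someValid m≤l zero t refl = [] , done
    someValid m≤l (suc n) t eq with someValid m≤l n (suc t) (trans (+-suc n t) eq) | left? t
    ... | cs , v | no ¬L = let (q , ok) = someOk (kind t) ¬L in q ∷ cs , (ok ∷ v)
    -- Any row of diagonal `t + 1` would do; that diagonal is nonempty because it has one square
    -- more than diagonal `t`.
    ... | cs , v | yes L@(p , e) = l (suc t) ∷ cs , (left-Ok (kind t) L (q∈ , ≤-refl) ∷ v)
      where
      q∈ : m (suc t) < l (suc t)
      q∈ = ≤-trans (≤-reflexive (sym p)) (≤-trans (m≤l t) (≤-reflexive e))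

    -- Built from the right: the partner v of a left snake t is still the label of some row of
    -- diagonal t + 1, and that row is the choice to be made at t.
    intervals-onto : ∀ n t I → n + t ≡ T → map proj₁ I ≡ lefts n t →
      All (λ (u , v) → u < v × IsRight v) I → Unique (map proj₂ I) →
      ∃ λ cs → Valid t cs × intervals cs t ≡ I ×
        (∀ {v} → t ≤ v → IsRight v → v ∉ map proj₂ I → ∃ λ i → In t i × E cs t i ≡ v)
    intervals-onto zero t [] refl _ _ _ = [] , done , refl ,
      -- No right snake lies at or beyond `T`, since the profile of λ is zero there and cannot drop.
      λ {v} T≤v (_ , b) _ → contradiction (subst (0 <_) (l-end T≤v) (subst (0 <_) (sym b) (s≤s z≤n))) (<-irrefl refl)
    intervals-onto (suc n) t I n+t fs ps us with left? t in lt
    intervals-onto (suc n) t ((u , w) ∷ I) n+t fs ps us | yes L with ∷-injective fs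
    intervals-onto (suc n) t ((.t , w) ∷ I) n+t fs ((t<w , Rw) ∷ ps) us@(_ ∷ us′) | yes L | refl , fs′
      with intervals-onto n (suc t) I (trans (+-suc n t) n+t) fs′ ps us′
    -- The partner `w` is not a partner of a later left snake, so the invariant offers a row with
    -- this name.
    ... | cs , va , eq , inv with inv t<w Rw (Unique[x∷xs]⇒x∉xs us)
    ... | q , q∈ , Eq = q ∷ cs , (ok ∷ va) , eq′ , inv′
      where
      ok = left-Ok (kind t) L q∈
      eq′ : intervals (q ∷ cs) t ≡ (t , w) ∷ I
      eq′ rewrite lt = cong₂ _∷_ (cong (t ,_) Eq) eq
      inv′ : ∀ {v} → t ≤ v → IsRight v → v ∉ w ∷ map proj₂ I → ∃ λ i → In t i × E (q ∷ cs) t i ≡ v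
      inv′ {v} t≤v Rv v∉ with m≤n⇒m<n∨m≡n t≤v
      ... | inj₂ refl = contradiction Rv (left⇒¬right L)
      ... | inj₁ t<v with inv t<v Rv (v∉ ∘ there)
      ... | j , j∈ , e with nxt-onto (kind t) ok j∈ (λ _ j≡q → v∉ (here (trans (sym e) (trans (cong (E cs (suc t)) j≡q) Eq))))
      ... | i , i∈ , ne = i , i∈ , trans (E-just {q} {cs} ne) e
    intervals-onto (suc n) t I n+t fs ps us | no ¬L
      with intervals-onto n (suc t) I (trans (+-suc n t) n+t) fs ps us | someOk (kind t) ¬L
    ... | cs , va , eq , inv | q , ok = q ∷ cs , (ok ∷ va) , eq′ , inv′
      where
      eq′ : intervals (q ∷ cs) t ≡ I
      eq′ rewrite lt = eq
      -- A right snake at `t` itself is the name of row `fq t`; a later one is the name of a row of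
      -- the next diagonal, which is pulled back.
      inv′ : ∀ {v} → t ≤ v → IsRight v → v ∉ map proj₂ I → ∃ λ i → In t i × E (q ∷ cs) t i ≡ v
      inv′ {v} t≤v Rv v∉ with m≤n⇒m<n∨m≡n t≤v
      ... | inj₂ refl = fq t , fq-in t Rv , E-nothing {q} {cs} (nxt-fq (kind t) ok Rv)
      ... | inj₁ t<v with inv t<v Rv v∉
      ... | j , j∈ , e with nxt-onto (kind t) ok j∈ (λ L → contradiction L ¬L)
      ... | i , i∈ , ne = i , i∈ , trans (E-just {q} {cs} ne) e

    drop-cons : ∀ {t cs} → Valid t cs → ∀ k {s} → k + t ≡ s → s < T →
      ∃ λ q → drop k cs ≡ q ∷ drop (suc k) cs × Ok (kind s) q × Valid (suc s) (drop (suc k) cs)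
    drop-cons done zero refl lt = contradiction lt (<-irrefl refl)
    drop-cons (ok ∷ v) zero refl _ = _ , refl , ok , v
    drop-cons done (suc k) refl lt = contradiction (≤-<-trans (m≤n+m T (suc k)) lt) (<-irrefl refl)
    drop-cons {t} (_ ∷ v) (suc k) eq lt = drop-cons v k (trans (+-suc k t) eq) lt

    valid-end : ∀ {t cs} → Valid t cs → ∀ k → k + t ≡ T → drop k cs ≡ []
    valid-end done zero _ = refl
    valid-end (_ ∷ v) zero refl = contradiction (valid-≤ v) 1+n≰n
    valid-end done (suc k) _ = refl
    valid-end {t} (_ ∷ v) (suc k) eq = valid-end v k (trans (+-suc k t) eq)

    module _ {cs : List ℕ} (va : Valid 0 cs) where

      label : ℕ → ℕ → ℕ
      label s i = E (drop s cs) s i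

      choice : ∀ {s} → s < T → ∃ λ q → drop s cs ≡ q ∷ drop (suc s) cs × Ok (kind s) q × Valid (suc s) (drop (suc s) cs)
      choice {s} s<T = drop-cons va s (+-identityʳ s) s<T

      valid-drop : ∀ {s} → s < T → Valid s (drop s cs)
      valid-drop {s} s<T with choice s<T
      ... | q , eq , ok , v = subst (Valid s) (sym eq) (ok ∷ v)

      label-just : ∀ {s q i j} → drop s cs ≡ q ∷ drop (suc s) cs → nxt (kind s) q i ≡ just j →
        label s i ≡ label (suc s) j
      label-just {s} {q} {i} eq e = trans (cong (λ z → E z s i) eq) (E-just {q} {drop (suc s) cs} e)

      label-thin : ∀ {t i j} → In t i → In t j → label t i ≡ label t j → i ≡ j
      label-thin i∈ = E-inj (valid-drop (in⇒<T i∈)) i∈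

      -- A strip ending at `t` is named `t`, whereas every name on a later diagonal `t′` is at least
      -- `t′`. So a name that occurs later belongs to a strip that goes on.
      label-linked : ∀ {t t′ i j} → t < t′ → In t i → In t′ j → label t i ≡ label t′ j →
        ∃ λ i′ → In (suc t) i′ × label (suc t) i′ ≡ label t i × (i′ ≡ i ⊎ i ≡ suc i′)
      label-linked {t} {t′} {i} {j} t<t′ i∈ j∈ e with choice (in⇒<T i∈)
      ... | q , eq , ok , v with nxt (kind t) q i in n
      ... | just i′ = let (i′∈ , adj) = nxt-in (kind t) ok i∈ n in
            i′ , i′∈ , sym (label-just eq n) , adj
      ... | nothing = contradiction
            (trans (sym (trans (cong (λ z → E z t i) eq) (E-nothing {q} {drop (suc t) cs} n))) e)
            (<⇒≢ (<-≤-trans t<t′ (E-≥ {i = j} (valid-drop (in⇒<T j∈)))))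

      label-right : ∀ {t i} → In t i → IsRight (label t i)
      label-right i∈ = E-right (valid-drop (in⇒<T i∈)) i∈

      labels-drop : ∀ n t → n + t ≡ T → map (λ (s , i) → label s i) (diagPairs n t) ≡ labels (drop t cs) t
      labels-drop zero t refl with drop t cs | valid-end va t (+-identityʳ t)
      ... | .[] | refl = refl
      labels-drop (suc n) t eq with choice {t} (subst (t <_) eq (s≤s (m≤n+m t n)))
      ... | q , e , _ = trans (map-++ _ (map (t ,_) (rows (m t) (l t))) (diagPairs n (suc t)))
        (trans (cong₂ _++_ (sym (map-∘ (rows (m t) (l t)))) (labels-drop n (suc t) (trans (+-suc n t) eq)))
          (trans (cong (λ z → map (E z t) (rows (m t) (l t)) ++ labels (drop (suc t) cs) (suc t)) e)
            (cong (λ z → labels z t) (sym e))))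

    -- How many labels a labelling of the diagonals needs

    module Labelling (lab : ℕ → ℕ → ℕ)
      (thin : ∀ {t i j} → In t i → In t j → lab t i ≡ lab t j → i ≡ j)
      (linked : ∀ {t t′ i j} → t < t′ → In t i → In t′ j → lab t i ≡ lab t′ j →
        ∃ λ i′ → In (suc t) i′ × lab (suc t) i′ ≡ lab t i × (i′ ≡ i ⊎ i ≡ suc i′)) where

      EndAt : ℕ → ℕ → Set
      EndAt b t = ∃ λ i → In t i × lab t i ≡ b × (∀ {j} → In (suc t) j → lab (suc t) j ≢ b)

      end-unique : ∀ {b t t′} → EndAt b t → EndAt b t′ → t ≡ t′
      end-unique {b} {t} {t′} (i , i∈ , e , last) (i′ , i′∈ , e′ , last′) with <-cmp t t′
      ... | tri≈ _ p _ = p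
      ... | tri< t<t′ _ _ with linked t<t′ i∈ i′∈ (trans e (sym e′))
      ... | j , j∈ , eq , _ = contradiction (trans eq e) (last j∈)
      end-unique {b} {t} {t′} (i , i∈ , e , last) (i′ , i′∈ , e′ , last′) | tri> _ _ t′<t
        with linked t′<t i′∈ i∈ (trans e′ (sym e))
      ... | j , j∈ , eq , _ = contradiction (trans eq e′) (last′ j∈)

      diag : ℕ → List ℕ
      diag t = map (lab t) (rows (m t) (l t))

      ∈-diag⁺ : ∀ {t i} → In t i → lab t i ∈ diag t
      ∈-diag⁺ {t} (a , b) = ∈-map⁺ (lab t) (∈-rows⁺ a b)

      ∈-diag⁻ : ∀ {t b} → b ∈ diag t → ∃ λ i → In t i × b ≡ lab t i
      ∈-diag⁻ {t} p with ∈-map⁻ (lab t) p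
      ... | i , i∈ , e = i , ∈-rows⁻ _ _ i∈ , e

      length-diag : ∀ t → length (diag t) ≡ l t ∸ m t
      length-diag t = trans (length-map (lab t) (rows (m t) (l t))) (length-rows (m t) (l t))

      -- A right snake has one square fewer on its second diagonal.
      right⇒end : (∀ t → m t ≤ l t) → ∀ {t} → IsRight t → ∃ λ b → EndAt b t
      right⇒end m≤l {t} (p , q) with pigeonhole-∉ {diag t} {diag (suc t)}
        (unique-map⁺-local (λ a b → thin (∈-rows⁻ _ _ a) (∈-rows⁻ _ _ b)) (rows-unique _ _)) shorter
        where
        shorter : length (diag (suc t)) < length (diag t)
        shorter = ≤-reflexive (trans (cong suc (length-diag (suc t)))
          (sym (trans (length-diag t) (trans (cong₂ _∸_ q p) (+-∸-assoc 1 (m≤l (suc t)))))))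
      ... | b , b∈ , b∉ with ∈-diag⁻ b∈
      ... | i , i∈ , e = b , i , i∈ , sym e , λ j∈ eq → b∉ (subst (_∈ diag (suc t)) eq (∈-diag⁺ j∈))

      rights : List ℕ
      rights = filter right? (upTo T)

      module _ (m≤l : ∀ t → m t ≤ l t) where

        endLabels : ∀ ts → Unique ts → All IsRight ts →
          ∃ λ bs → Unique bs × length bs ≡ length ts × (∀ {b} → b ∈ bs → ∃ λ t → t ∈ ts × EndAt b t)
        endLabels [] _ _ = [] , [] , refl , λ ()
        endLabels (t ∷ ts) u@(_ ∷ us) (R ∷ Rs) with right⇒end m≤l R | endLabels ts us Rs
        ... | b , e | bs , ub , len , f = b ∷ bs , ∉⇒All≢ b∉ ∷ ub , cong suc len , g
          where
          b∉ : b ∉ bs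
          b∉ p with f p
          ... | t′ , t′∈ , e′ = Unique[x∷xs]⇒x∉xs u (subst (_∈ ts) (sym (end-unique e e′)) t′∈)
          g : ∀ {b′} → b′ ∈ b ∷ bs → ∃ λ t′ → t′ ∈ t ∷ ts × EndAt b′ t′
          g (here refl) = t , here refl , e
          g (there p) = let (t′ , t′∈ , e′) = f p in t′ , there t′∈ , e′

        rights-endLabels : ∃ λ bs → Unique bs × length bs ≡ length rights × (∀ {b} → b ∈ bs → ∃ λ t → IsRight t × EndAt b t)
        rights-endLabels with endLabels rights (Unique.filter⁺ right? (upTo⁺ T)) (all-filter right? (upTo T))
        ... | bs , u , len , f = bs , u , len ,
              λ p → let (t , t∈ , e) = f p in t , proj₂ (∈-filter⁻ right? {xs = upTo T} t∈) , e

        module _ (n : ℕ) (bound : ∀ {t i} → In t i → lab t i < n) where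

          private
            bs = proj₁ rights-endLabels
            ends : ∀ {b} → b ∈ bs → ∃ λ t → IsRight t × EndAt b t
            ends = proj₂ (proj₂ (proj₂ rights-endLabels))
            bs⊆ : ∀ {b} → b ∈ bs → b ∈ upTo n
            bs⊆ p with ends p
            ... | t , _ , i , i∈ , refl , _ = ∈-upTo⁺ (bound i∈)

          rights≤ : length rights ≤ n
          rights≤ = subst₂ _≤_ (proj₁ (proj₂ (proj₂ rights-endLabels))) (length-upTo n)
            (unique∧⊆⇒length≤ (proj₁ (proj₂ rights-endLabels)) bs⊆)

          -- With no more labels than right snakes, the labels ending at right snakes are all
          -- labels. A label stopping elsewhere would have two ends, against `end-unique`.
          continues : n ≤ length rights → ∀ {t i} → ¬ IsRight t → In t i →
            ∃ λ i′ → In (suc t) i′ × lab (suc t) i′ ≡ lab t i × (i′ ≡ i ⊎ i ≡ suc i′)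
          continues n≤ {t} {i} ¬R i∈ with lab t i ∈? diag (suc t)
          ... | yes p = let (j , j∈ , e) = ∈-diag⁻ p in linked (n<1+n t) i∈ j∈ e
          ... | no p with ends (unique-⊆-≥⇒⊇ (proj₁ (proj₂ rights-endLabels)) bs⊆
                  (subst₂ _≤_ (sym (length-upTo n)) (sym (proj₁ (proj₂ (proj₂ rights-endLabels)))) n≤)
                  (∈-upTo⁺ (bound i∈)))
          ... | t′ , R′ , e = contradiction
                (subst IsRight (end-unique e (i , i∈ , refl , λ j∈ eq → p (subst (_∈ diag (suc t)) eq (∈-diag⁺ j∈)))) R′) ¬R

      -- Recovering the choices from a labelling

      module _ (m≤l : ∀ t → m t ≤ l t)
        (contin : ∀ {t i} → ¬ IsRight t → In t i →
          ∃ λ i′ → In (suc t) i′ × lab (suc t) i′ ≡ lab t i × (i′ ≡ i ⊎ i ≡ suc i′))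
        (fixed< : ∀ {t i} → IsRight t → In t i → i < fq t → lab (suc t) i ≡ lab t i)
        (fixed> : ∀ {t i} → IsRight t → In t i → fq t < i → lab (suc t) (pred i) ≡ lab t i) where

        Up Stay : ℕ → ℕ → Set
        Up t i = In (suc t) (pred i) × lab (suc t) (pred i) ≡ lab t i
        Stay t i = In (suc t) i × lab (suc t) i ≡ lab t i

        turn : ∀ {t} → ¬ IsRight t → ∃ λ c → m t ≤ c × c ≤ l t ×
          (∀ i → m t < i → i ≤ c → Up t i) × (∀ i → c < i → i ≤ l t → Stay t i)
        turn {t} ¬R = threshold (Up t) (Stay t) (m t) (l t) (m≤l t)
          (λ i a b → split (contin ¬R (a , b)))
          (λ i a b (_ , e) (_ , e′) → contradiction (thin (a , <⇒≤ b) (m<n⇒m<1+n a , b) (trans (sym e) e′)) (1+n≢n ∘ sym))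
          where
          split : ∀ {i} → (∃ λ i′ → In (suc t) i′ × lab (suc t) i′ ≡ lab t i × (i′ ≡ i ⊎ i ≡ suc i′)) → Up t i ⊎ Stay t i
          split (i′ , i′∈ , e , inj₁ refl) = inj₂ (i′∈ , e)
          split (i′ , i′∈ , e , inj₂ refl) = inj₁ (i′∈ , e)

        -- If `m` and `l` are both constant, the first row cannot go up; if both drop, the last row
        -- cannot stay. So the switch is forced to an end of the diagonal, and only a left snake
        -- leaves it free. At a right snake the given links prescribe the moves.
        followed : ∀ {t} (k : Kind t) → ∃ λ q → Ok k q ×
          (∀ {i j} → In t i → nxt k q i ≡ just j → lab (suc t) j ≡ lab t i)
        followed {t} (flat p q) with turn {t} (λ (_ , r) → contradiction (trans (sym r) q) 1+n≢n)
        ... | c , m≤c , c≤l , ups , stays with m≤n⇒m<n∨m≡n m≤c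
        ... | inj₁ m<c = contradiction (proj₁ (proj₁ (ups (suc (m t)) ≤-refl m<c))) (λ lt → <-irrefl (sym p) lt)
        ... | inj₂ refl = 0 , refl , λ { (a , b) refl → proj₂ (stays _ a b) }
        followed {t} (rise p q) with turn {t} (λ (r , _) → contradiction (trans (sym p) r) 1+n≢n)
        ... | c , m≤c , c≤l , ups , stays with m≤n⇒m<n∨m≡n c≤l
        ... | inj₁ c<l = contradiction (subst (_≤ l (suc t)) q (proj₂ (proj₁ (stays (l t) c<l ≤-refl)))) 1+n≰n
        ... | inj₂ refl = 0 , refl , λ { (a , b) refl → proj₂ (ups _ a b) }
        -- Rows up to `c` go to rows below `c` in number and the others stay beyond `c`, so row `c`
        -- of diagonal `t + 1` is not entered: it is where a strip starts.
        followed {t} (left L@(p , q)) with turn {t} (left⇒¬right L)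
        ... | c , m≤c , c≤l , ups , stays = c , (subst (_≤ c) p m≤c , subst (c ≤_) q c≤l) , f
          where
          f : ∀ {i j} → In t i → nxt (left L) c i ≡ just j → lab (suc t) j ≡ lab t i
          f {i} (a , b) e with i ≤? c
          f {i} (a , b) refl | yes r = proj₂ (ups i a r)
          f {i} (a , b) refl | no r = proj₂ (stays i (≰⇒> r) b)
        followed {t} (right R) = fq t , refl , f
          where
          f : ∀ {i j} → In t i → nxt (right R) (fq t) i ≡ just j → lab (suc t) j ≡ lab t i
          f {i} i∈ e with <-cmp i (fq t)
          f {i} i∈ refl | tri< r _ _ = fixed< R i∈ r
          f {i} i∈ refl | tri> _ _ r = fixed> R i∈ r

        follow : ℕ → ℕ → List ℕ
        follow zero t = []
        follow (suc n) t = proj₁ (followed (kind t)) ∷ follow n (suc t)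

        follow-valid : ∀ n t → n + t ≡ T → Valid t (follow n t)
        follow-valid zero t refl = done
        follow-valid (suc n) t eq = proj₁ (proj₂ (followed (kind t))) ∷ follow-valid n (suc t) (trans (+-suc n t) eq)

        chosen-valid : Valid 0 (follow T 0)
        chosen-valid = follow-valid T 0 (+-identityʳ T)

        follow-label : ∀ n t → n + t ≡ T → ∀ {i} → In t i →
          lab t i ≡ lab (E (follow n t) t i) (fq (E (follow n t) t i))
        follow-label zero t refl i∈ = contradiction i∈ in-end
        follow-label (suc n) t eq {i} i∈ with followed (kind t)
        ... | q , ok , f with nxt (kind t) q i in e
        ... | nothing = cong (lab t) (proj₂ (nxt-nothing (kind t) ok e))
        ... | just j = trans (sym (f i∈ e)) (follow-label n (suc t) (trans (+-suc n t) eq) (proj₁ (nxt-in (kind t) ok i∈ e)))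

        drop-follow : ∀ k n t → drop k (follow (k + n) t) ≡ follow n (k + t)
        drop-follow zero n t = refl
        drop-follow (suc k) n t = trans (drop-follow k n (suc t)) (cong (follow n) (+-suc k t))

        -- The original label is constant along the followed strip, so it can be read off at the
        -- last square of that strip. Equal names therefore force equal labels.
        chosen-label : ∀ {t i} → In t i →
          lab t i ≡ lab (label chosen-valid t i) (fq (label chosen-valid t i))
        chosen-label {t} {i} i∈ = subst (λ z → lab t i ≡ lab (E z t i) (fq (E z t i))) (sym eq)
            (follow-label n t (m∸n+n≡m t≤T) i∈)
          where
          t≤T = <⇒≤ (in⇒<T i∈)
          n = T ∸ t
          eq : drop t (follow T 0) ≡ follow n t
          eq = trans (cong (λ z → drop t (follow z 0)) (sym (m+[n∸m]≡n t≤T)))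
                 (trans (drop-follow t n 0) (cong (follow n) (+-identityʳ t)))

        -- If the label went on past `v`, it would appear in some row of diagonal `v + 1`. That row
        -- continues a row of diagonal `v` with the same label, by `thin` the row `fq v`, yet `fq v`
        -- has no continuation.
        ends-here : ∀ {v v′} → IsRight v → IsRight v′ → v < v′ → lab v (fq v) ≢ lab v′ (fq v′)
        ends-here {v} {v′} R R′ v<v′ e with linked v<v′ (fq-in v R) (fq-in v′ R′) e | followed (kind v)
        ... | j , j∈ , e′ , _ | q , ok , f with nxt-onto (kind v) ok j∈ (λ L → contradiction R (left⇒¬right L))
        ... | i , i∈ , ne with thin i∈ (fq-in v R) (trans (sym (f i∈ ne)) e′)
        ... | refl = contradiction (trans (sym ne) (nxt-fq (kind v) ok R)) λ ()

        sameKernel : ∀ {t i t′ i′} → In t i → In t′ i′ →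
          (lab t i ≡ lab t′ i′ → label chosen-valid t i ≡ label chosen-valid t′ i′) ×
          (label chosen-valid t i ≡ label chosen-valid t′ i′ → lab t i ≡ lab t′ i′)
        sameKernel {t} {i} {t′} {i′} i∈ i′∈ = to ,
          (λ e → trans (chosen-label i∈) (trans (cong (λ v → lab v (fq v)) e) (sym (chosen-label i′∈))))
          where
          v = label chosen-valid t i
          v′ = label chosen-valid t′ i′
          to : lab t i ≡ lab t′ i′ → v ≡ v′
          to e with <-cmp v v′ | trans (sym (chosen-label i∈)) (trans e (chosen-label i′∈))
          ... | tri≈ _ p _ | _ = p
          ... | tri< p _ _ | e′ = contradiction e′ (ends-here (label-right chosen-valid i∈) (label-right chosen-valid i′∈) p)
          ... | tri> _ _ p | e′ = contradiction (sym e′) (ends-here (label-right chosen-valid i′∈) (label-right chosen-valid i∈) p)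

    -- If the starting rows at a left snake differed, the second family would continue a strip into
    -- the row `q` where the first family starts one. As the first family identifies whatever the
    -- second does, a continued strip of the first would enter `q` too.
    label-inj : ∀ {cs cs′} (va : Valid 0 cs) (va′ : Valid 0 cs′) →
      (∀ {t i t′ i′} → In t i → In t′ i′ → label va′ t i ≡ label va′ t′ i′ → label va t i ≡ label va t′ i′) →
      cs ≡ cs′
    label-inj {cs} {cs′} va va′ coarser = go T 0 (+-identityʳ T)
      where
      head≡ : ∀ {t q q′} → drop t cs ≡ q ∷ drop (suc t) cs → drop t cs′ ≡ q′ ∷ drop (suc t) cs′ →
        Ok (kind t) q → Ok (kind t) q′ → q ≡ q′
      head≡ {t} {q} {q′} e e′ ok ok′ with left? t
      ... | no ¬L = Ok-unique (kind t) ¬L ok ok′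
      ... | yes L with q ≟ q′
      ... | yes p = p
      ... | no q≢q′ with nxt-onto (kind t) ok′ (Ok-left (kind t) ok L) (λ _ → q≢q′)
      ... | i , i∈ , ne′ with nxt (kind t) q i in ne
      ... | nothing = contradiction (proj₁ (nxt-nothing (kind t) ok ne)) (left⇒¬right L)
      ... | just j = contradiction (trans ne (cong just j≡q)) (nxt-left-≢ (kind t) ok i∈ L)
        where
        j≡q : j ≡ q
        j≡q = label-thin va (proj₁ (nxt-in (kind t) ok i∈ ne)) (Ok-left (kind t) ok L)
          (trans (sym (label-just va e ne))
            (coarser i∈ (Ok-left (kind t) ok L) (label-just va′ e′ ne′)))
      go : ∀ n t → n + t ≡ T → drop t cs ≡ drop t cs′
      go zero t refl = trans (valid-end va t (+-identityʳ t)) (sym (valid-end va′ t (+-identityʳ t)))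
      go (suc n) t eq with choice va {t} (subst (t <_) eq (s≤s (m≤n+m t n))) | choice va′ {t} (subst (t <_) eq (s≤s (m≤n+m t n)))
      ... | q , e , ok , _ | q′ , e′ , ok′ , _ =
        trans e (trans (cong₂ _∷_ (head≡ e e′ ok ok′) (go n (suc t) (trans (+-suc n t) eq))) (sym e′))

-- Partitions and their profiles

Antitone : (ℕ → ℕ) → Set
Antitone A = ∀ i → A (suc i) ≤ A i

part-0 : ∀ α → part α 0 ≡ 0
part-0 [] = refl
part-0 (_ ∷ _) = refl

part-step : ∀ {α} → Linked (λ a b → b ≤ a) α → ∀ i → part α (suc (suc i)) ≤ part α (suc i)
part-step [] i = z≤n
part-step [-] i = z≤n
part-step (p ∷ _) zero = p
part-step (_ ∷ ps) (suc i) = part-step ps i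

part-mono : ∀ {α} → IsPartition α → ∀ {i i′} → 1 ≤ i → i ≤ i′ → part α i′ ≤ part α i
part-mono {α} (lk , _) {suc i} {suc i′} _ (s≤s i≤i′) = go (≤⇒≤′ i≤i′)
  where
  go : ∀ {k} → i ≤′ k → part α (suc k) ≤ part α (suc i)
  go ≤′-refl = ≤-refl
  go (≤′-step p) = ≤-trans (part-step lk _) (go p)

part-beyond : ∀ α {i} → length α < i → part α i ≡ 0
part-beyond [] _ = refl
part-beyond (a ∷ α) {suc (suc i)} (s≤s p) = part-beyond α p

-- Cut off at the first zero because parts must be positive; an antitone sequence loses nothing by
-- this.
build : (ℕ → ℕ) → ℕ → List ℕ
build A zero = []
build A (suc n) with A 0
... | zero = []
... | suc a = suc a ∷ build (A ∘ suc) n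

antitone-≤ : ∀ {A} → Antitone A → ∀ i → A i ≤ A 0
antitone-≤ anti zero = ≤-refl
antitone-≤ anti (suc i) = ≤-trans (anti i) (antitone-≤ anti i)

part-build : ∀ A n → Antitone A → (∀ i → n ≤ i → A i ≡ 0) → ∀ i → part (build A n) (suc i) ≡ A i
part-build A zero anti z i = sym (z i z≤n)
part-build A (suc n) anti z i with A 0 in eq
... | zero = sym (n≤0⇒n≡0 (subst (A i ≤_) eq (antitone-≤ anti i)))
part-build A (suc n) anti z zero | suc a = sym eq
part-build A (suc n) anti z (suc i) | suc a =
  part-build (A ∘ suc) n (anti ∘ suc) (λ i n≤i → z (suc i) (s≤s n≤i)) i

build-partition : ∀ A n → Antitone A → IsPartition (build A n)
build-partition A zero anti = [] , []
build-partition A (suc n) anti with A 0 in eq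
... | zero = [] , []
... | suc a with build-partition (A ∘ suc) n (anti ∘ suc)
... | lk , pos = link n (subst (A 1 ≤_) eq (anti 0)) lk , s≤s z≤n ∷ pos
  where
  link : ∀ n → A 1 ≤ suc a → Linked (λ a b → b ≤ a) (build (A ∘ suc) n) → Linked (λ a b → b ≤ a) (suc a ∷ build (A ∘ suc) n)
  link zero le lk = [-]
  link (suc n) le lk with A 1
  ... | zero = [-]
  ... | suc b = le ∷ lk

inSkew⁻ : ∀ la mu {i j} → Tr (inSkew la mu (i , j)) → part mu i < j × j ≤ part la i
inSkew⁻ la mu {i} {j} p = let (a , b) = Equivalence.to (T-∧ {part mu i <ᵇ j}) p in <ᵇ⇒< _ _ a , ≤ᵇ⇒≤ _ _ b

inSkew⁺ : ∀ la mu {i j} → part mu i < j → j ≤ part la i → Tr (inSkew la mu (i , j))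
inSkew⁺ la mu {i} {j} p q = Equivalence.from (T-∧ {part mu i <ᵇ j}) (<⇒<ᵇ p , ≤⇒≤ᵇ q)

inSkew-pos : ∀ la mu {i j} → Tr (inSkew la mu (i , j)) → 1 ≤ i × i ≤ length la
inSkew-pos la mu {zero} {j} p = let (a , b) = inSkew⁻ la mu p in
  contradiction (<-≤-trans a (subst (j ≤_) (part-0 la) b)) n≮0
inSkew-pos la mu {suc i} {j} p = s≤s z≤n , len
  where
  len : suc i ≤ length la
  len with suc i ≤? length la
  ... | yes q = q
  ... | no q = let (a , b) = inSkew⁻ la mu {suc i} {j} p in
    contradiction (<-≤-trans a (subst (j ≤_) (part-beyond la (≰⇒> q)) b)) n≮0

skew-convex : ∀ {la mu} → IsPartition la → IsPartition mu → ∀ {i j i′ j′ a b} →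
  Tr (inSkew la mu (i , j)) → Tr (inSkew la mu (i′ , j′)) → i ≤ a → a ≤ i′ → j ≤ b → b ≤ j′ →
  Tr (inSkew la mu (a , b))
skew-convex {la} {mu} pl pm {i} {j} p q i≤a a≤i′ j≤b b≤j′ =
  let (p₁ , _) = inSkew⁻ la mu p
      (_ , q₂) = inSkew⁻ la mu q
      (1≤i , _) = inSkew-pos la mu {i} {j} p
  in inSkew⁺ la mu (≤-<-trans (part-mono pm 1≤i i≤a) (<-≤-trans p₁ j≤b))
       (≤-trans b≤j′ (≤-trans q₂ (part-mono pl (≤-trans 1≤i i≤a) a≤i′)))

-- A finite order-convex set S of cells is the skew diagram A / B, where A is the order ideal
-- generated by S and B is the set of those c in A for which there is no s in S with s ≤ c.

module OrderConvex (xs : List Cell) where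

  upper : List Cell → ℕ → ℕ
  upper [] i = 0
  upper ((i′ , j′) ∷ ys) i with i ≤? i′
  ... | yes _ = j′ ⊔ upper ys i
  ... | no _ = upper ys i

  upper⁺ : ∀ {ys i j i′ j′} → (i′ , j′) ∈ ys → i ≤ i′ → j ≤ j′ → j ≤ upper ys i
  upper⁺ {(a , b) ∷ ys} {i} p i≤ j≤ with i ≤? a
  upper⁺ (here refl) i≤ j≤ | yes _ = ≤-trans j≤ (m≤m⊔n _ _)
  upper⁺ (there p) i≤ j≤ | yes _ = ≤-trans (upper⁺ p i≤ j≤) (m≤n⊔m _ _)
  upper⁺ (here refl) i≤ j≤ | no ¬p = contradiction i≤ ¬p
  upper⁺ (there p) i≤ j≤ | no _ = upper⁺ p i≤ j≤

  upper⁻ : ∀ ys {i j} → j < upper ys i → ∃ λ i′ → ∃ λ j′ → (i′ , j′) ∈ ys × i ≤ i′ × j < j′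
  upper⁻ ((a , b) ∷ ys) {i} j< with i ≤? a
  ... | no _ = let (i′ , j′ , p , q) = upper⁻ ys j< in i′ , j′ , there p , q
  ... | yes i≤a with <⊔⇒⊎ b (upper ys i) j<
  ... | inj₁ q = a , b , here refl , i≤a , q
  ... | inj₂ q = let (i′ , j′ , p , r) = upper⁻ ys q in i′ , j′ , there p , r

  A : ℕ → ℕ
  A = upper xs

  -- Starting from `A i` keeps `B` below `A`, so rows where no square precedes become empty.
  -- `pred j′` occurs because row `i` of A / B begins in column `B i + 1`.
  lower : List Cell → ℕ → ℕ
  lower [] i = A i
  lower ((i′ , j′) ∷ ys) i with i′ ≤? i
  ... | yes _ = pred j′ ⊓ lower ys i
  ... | no _ = lower ys i

  lower≤A : ∀ ys i → lower ys i ≤ A i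
  lower≤A [] i = ≤-refl
  lower≤A ((a , b) ∷ ys) i with a ≤? i
  ... | yes _ = ≤-trans (m⊓n≤n _ _) (lower≤A ys i)
  ... | no _ = lower≤A ys i

  lower⁺ : ∀ {ys i i′ j′} → (i′ , j′) ∈ ys → i′ ≤ i → lower ys i ≤ pred j′
  lower⁺ {(a , b) ∷ ys} {i} p i′≤ with a ≤? i
  lower⁺ {(a , b) ∷ ys} {i} (here refl) i′≤ | yes _ = m⊓n≤m _ _
  lower⁺ {(a , b) ∷ ys} {i} (there p) i′≤ | yes _ = ≤-trans (m⊓n≤n (pred b) _) (lower⁺ p i′≤)
  lower⁺ (here refl) i′≤ | no ¬p = contradiction i′≤ ¬p
  lower⁺ (there p) i′≤ | no _ = lower⁺ p i′≤

  lower⁻ : ∀ ys {i j} → lower ys i < j → A i < j ⊎ (∃ λ i′ → ∃ λ j′ → (i′ , j′) ∈ ys × i′ ≤ i × pred j′ < j)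
  lower⁻ [] p = inj₁ p
  lower⁻ ((a , b) ∷ ys) {i} {j} p with a ≤? i
  ... | no _ with lower⁻ ys p
  ... | inj₁ q = inj₁ q
  ... | inj₂ (i′ , j′ , q , r) = inj₂ (i′ , j′ , there q , r)
  lower⁻ ((a , b) ∷ ys) {i} {j} p | yes a≤i with ⊓-sel (pred b) (lower ys i)
  ... | inj₁ e = inj₂ (a , b , here refl , a≤i , subst (_< j) e p)
  ... | inj₂ e with lower⁻ ys (subst (_< j) e p)
  ... | inj₁ q = inj₁ q
  ... | inj₂ (i′ , j′ , q , r) = inj₂ (i′ , j′ , there q , r)

  B : ℕ → ℕ
  B = lower xs

  A-antitone : Antitone A
  A-antitone i with A (suc i) ≤? A i
  ... | yes p = p
  ... | no ¬p = let (i′ , j′ , q , r , s) = upper⁻ xs (≰⇒> ¬p) in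
    contradiction (<-≤-trans s (upper⁺ q (≤-trans (n≤1+n i) r) ≤-refl)) (<-irrefl refl)

  B-antitone : Antitone B
  B-antitone i with B (suc i) ≤? B i
  ... | yes p = p
  ... | no ¬p with lower⁻ xs (≰⇒> ¬p)
  ... | inj₁ q = contradiction (<-≤-trans q (≤-trans (lower≤A xs (suc i)) (A-antitone i))) (<-irrefl refl)
  ... | inj₂ (i′ , j′ , q , r , s) = contradiction (<-≤-trans s (lower⁺ q (m≤n⇒m≤1+n r))) (<-irrefl refl)

  bound : List Cell → ℕ
  bound [] = 0
  bound ((i , _) ∷ ys) = i ⊔ bound ys

  bound-≥ : ∀ {ys i j} → (i , j) ∈ ys → i ≤ bound ys
  bound-≥ (here refl) = m≤m⊔n _ _
  bound-≥ {(a , _) ∷ ys} (there p) = ≤-trans (bound-≥ p) (m≤n⊔m a _)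

  A-zero : ∀ i → bound xs ≤ i → A (suc i) ≡ 0
  A-zero i b≤i with A (suc i) in eq
  ... | zero = refl
  ... | suc a = let (i′ , j′ , q , r , s) = upper⁻ xs {suc i} {a} (≤-reflexive (sym eq)) in
    contradiction (≤-trans r (≤-trans (bound-≥ q) b≤i)) 1+n≰n

  isSkew : (S : Cell → Set) → (∀ {c} → S c → c ∈ xs) → (∀ {c} → c ∈ xs → S c) →
    (∀ {i j} → S (i , j) → 1 ≤ i × 1 ≤ j) →
    (∀ {i j i′ j′ a b} → S (i , j) → S (i′ , j′) → i ≤ a → a ≤ i′ → j ≤ b → b ≤ j′ → S (a , b)) →
    IsSkewDiagram S
  isSkew S S⊆ ⊆S pos convex =
    la′ , mu′ , build-partition (A ∘ suc) n (A-antitone ∘ suc) , build-partition (B ∘ suc) n (B-antitone ∘ suc) ,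
    contains , λ c → to c , from c
    where
    n = bound xs
    la′ = build (A ∘ suc) n
    mu′ = build (B ∘ suc) n
    pa : ∀ i → part la′ (suc i) ≡ A (suc i)
    pa = part-build (A ∘ suc) n (A-antitone ∘ suc) A-zero
    pb : ∀ i → part mu′ (suc i) ≡ B (suc i)
    pb = part-build (B ∘ suc) n (B-antitone ∘ suc)
      (λ i p → n≤0⇒n≡0 (subst (B (suc i) ≤_) (A-zero i p) (lower≤A xs (suc i))))
    contains : Contains la′ mu′
    contains zero = ≤-trans (≤-reflexive (part-0 mu′)) z≤n
    contains (suc i) = subst₂ _≤_ (sym (pb i)) (sym (pa i)) (lower≤A xs (suc i))
    to : ∀ c → S c → Tr (inSkew la′ mu′ c)
    to (i , j) s with pos s
    to (suc i , suc j) s | _ , _ = inSkew⁺ la′ mu′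
      (subst (_< suc j) (sym (pb i)) (s≤s (lower⁺ (S⊆ s) ≤-refl)))
      (subst (suc j ≤_) (sym (pa i)) (upper⁺ (S⊆ s) ≤-refl ≤-refl))
    from : ∀ c → Tr (inSkew la′ mu′ c) → S c
    from (zero , j) p = contradiction (proj₁ (inSkew-pos la′ mu′ {zero} {j} p)) n≮0
    from (suc i , zero) p = contradiction (proj₁ (inSkew⁻ la′ mu′ {suc i} p)) n≮0
    from (suc i , suc j) p with inSkew⁻ la′ mu′ {suc i} p
    ... | p₁ , p₂ with lower⁻ xs (subst (_< suc j) (pb i) p₁) | upper⁻ xs (subst (suc j ≤_) (pa i) p₂)
    ... | inj₁ q | _ = contradiction (<-≤-trans q (subst (suc j ≤_) (pa i) p₂)) (<-irrefl refl)
    ... | inj₂ (a , b , ab∈ , a≤ , b<) | a′ , b′ , ab′∈ , ≤a′ , <b′ =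
      convex (⊆S ab∈) (⊆S ab′∈) a≤ ≤a′ (≤-trans (pred-< b) b<) <b′
      where
      pred-< : ∀ b → b ≤ suc (pred b)
      pred-< zero = z≤n
      pred-< (suc b) = ≤-refl

-- The cell (i , j) with i ≤ L lies on the diagonal t = j + (L ∸ i), and it belongs to α exactly
-- when i ≤ profile α L t.

profileUpTo : List ℕ → ℕ → ℕ → ℕ → ℕ
profileUpTo α L t zero = 0
profileUpTo α L t (suc n) with t ≤? part α (suc n) + (L ∸ suc n)
... | yes _ = suc n
... | no _ = profileUpTo α L t n

profile : List ℕ → ℕ → ℕ → ℕ
profile α L t = profileUpTo α L t L

profileUpTo-≤ : ∀ α L t n → profileUpTo α L t n ≤ n
profileUpTo-≤ α L t zero = z≤n
profileUpTo-≤ α L t (suc n) with t ≤? part α (suc n) + (L ∸ suc n)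
... | yes _ = ≤-refl
... | no _ = m≤n⇒m≤1+n (profileUpTo-≤ α L t n)

profile-≤ : ∀ α L t → profile α L t ≤ L
profile-≤ α L t = profileUpTo-≤ α L t L

profileUpTo⁺ : ∀ α L t n {i} → 1 ≤ i → i ≤ n → t ≤ part α i + (L ∸ i) → i ≤ profileUpTo α L t n
profileUpTo⁺ α L t zero 1≤i i≤n _ = i≤n
profileUpTo⁺ α L t (suc n) {i} 1≤i i≤n p with t ≤? part α (suc n) + (L ∸ suc n)
... | yes _ = i≤n
... | no ¬q with m≤n⇒m<n∨m≡n i≤n
... | inj₁ (s≤s i≤n′) = profileUpTo⁺ α L t n 1≤i i≤n′ p
... | inj₂ refl = contradiction p ¬q

profileUpTo⁻ : ∀ {α} → IsPartition α → ∀ L t n {i} → 1 ≤ i → i ≤ profileUpTo α L t n → t ≤ part α i + (L ∸ i)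
profileUpTo⁻ pα L t zero 1≤i i≤ = contradiction (≤-trans 1≤i i≤) n≮0
profileUpTo⁻ {α} pα L t (suc n) {i} 1≤i i≤ with t ≤? part α (suc n) + (L ∸ suc n)
... | yes q = ≤-trans q (+-mono-≤ (part-mono pα 1≤i i≤) (∸-monoʳ-≤ L i≤))
... | no _ = profileUpTo⁻ pα L t n 1≤i i≤

profile⁺ : ∀ α {L t i} → 1 ≤ i → i ≤ L → t ≤ part α i + (L ∸ i) → i ≤ profile α L t
profile⁺ α {L} {t} = profileUpTo⁺ α L t L

profile⁻ : ∀ {α} → IsPartition α → ∀ {L t i} → 1 ≤ i → i ≤ profile α L t → t ≤ part α i + (L ∸ i)
profile⁻ pα {L} {t} = profileUpTo⁻ pα L t L

profile-antitone : ∀ {α} → IsPartition α → ∀ L t → profile α L (suc t) ≤ profile α L t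
profile-antitone {α} pα L t with profile α L (suc t) in eq
... | zero = z≤n
... | suc i = profile⁺ α (s≤s z≤n) (subst (_≤ L) eq (profile-≤ α L (suc t)))
  (≤-trans (n≤1+n t) (profile⁻ pα {L} {suc t} (s≤s z≤n) (≤-reflexive (sym eq))))

-- The last square of row `i` is on the diagonal with number `part α i + (L ∸ i)`. These numbers
-- strictly decrease in `i`, so at most one row ends on each diagonal.
profile-drop≤1 : ∀ {α} → IsPartition α → ∀ L t → profile α L t ≤ suc (profile α L (suc t))
profile-drop≤1 {α} pα L t with profile α L t in eq
... | zero = z≤n
... | suc zero = s≤s z≤n
... | suc (suc i) = s≤s (profile⁺ α (s≤s z≤n) (<⇒≤ i<L)
  (≤-trans (s≤s (profile⁻ pα {L} {t} (s≤s z≤n) (≤-reflexive (sym eq))))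
    (subst (_≤ part α (suc i) + (L ∸ suc i)) (+-suc (part α (suc (suc i))) (L ∸ suc (suc i)))
      (+-mono-≤ (part-mono pα (s≤s z≤n) (n≤1+n _)) (≤-reflexive (sym (+-∸-assoc 1 i<L)))))))
  where
  i<L : suc (suc i) ≤ L
  i<L = subst (_≤ L) eq (profile-≤ α L t)

profile-step : ∀ {α} → IsPartition α → ∀ L t →
  profile α L t ≡ profile α L (suc t) ⊎ profile α L t ≡ suc (profile α L (suc t))
profile-step pα L t with m≤n⇒m<n∨m≡n (profile-antitone pα L t)
... | inj₂ e = inj₁ (sym e)
... | inj₁ lt = inj₂ (≤-antisym (profile-drop≤1 pα L t) lt)

-- Row `L ∸ t` meets diagonal `t` in column 0, which lies to the left of α and counts as belonging
-- to it. Rows beyond the profile of μ therefore have positive columns.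
profile-≥ : ∀ α L t → L ≤ t + profile α L t
profile-≥ α L t with L ≤? t
... | yes p = ≤-trans p (m≤m+n t _)
... | no ¬p = ≤-trans (≤-reflexive (sym (m+[n∸m]≡n t≤L)))
  (+-monoʳ-≤ t (profile⁺ α (m<n⇒0<n∸m t<L) (m∸n≤m L t)
    (≤-trans (≤-reflexive (sym (m∸[m∸n]≡n t≤L))) (m≤n+m _ (part α (L ∸ t))))))
  where
  t<L = ≰⇒> ¬p
  t≤L = <⇒≤ t<L

profile-start : ∀ α L → profile α L 0 ≡ L
profile-start α L = ≤-antisym (profile-≤ α L 0) (profile-≥ α L 0)

profile-end : ∀ {α} → IsPartition α → ∀ L → profile α L (L + part α 1) ≡ 0
profile-end {α} pα L with profile α L (L + part α 1) in eq
... | zero = refl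
... | suc i = contradiction
    (profile⁻ pα {L} {L + part α 1} {1} ≤-refl (subst (1 ≤_) (sym eq) (s≤s z≤n)))
    (<⇒≱ (subst (part α 1 + (L ∸ 1) <_) (+-comm (part α 1) L) (+-monoʳ-< (part α 1) (lt L (subst (_≤ L) eq (profile-≤ α L _))))))
  where
  lt : ∀ L → suc i ≤ L → L ∸ 1 < L
  lt (suc L) _ = ≤-refl

profile-mono : ∀ {la mu} → IsPartition mu → Contains la mu → ∀ L t → profile mu L t ≤ profile la L t
profile-mono {la} {mu} pm con L t with profile mu L t in eq
... | zero = z≤n
... | suc i = profile⁺ la (s≤s z≤n) (subst (_≤ L) eq (profile-≤ mu L t))
  (≤-trans (profile⁻ pm {L} {t} (s≤s z≤n) (≤-reflexive (sym eq))) (+-monoˡ-≤ (L ∸ suc i) (con (suc i))))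

-- Columns of a partition

conj⁺ : ∀ {α} → IsPartition α → ∀ {i j} → 1 ≤ i → 1 ≤ j → j ≤ part α i → i ≤ conj α j
conj⁺ {[]} pα {i} {suc j} _ _ p = contradiction p n≮0
conj⁺ {a ∷ α} pα {suc zero} {j} _ _ p with j ≤? a
... | yes q = subst (1 ≤_) (cong length (sym (filter-accept (j ≤?_) {xs = α} q))) (s≤s z≤n)
... | no q = contradiction p q
conj⁺ {a ∷ α} pα@(lk , _ ∷ pos) {suc (suc i)} {j} 1≤i 1≤j p =
  subst (suc (suc i) ≤_) (cong length (sym (filter-accept (j ≤?_) {xs = α} q)))
    (s≤s (conj⁺ (Linked.tail lk , pos) {suc i} (s≤s z≤n) 1≤j p))
  where
  q : j ≤ a
  q = ≤-trans p (part-mono pα {1} {suc (suc i)} ≤-refl (s≤s z≤n))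

conj⁻ : ∀ {α} → IsPartition α → ∀ {i j} → 1 ≤ i → i ≤ conj α j → j ≤ part α i
conj⁻ {[]} pα {suc i} _ ()
conj⁻ {a ∷ α} pα@(lk , _ ∷ pos) {i} {j} 1≤i p = go (j ≤? a)
  where
  tail⁻ : ∀ {i} → 1 ≤ i → i ≤ conj α j → j ≤ part α i
  tail⁻ = conj⁻ (Linked.tail lk , pos)
  go : Dec (j ≤ a) → j ≤ part (a ∷ α) i
  go (no q) = contradiction (≤-trans (tail⁻ 1≤i (subst (i ≤_) (cong length (filter-reject (j ≤?_) {xs = α} q)) p)) (below i 1≤i)) q
    where
    below : ∀ i → 1 ≤ i → part α i ≤ a
    below (suc i) _ = part-mono pα {1} {suc (suc i)} ≤-refl (s≤s z≤n)
  go (yes q) = lem i 1≤i (subst (i ≤_) (cong length (filter-accept (j ≤?_) {xs = α} q)) p)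
    where
    lem : ∀ i → 1 ≤ i → i ≤ suc (conj α j) → j ≤ part (a ∷ α) i
    lem (suc zero) _ _ = q
    lem (suc (suc i)) _ (s≤s r) = tail⁻ (s≤s z≤n) r

conj-≤-length : ∀ α j → conj α j ≤ length α
conj-≤-length α j = length-filter (j ≤?_) α

-- Border strips of a skew diagram

concatMap-unique : {A B : Set} (f : A → List B) {xs : List A} → Unique xs → (∀ x → Unique (f x)) →
  (∀ {x y z} → z ∈ f x → z ∈ f y → x ≡ y) → Unique (concatMap f xs)
concatMap-unique f [] uf disj = []
concatMap-unique f {x ∷ xs} (x≢ ∷ u) uf disj = Unique.++⁺ (uf x) (concatMap-unique f u uf disj) d
  where
  d : ∀ {z} → ¬ (z ∈ f x × z ∈ concatMap f xs)
  d (p , q) with find (∈-concatMap⁻ f {xs = xs} q)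
  ... | y , y∈ , r = All.lookup x≢ y∈ (disj p r)

∈-cells⁺ : ∀ la mu {c} → Tr (inSkew la mu c) → c ∈ cells la mu
∈-cells⁺ la mu {suc i , suc j} p with inSkew⁻ la mu {suc i} {suc j} p | inSkew-pos la mu {suc i} {suc j} p
... | s≤s a , b | _ , le = ∈-concat⁺′
  (subst (λ z → (suc i , suc z) ∈ row (suc i)) (m+[n∸m]≡n a)
    (∈-map⁺ (λ t → (suc i , suc (part mu (suc i) + t))) (∈-upTo⁺ (∸-monoˡ-< b a))))
  (∈-map⁺ row (∈-map⁺ suc (∈-upTo⁺ le)))
  where
  row : ℕ → List Cell
  row i = map (λ t → (i , suc (part mu i + t))) (upTo (part la i ∸ part mu i))
∈-cells⁺ la mu {zero , j} p = contradiction (proj₁ (inSkew-pos la mu {zero} {j} p)) n≮0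
∈-cells⁺ la mu {suc i , zero} p = contradiction (proj₁ (inSkew⁻ la mu {suc i} {zero} p)) n≮0

∈-cells⁻ : ∀ la mu {c} → c ∈ cells la mu → Tr (inSkew la mu c)
∈-cells⁻ la mu c∈ with find (∈-concatMap⁻ (λ i → map (λ t → (i , suc (part mu i + t))) (upTo (part la i ∸ part mu i))) {xs = map suc (upTo (length la))} c∈)
... | i , _ , p with ∈-map⁻ (λ t → (i , suc (part mu i + t))) p
... | t , t∈ , refl = inSkew⁺ la mu (s≤s (m≤m+n _ t)) (proj₂ (∈-rows⁻ (part mu i) (part la i) (∈-map⁺ (λ p → suc (part mu i + p)) t∈)))

cells-unique : ∀ la mu → Unique (cells la mu)
cells-unique la mu = concatMap-unique _ (Unique.map⁺ suc-injective (upTo⁺ (length la)))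
  (λ i → Unique.map⁺ (λ e → +-cancelˡ-≡ (part mu i) _ _ (suc-injective (cong proj₂ e))) (upTo⁺ _))
  (λ {x} {y} p q → trans (sym (row x p)) (row y q))
  where
  row : ∀ i {c} → c ∈ map (λ t → (i , suc (part mu i + t))) (upTo (part la i ∸ part mu i)) → proj₁ c ≡ i
  row i p with ∈-map⁻ (λ t → (i , suc (part mu i + t))) p
  ... | t , _ , refl = refl

conn-end : ∀ {S a b} → Conn S a b → S b
conn-end (here s) = s
conn-end (step _ s _) = s

conn-cons : ∀ {S a b c} → S a → ShareEdge a b → Conn S b c → Conn S a c
conn-cons sa e (here sb) = step (here sa) sb e
conn-cons sa e (step p sc e′) = step (conn-cons sa e p) sc e′

share-sym : ∀ {a b} → ShareEdge a b → ShareEdge b a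
share-sym (inj₁ p) = inj₂ p
share-sym (inj₂ p) = inj₁ p

conn-sym : ∀ {S a b} → Conn S a b → Conn S b a
conn-sym (here s) = here s
conn-sym (step p s e) = conn-cons s (share-sym e) (conn-sym p)

conn-map : ∀ {S S′ : Cell → Set} → (∀ {c} → S c → S′ c) → ∀ {a b} → Conn S a b → Conn S′ a b
conn-map f (here s) = here (f s)
conn-map f (step p s e) = step (conn-map f p) (f s) e

strip-resp : ∀ {S S′ : Cell → Set} → (∀ {c} → S c → S′ c) → (∀ {c} → S′ c → S c) → IsBorderStrip S → IsBorderStrip S′
strip-resp f g ((c , s) , (la′ , mu′ , pl′ , pm′ , con′ , eqv) , conn , no2) =
  (c , f s) , (la′ , mu′ , pl′ , pm′ , con′ , λ c → (λ s → proj₁ (eqv c) (g s)) , λ t → f (proj₂ (eqv c) t)) ,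
  (λ c c′ s s′ → conn-map f (conn c c′ (g s) (g s′))) ,
  λ i j (s₁ , s₂ , s₃ , s₄) → no2 i j (g s₁ , g s₂ , g s₃ , g s₄)

-- Parities, lists of rows and a Boolean identity

double-even : ∀ k → (k + k) % 2 ≡ 0
double-even k = trans (cong (_% 2) (trans (cong (k +_) (sym (+-identityʳ k))) (*-comm 2 k))) (m*n%n≡0 k 2)

double+1-odd : ∀ k → suc (k + k) % 2 ≡ 1
double+1-odd k = trans (cong (λ z → suc z % 2) (trans (cong (k +_) (sym (+-identityʳ k))) (*-comm 2 k))) ([m+kn]%n≡m%n 1 k 2)

half-double : ∀ k → ⌊ (k + k) /2⌋ ≡ k
half-double zero = refl
half-double (suc k) = trans (cong (λ z → ⌊ suc z /2⌋) (+-suc k k)) (cong suc (half-double k))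

suc∸ : ∀ a b → a < b → b ∸ a ≡ suc (b ∸ suc a)
suc∸ a (suc b) (s≤s p) = +-∸-assoc 1 p

_≟C_ : (c c′ : Cell) → Dec (c ≡ c′)
_≟C_ = ≡-dec _≟_ _≟_

_≟L_ : (x y : Link) → Dec (x ≡ y)
_≟L_ = ≡-dec _≟C_ _≟C_

rows-cons : ∀ {a b} → a < b → rows a b ≡ suc a ∷ rows (suc a) b
rows-cons {a} {suc b} (s≤s a≤b) = begin
  map h (upTo (suc b ∸ a))          ≡⟨ cong (λ z → map h (upTo z)) (+-∸-assoc 1 a≤b) ⟩
  h 0 ∷ map h (applyUpTo suc (b ∸ a))
    ≡⟨ cong₂ _∷_ (cong suc (+-identityʳ a)) (begin
       map h (applyUpTo suc (b ∸ a)) ≡⟨ cong (map h) (sym (map-upTo suc (b ∸ a))) ⟩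
       map h (map suc (upTo (b ∸ a)))          ≡⟨ sym (map-∘ (upTo (b ∸ a))) ⟩
       map (h ∘ suc) (upTo (b ∸ a))            ≡⟨ map-cong (λ p → cong suc (+-suc a p)) (upTo (b ∸ a)) ⟩
       rows (suc a) (suc b) ∎) ⟩
  suc a ∷ rows (suc a) (suc b) ∎
  where
  open ≡-Reasoning
  h : ℕ → ℕ
  h p = suc (a + p)

rows-[] : ∀ {a b} → b ≤ a → rows a b ≡ []
rows-[] {a} b≤a = cong (λ z → map (λ p → suc (a + p)) (upTo z)) (m≤n⇒m∸n≡0 b≤a)

sum-rows : ∀ (g : ℕ → ℕ) {a b} → (∀ {i} → suc a < i → i ≤ b → g i ≡ 0) → a < b → sum (map g (rows a b)) ≡ g (suc a)
sum-rows g {a} {b} z a<b = trans (cong (λ xs → sum (map g xs)) (rows-cons a<b))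
  (trans (cong (g (suc a) +_) (sum-zero g (rows (suc a) b) λ p → let (x , y) = ∈-rows⁻ (suc a) b p in z x y)) (+-identityʳ _))

when : Bool → ℕ → ℕ
when b n = if b then n else 0

when-0 : ∀ b → when b 0 ≡ 0
when-0 true = refl
when-0 false = refl

local-sum : ∀ a b {d d′ x} → (a ≡ true → d′ ≡ d + x) → (a ≡ false → x ≡ 0) →
  when (not a ∧ᵇ b) d + when a d′ ≡ when (a ∧ᵇ not b) d + (x + when b d)
local-sum true true {d} {d′} {x} f _ = trans (f refl) (+-comm d x)
local-sum true false {d} {d′} {x} f _ = trans (f refl) (cong (d +_) (sym (+-identityʳ x)))
local-sum false true {d} _ g = trans (+-identityʳ d) (sym (cong (_+ d) (g refl)))
local-sum false false {x = x} _ g = sym (trans (+-identityʳ x) (g refl))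

¬Tr⇒false : ∀ {b} → ¬ Tr b → b ≡ false
¬Tr⇒false {true} p = contradiction tt p
¬Tr⇒false {false} _ = refl

Tr⇒true : ∀ {b} → Tr b → b ≡ true
Tr⇒true {true} _ = refl

module Skew (la mu : List ℕ) (pl : IsPartition la) (pm : IsPartition mu) (con : Contains la mu) where

  L T : ℕ
  L = length la
  T = L + part la 1

  m l : ℕ → ℕ
  m = profile mu L
  l = profile la L

  open Profile m l public

  m≤l : ∀ t → m t ≤ l t
  m≤l = profile-mono pm con L

  m-step : ∀ t → m t ≡ m (suc t) ⊎ m t ≡ suc (m (suc t))
  m-step = profile-step pm L

  l-step : ∀ t → l t ≡ l (suc t) ⊎ l t ≡ suc (l (suc t))
  l-step = profile-step pl L

  start : l 0 ≡ m 0
  start = trans (profile-start la L) (sym (profile-start mu L))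

  end : l T ≡ 0
  end = profile-end pl L

  dg : Cell → ℕ
  dg (i , j) = j + (L ∸ i)

  dg-eq : ∀ {i} j → i ≤ L → dg (i , j) + i ≡ j + L
  dg-eq {i} j i≤L = trans (+-assoc j (L ∸ i) i) (cong (j +_) (m∸n+n≡m i≤L))

  cellAt : ℕ → ℕ → Cell
  cellAt t i = i , (t + i) ∸ L

  in-pos : ∀ {t i} → In t i → 1 ≤ i
  in-pos (a , _) = ≤-trans (s≤s z≤n) a

  in-≤L : ∀ {t i} → In t i → i ≤ L
  in-≤L {t} (_ , b) = ≤-trans b (profile-≤ la L t)

  in-> : ∀ {t i} → In t i → L < t + i
  in-> {t} (a , _) = ≤-<-trans (profile-≥ mu L t) (+-monoʳ-< t a)

  skew⁻ : ∀ {i j} → Tr (inSkew la mu (i , j)) → In (dg (i , j)) i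
  skew⁻ {i} {j} p with inSkew⁻ la mu {i} {j} p | inSkew-pos la mu {i} {j} p
  ... | a , b | 1≤i , i≤L = above , profile⁺ la 1≤i i≤L (+-monoˡ-≤ (L ∸ i) b)
    where
    above : m (dg (i , j)) < i
    above with m (dg (i , j)) <? i
    ... | yes q = q
    ... | no q = contradiction (+-cancelʳ-≤ (L ∸ i) j (part mu i) (profile⁻ pm {L} 1≤i (≮⇒≥ q))) (<⇒≱ a)

  skew⁺ : ∀ {i j} → In (dg (i , j)) i → Tr (inSkew la mu (i , j))
  skew⁺ {i} {j} i∈@(a , b) = inSkew⁺ la mu {i} below
    (+-cancelʳ-≤ (L ∸ i) j (part la i) (profile⁻ pl {L} (in-pos {dg (i , j)} i∈) b))
    where
    below : part mu i < j
    below with part mu i <? j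
    ... | yes q = q
    ... | no q = contradiction (profile⁺ mu (in-pos {dg (i , j)} i∈) (in-≤L {dg (i , j)} i∈) (+-monoˡ-≤ (L ∸ i) (≮⇒≥ q))) (<⇒≱ a)

  dg-cellAt : ∀ {t i} → i ≤ L → L ≤ t + i → dg (cellAt t i) ≡ t
  dg-cellAt {t} {i} i≤L L≤ = +-cancelʳ-≡ i _ _ (trans (dg-eq (t + i ∸ L) i≤L) (m∸n+n≡m L≤))

  cellAt-dg : ∀ {i j} → i ≤ L → cellAt (dg (i , j)) i ≡ (i , j)
  cellAt-dg {i} {j} i≤L = cong (i ,_) (trans (cong (_∸ L) (dg-eq j i≤L)) (m+n∸n≡m j L))

  dg-in : ∀ {t i} → In t i → dg (cellAt t i) ≡ t
  dg-in {t} {i} i∈ = dg-cellAt (in-≤L {t} i∈) (<⇒≤ (in-> {t} i∈))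

  cellAt-skew : ∀ {t i} → In t i → Tr (inSkew la mu (cellAt t i))
  cellAt-skew {t} {i} i∈ = skew⁺ (subst (λ s → In s i) (sym (dg-in {t} i∈)) i∈)

  cellAt∈ : ∀ {t i} → In t i → cellAt t i ∈ cells la mu
  cellAt∈ {t} i∈ = ∈-cells⁺ la mu (cellAt-skew {t} i∈)

  cells-view : ∀ {c} → c ∈ cells la mu → In (dg c) (proj₁ c) × cellAt (dg c) (proj₁ c) ≡ c × proj₁ c ≤ L
  cells-view {i , j} p = let q = ∈-cells⁻ la mu p ; le = proj₂ (inSkew-pos la mu {i} {j} q) in skew⁻ q , cellAt-dg le , le

  dg<T : ∀ {t i} → In t i → t < T
  dg<T {t} {i} i∈@(a , b) = ≤-trans (s≤s (profile⁻ pl {L} {t} {i} (in-pos {t} i∈) b))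
    (subst (suc (part la i + (L ∸ i)) ≤_) (+-comm (part la 1) L)
      (subst (_≤ part la 1 + L) (+-suc (part la i) (L ∸ i))
        (+-mono-≤ (part-mono pl ≤-refl (in-pos {t} i∈)) (∸-monoʳ-< {L} {i} {0} (in-pos {t} i∈) (in-≤L {t} i∈)))))

  -- Sums and frequencies do not depend on the order of the squares, so the row order of `cells` can
  -- be exchanged for the order by diagonals.
  cells↭ : cells la mu ↭ map (uncurry cellAt) (diagPairs T 0)
  cells↭ = unique-set⇒↭ (cells-unique la mu)
    (unique-map⁺-local inj (diagPairs-unique T 0)) to from
    where
    inj : ∀ {p q} → p ∈ diagPairs T 0 → q ∈ diagPairs T 0 → uncurry cellAt p ≡ uncurry cellAt q → p ≡ q
    inj {t , i} {t′ , i′} p q e = cong₂ _,_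
      (trans (sym (dg-in {t} (proj₂ (∈-diagPairs⁻ T 0 p)))) (trans (cong dg e) (dg-in {t′} (proj₂ (∈-diagPairs⁻ T 0 q)))))
      (cong proj₁ e)
    to : ∀ {c} → c ∈ cells la mu → c ∈ map (uncurry cellAt) (diagPairs T 0)
    to {c} p with cells-view p
    ... | i∈ , e , _ = subst (_∈ map (uncurry cellAt) (diagPairs T 0)) e
      (∈-map⁺ (uncurry cellAt) (∈-diagPairs⁺ T 0 z≤n (subst (dg c <_) (sym (+-identityʳ T)) (dg<T {dg c} i∈)) i∈))
    from : ∀ {c} → c ∈ map (uncurry cellAt) (diagPairs T 0) → c ∈ cells la mu
    from p with ∈-map⁻ (uncurry cellAt) p
    ... | (t , i) , ti∈ , refl = cellAt∈ {t} (proj₂ (∈-diagPairs⁻ T 0 ti∈))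

  down-dg : ∀ {i} j → suc i ≤ L → dg (i , j) ≡ suc (dg (suc i , j))
  down-dg {i} j i<L = trans (cong (j +_) (+-∸-assoc 1 i<L)) (+-suc j _)

  Next : Cell → Cell → Set
  Next c c′ = dg c′ ≡ suc (dg c) × (proj₁ c′ ≡ proj₁ c ⊎ proj₁ c ≡ suc (proj₁ c′))

  adj⇒next : ∀ {c c′} → proj₁ c ≤ L → proj₁ c′ ≤ L → Adj c c′ → Next c c′ ⊎ Next c′ c
  adj⇒next a b (inj₁ refl) = inj₁ (refl , inj₁ refl)
  adj⇒next {i , j} a b (inj₂ refl) = inj₂ (down-dg j b , inj₂ refl)

  share⇒next : ∀ {c c′} → proj₁ c ≤ L → proj₁ c′ ≤ L → ShareEdge c c′ → Next c c′ ⊎ Next c′ c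
  share⇒next a b (inj₁ e) = adj⇒next a b e
  share⇒next a b (inj₂ e) = [ inj₂ , inj₁ ]′ (adj⇒next b a e)

  adjacent⇒share : ∀ {t i i′} → In t i → In (suc t) i′ → i′ ≡ i ⊎ i ≡ suc i′ → ShareEdge (cellAt t i) (cellAt (suc t) i′)
  adjacent⇒share {t} {i} i∈ _ (inj₁ refl) = inj₁ (inj₁ (cong (i ,_) (+-∸-assoc 1 (<⇒≤ (in-> {t} i∈)))))
  adjacent⇒share {t} {suc i} i∈ _ (inj₂ refl) = inj₂ (inj₂ (cong (λ z → suc i , z ∸ L) (+-suc t i)))

  -- Each edge changes the diagonal by exactly one, so a path cannot jump over the border between
  -- `t` and `t + 1`.
  conn-crosses : ∀ {S : Cell → Set} {a b t} → (∀ {c} → S c → proj₁ c ≤ L) → Conn S a b → dg a ≤ t → t < dg b →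
    ∃ λ x → ∃ λ y → S x × S y × dg x ≡ t × Next x y
  conn-crosses rows≤ (here s) a≤t t<a = contradiction (≤-<-trans a≤t t<a) (<-irrefl refl)
  conn-crosses {t = t} rows≤ (step {b = b} {c} p s e) a≤t t<c with t <? dg b
  ... | yes t<b = conn-crosses rows≤ p a≤t t<b
  ... | no t≮b with share⇒next (rows≤ (conn-end p)) (rows≤ s) e
  ... | inj₁ n@(e′ , _) = b , c , conn-end p , s , ≤-antisym (≮⇒≥ t≮b) (s≤s⁻¹ (subst (t <_) e′ t<c)) , n
  ... | inj₂ (e′ , _) = contradiction (<-trans t<c (≤-reflexive (sym e′))) t≮b

  -- A skew diagram contains the whole rectangle between two squares one of which lies weakly below
  -- and to the right of the other; between different squares of one diagonal this includes a 2 by 2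
  -- block.
  strip-diagonal : ∀ {S} → IsBorderStrip S → (∀ {c} → S c → proj₁ c ≤ L) → ∀ {i j i′ j′} →
    S (i , j) → S (i′ , j′) → dg (i , j) ≡ dg (i′ , j′) → ¬ (i < i′)
  strip-diagonal {S} (_ , (la′ , mu′ , pl′ , pm′ , _ , eqv) , _ , no2) rows≤ {i} {j} {i′} {j′} s s′ e lt =
    no2 i j (s , mem ≤-refl (<⇒≤ lt) (n≤1+n j) j<j′ , mem (n≤1+n i) lt ≤-refl (<⇒≤ j<j′) ,
      mem (n≤1+n i) lt (n≤1+n j) j<j′)
    where
    j<j′ : j < j′
    j<j′ with j <? j′
    ... | yes p = p
    ... | no p = contradiction e (<⇒≢ (+-mono-≤-< (≮⇒≥ p) (∸-monoʳ-< lt (rows≤ s′))) ∘ sym)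
    mem : ∀ {a b} → i ≤ a → a ≤ i′ → j ≤ b → b ≤ j′ → S (a , b)
    mem p q r u = proj₂ (eqv _)
      (skew-convex pl′ pm′ {i} {j} {i′} {j′} (proj₁ (eqv _) s) (proj₁ (eqv _) s′) p q r u)

  strip-thin : ∀ {S} → IsBorderStrip S → (∀ {c} → S c → proj₁ c ≤ L) → ∀ {c c′} →
    S c → S c′ → dg c ≡ dg c′ → proj₁ c ≡ proj₁ c′
  strip-thin bs rows≤ {i , j} {i′ , j′} s s′ e with <-cmp i i′
  ... | tri≈ _ p _ = p
  ... | tri< lt _ _ = contradiction lt (strip-diagonal bs rows≤ s s′ e)
  ... | tri> _ _ lt = contradiction lt (strip-diagonal bs rows≤ s′ s (sym e))

  -- From a border strip decomposition to a labelling of the diagonals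

  module Blocks (f : Cell → ℕ) (strips : ∀ {c} → c ∈ cells la mu → IsBorderStrip (λ c′ → c′ ∈ cells la mu × f c′ ≡ f c)) where

    lab : ℕ → ℕ → ℕ
    lab t i = f (cellAt t i)

    private
      rows≤ : ∀ {c b} → c ∈ cells la mu × f c ≡ b → proj₁ c ≤ L
      rows≤ (p , _) = proj₂ (proj₂ (cells-view p))

    lab-thin : ∀ {t i j} → In t i → In t j → lab t i ≡ lab t j → i ≡ j
    lab-thin {t} i∈ j∈ e = strip-thin (strips (cellAt∈ {t} i∈)) rows≤ (cellAt∈ {t} i∈ , refl) (cellAt∈ {t} j∈ , sym e)
      (trans (dg-in {t} i∈) (sym (dg-in {t} j∈)))

    -- A path inside the strip crosses from diagonal `t` to `t + 1`; its square on diagonal `t` must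
    -- be the given one, as a strip has only one square there.
    lab-linked : ∀ {t t′ i j} → t < t′ → In t i → In t′ j → lab t i ≡ lab t′ j →
      ∃ λ i′ → In (suc t) i′ × lab (suc t) i′ ≡ lab t i × (i′ ≡ i ⊎ i ≡ suc i′)
    lab-linked {t} {t′} {i} {j} t<t′ i∈ j∈ e with strips (cellAt∈ {t} i∈)
    ... | bs@(_ , _ , conn , _) with conn-crosses rows≤
            (conn (cellAt t i) (cellAt t′ j) (cellAt∈ {t} i∈ , refl) (cellAt∈ {t′} j∈ , sym e))
            (≤-reflexive (dg-in {t} i∈)) (subst (t <_) (sym (dg-in {t′} j∈)) t<t′)
    ... | x , y , sx , sy@(y∈ , fy) , dx , dy , adj with cells-view y∈
                                      | strip-thin bs rows≤ sx (cellAt∈ {t} i∈ , refl) (trans dx (sym (dg-in {t} i∈)))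
    ... | in-y , ey , _ | refl = proj₁ y , subst (λ s → In s (proj₁ y)) dy′ in-y ,
          trans (cong f (trans (cong (λ s → cellAt s (proj₁ y)) (sym dy′)) ey)) fy , adj
      where
      dy′ : dg y ≡ suc t
      dy′ = trans dy (cong suc dx)

  -- From a labelling of the diagonals to border strips

  module Classes (lab : ℕ → ℕ → ℕ)
    (thin : ∀ {t i j} → In t i → In t j → lab t i ≡ lab t j → i ≡ j)
    (linked : ∀ {t t′ i j} → t < t′ → In t i → In t′ j → lab t i ≡ lab t′ j →
      ∃ λ i′ → In (suc t) i′ × lab (suc t) i′ ≡ lab t i × (i′ ≡ i ⊎ i ≡ suc i′)) where

    labOf : Cell → ℕ
    labOf c = lab (dg c) (proj₁ c)

    Class : ℕ → Cell → Set
    Class v c = c ∈ cells la mu × labOf c ≡ v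

    -- Strips go right or up. The column of row `i` on diagonal `t` is `t + i` minus `L`, so the
    -- second inequality says that columns do not decrease.
    path-mono : ∀ n {t t′ i i′} → n + t ≡ t′ → In t i → In t′ i′ → lab t i ≡ lab t′ i′ → i′ ≤ i × t + i ≤ t′ + i′
    path-mono zero refl i∈ i′∈ e with thin i∈ i′∈ e
    ... | refl = ≤-refl , ≤-refl
    path-mono (suc n) {t} {t′} eq i∈ i′∈ e with linked (subst (t <_) eq (s≤s (m≤n+m t n))) i∈ i′∈ e
    ... | j , j∈ , e′ , adj with path-mono n (trans (+-suc n t) eq) j∈ i′∈ (trans e′ e)
    path-mono (suc n) {t} eq i∈ i′∈ e | j , j∈ , e′ , inj₁ refl | p , q = p , ≤-trans (n≤1+n _) q
    path-mono (suc n) {t} eq i∈ i′∈ e | j , j∈ , e′ , inj₂ refl | p , q =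
      m≤n⇒m≤1+n p , ≤-trans (≤-reflexive (+-suc t j)) q

    path-fill : ∀ k {t s t′ i i′} → k + t ≡ s → s ≤ t′ → In t i → In t′ i′ → lab t i ≡ lab t′ i′ →
      ∃ λ r → In s r × lab s r ≡ lab t i
    path-fill zero refl _ i∈ _ _ = _ , i∈ , refl
    path-fill (suc k) {t} eq s≤t′ i∈ i′∈ e
      with linked (<-≤-trans (subst (t <_) eq (s≤s (m≤n+m t k))) s≤t′) i∈ i′∈ e
    ... | j , j∈ , e′ , _ with path-fill k (trans (+-suc k t) eq) s≤t′ j∈ i′∈ (trans e′ e)
    ... | r , r∈ , e″ = r , r∈ , trans e″ e′

    class-at : ∀ {t i v} → In t i → lab t i ≡ v → Class v (cellAt t i)
    class-at {t} {i} i∈ e = cellAt∈ {t} i∈ , trans (cong (λ s → lab s i) (dg-in {t} i∈)) e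

    path-conn : ∀ n {t t′ i i′ v} → n + t ≡ t′ → In t i → In t′ i′ → lab t i ≡ v → lab t′ i′ ≡ v →
      Conn (Class v) (cellAt t i) (cellAt t′ i′)
    path-conn zero {t} refl i∈ i′∈ e e′ with thin i∈ i′∈ (trans e (sym e′))
    ... | refl = here (class-at {t} i∈ e)
    path-conn (suc n) {t} {t′} eq i∈ i′∈ e e′ with linked (subst (t <_) eq (s≤s (m≤n+m t n))) i∈ i′∈ (trans e (sym e′))
    ... | j , j∈ , e″ , adj = conn-cons (class-at {t} i∈ e) (adjacent⇒share {t} i∈ j∈ adj)
          (path-conn n (trans (+-suc n t) eq) j∈ i′∈ (trans e″ e) e′)

    class-pos : ∀ {v i j} → Class v (i , j) → 1 ≤ i × 1 ≤ j
    class-pos {v} {i} {j} (p , _) = let q = ∈-cells⁻ la mu p in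
      proj₁ (inSkew-pos la mu {i} {j} q) , ≤-trans (s≤s z≤n) (proj₁ (inSkew⁻ la mu {i} {j} q))

    -- On a path going right and up, two squares with one weakly below and to the right of the other
    -- share a row or a column. The path meets every diagonal in between, and `path-mono` pins the
    -- row or column there.
    class-convex : ∀ {v i j i′ j′ a b} → Class v (i , j) → Class v (i′ , j′) →
      i ≤ a → a ≤ i′ → j ≤ b → b ≤ j′ → Class v (a , b)
    class-convex {v} {i} {j} {i′} {j′} {a} {b} (c∈ , e) (c′∈ , e′) i≤a a≤i′ j≤b b≤j′
      with cells-view c∈ | cells-view c′∈ | ≤-total (dg (i , j)) (dg (i′ , j′))
    ... | in₁ , _ , i≤L | in₂ , _ , i′≤L | inj₁ t≤t′ = same-row (≤-antisym (≤-trans i≤a a≤i′) (proj₁ mono))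
      where
      mono : i′ ≤ i × dg (i , j) + i ≤ dg (i′ , j′) + i′
      mono = path-mono (dg (i′ , j′) ∸ dg (i , j)) (m∸n+n≡m t≤t′) in₁ in₂ (trans e (sym e′))
      same-row : i ≡ i′ → Class v (a , b)
      same-row refl with ≤-antisym a≤i′ i≤a
      ... | refl with path-fill (b ∸ j) {s = dg (i , b)} eq (+-monoˡ-≤ (L ∸ i) b≤j′) in₁ in₂ (trans e (sym e′))
        where
        eq : (b ∸ j) + dg (i , j) ≡ dg (i , b)
        eq = trans (sym (+-assoc (b ∸ j) j (L ∸ i))) (cong (_+ (L ∸ i)) (m∸n+n≡m j≤b))
      ... | r , r∈ , er with path-mono (dg (i , b) ∸ dg (i , j)) (m∸n+n≡m (+-monoˡ-≤ (L ∸ i) j≤b)) in₁ r∈ (sym er)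
                           | path-mono (dg (i , j′) ∸ dg (i , b)) (m∸n+n≡m (+-monoˡ-≤ (L ∸ i) b≤j′)) r∈ in₂ (trans er (trans e (sym e′)))
      ... | r≤i , _ | i≤r , _ with ≤-antisym r≤i i≤r
      ... | refl = subst (Class v) (cellAt-dg i≤L) (class-at {dg (i , b)} r∈ (trans er e))
    ... | in₁ , _ , i≤L | in₂ , _ , i′≤L | inj₂ t′≤t = same-col (≤-antisym (≤-trans j≤b b≤j′) j′≤j)
      where
      a≤L = ≤-trans a≤i′ i′≤L
      j′≤j : j′ ≤ j
      j′≤j = +-cancelʳ-≤ L j′ j (subst₂ _≤_ (dg-eq j′ i′≤L) (dg-eq j i≤L)
        (proj₂ (path-mono (dg (i , j) ∸ dg (i′ , j′)) (m∸n+n≡m t′≤t) in₂ in₁ (trans e′ (sym e)))))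
      same-col : j ≡ j′ → Class v (a , b)
      same-col refl with ≤-antisym b≤j′ j≤b
      ... | refl with path-fill (dg (a , b) ∸ dg (i′ , b)) {s = dg (a , b)} (m∸n+n≡m le₁) le₂ in₂ in₁ (trans e′ (sym e))
        where
        le₁ : dg (i′ , b) ≤ dg (a , b)
        le₁ = +-monoʳ-≤ b (∸-monoʳ-≤ L a≤i′)
        le₂ : dg (a , b) ≤ dg (i , b)
        le₂ = +-monoʳ-≤ b (∸-monoʳ-≤ L i≤a)
      ... | r , r∈ , er with path-mono (dg (a , b) ∸ dg (i′ , b)) (m∸n+n≡m (+-monoʳ-≤ b (∸-monoʳ-≤ L a≤i′))) in₂ r∈ (sym er)
                           | path-mono (dg (i , b) ∸ dg (a , b)) (m∸n+n≡m (+-monoʳ-≤ b (∸-monoʳ-≤ L i≤a))) r∈ in₁ (trans er (trans e′ (sym e)))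
      ... | _ , p | _ , q with +-cancelˡ-≡ (dg (a , b)) r a (≤-antisym
                 (≤-trans q (≤-reflexive (trans (dg-eq b i≤L) (sym (dg-eq b a≤L)))))
                 (≤-trans (≤-reflexive (trans (dg-eq b a≤L) (sym (dg-eq b i′≤L)))) p))
      ... | refl = subst (Class v) (cellAt-dg a≤L) (class-at {dg (a , b)} r∈ (trans er e′))

    class-strip : ∀ {v} → ∃ (Class v) → IsBorderStrip (Class v)
    class-strip {v} ex = ex , skew , connected , no2x2
      where
      xs = filter (λ c → labOf c ≟ v) (cells la mu)
      skew : IsSkewDiagram (Class v)
      skew = OrderConvex.isSkew xs (Class v)
        (λ (p , e) → ∈-filter⁺ (λ c → labOf c ≟ v) p e)
        (λ p → ∈-filter⁻ (λ c → labOf c ≟ v) p) class-pos class-convex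
      connected : EdgeConnected (Class v)
      connected c c′ (c∈ , e) (c′∈ , e′) with cells-view c∈ | cells-view c′∈ | ≤-total (dg c) (dg c′)
      ... | p , q , _ | p′ , q′ , _ | inj₁ le =
        subst₂ (Conn (Class v)) q q′ (path-conn (dg c′ ∸ dg c) (m∸n+n≡m le) p p′ e e′)
      ... | p , q , _ | p′ , q′ , _ | inj₂ le =
        subst₂ (Conn (Class v)) q q′ (conn-sym (path-conn (dg c ∸ dg c′) (m∸n+n≡m le) p′ p e′ e))
      no2x2 : No2x2 (Class v)
      -- Two opposite corners of the block lie on the same diagonal, which already contradicts
      -- `thin`.
      no2x2 i j ((p , e) , _ , _ , (p′ , e′)) with cells-view p | cells-view p′
      ... | q , _ , _ | q′ , _ , le = contradiction
        (thin (subst (λ s → In s i) dg≡ q) q′ (trans (cong (λ s → lab s i) (sym dg≡)) (trans e (sym e′)))) (1+n≢n ∘ sym)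
        where
        dg≡ : dg (i , j) ≡ dg (suc i , suc j)
        dg≡ = down-dg j le

  -- Snakes

  In? : ∀ t i → Dec (In t i)
  In? t i with m t <? i | i ≤? l t
  ... | yes p | yes q = yes (p , q)
  ... | no p | _ = no (p ∘ proj₁)
  ... | _ | no q = no (q ∘ proj₂)

  ind : ∀ {P : Set} → Dec P → ℕ
  ind (yes _) = 1
  ind (no _) = 0

  count : ℕ → ℕ → ℕ
  count t zero = 0
  count t (suc i) = ind (In? t (suc i)) + count t i

  count-low : ∀ t {n} → n ≤ m t → count t n ≡ 0
  count-low t {zero} _ = refl
  count-low t {suc n} n≤ with In? t (suc n)
  ... | yes (p , _) = contradiction n≤ (<⇒≱ p)
  ... | no _ = count-low t (<⇒≤ n≤)

  count-mid : ∀ t {n} → m t ≤ n → n ≤ l t → count t n ≡ n ∸ m t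
  count-mid t {n} m≤n n≤l with m≤n⇒m<n∨m≡n m≤n
  ... | inj₂ refl = trans (count-low t ≤-refl) (sym (n∸n≡0 n))
  count-mid t {suc n} m≤n n≤l | inj₁ (s≤s m≤n′) with In? t (suc n)
  ... | yes _ = trans (cong suc (count-mid t m≤n′ (<⇒≤ n≤l))) (sym (+-∸-assoc 1 m≤n′))
  ... | no q = contradiction (s≤s m≤n′ , n≤l) q

  count-full : ∀ t {n} → n ≡ l t → count t n ≡ l t ∸ m t
  count-full t refl = count-mid t (m≤l t) ≤-refl

  length-skewPart : List Cell → ℕ
  length-skewPart cs = length (skewPart la mu cs)

  skewPart-in : ∀ {t i j} cs → dg (i , j) ≡ t → length-skewPart ((i , j) ∷ cs) ≡ ind (In? t i) + length-skewPart cs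
  skewPart-in {t} {i} {j} cs refl with In? (dg (i , j)) i
  ... | yes p = cong length (filter-accept (λ c → T? (inSkew la mu c)) {i , j} {cs} (skew⁺ {i} {j} p))
  ... | no p = cong length (filter-reject (λ c → T? (inSkew la mu c)) {i , j} {cs} (p ∘ skew⁻ {i} {j}))

  skewPart-out : ∀ {c} cs → ¬ Tr (inSkew la mu c) → length-skewPart (c ∷ cs) ≡ length-skewPart cs
  skewPart-out {c} cs p = cong length (filter-reject (λ c → T? (inSkew la mu c)) {c} {cs} p)

  row0∉ : ∀ {j} → ¬ Tr (inSkew la mu (0 , j))
  row0∉ {j} p = contradiction (proj₁ (inSkew-pos la mu {0} {j} p)) n≮0

  col0∉ : ∀ {i} → ¬ Tr (inSkew la mu (i , 0))
  col0∉ {i} p = contradiction (proj₁ (inSkew⁻ la mu {i} {0} p)) n≮0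

  -- With truncated subtraction a staircase that reaches row `0` runs on inside it; no squares lie
  -- there, so the surplus entries do not count. The same holds for column `0`.
  stairR-row0 : ∀ n {j} → length-skewPart (stairR n (0 , j)) ≡ 0
  stairR-row0 zero = refl
  stairR-row0 (suc n) {j} = trans (skewPart-out {0 , j} _ (row0∉ {j})) (trans (skewPart-out {0 , j} _ (row0∉ {j})) (stairR-row0 n))

  stairR-col0 : ∀ n {i} → length-skewPart (stairR n (i , 0)) ≡ 0
  stairR-col0 zero = refl
  stairR-col0 (suc n) {i} = trans (skewPart-out {i , 0} ((i ∸ 1 , 0) ∷ stairR n (i ∸ 1 , 0)) (col0∉ {i}))
    (trans (skewPart-out {i ∸ 1 , 0} (stairR n (i ∸ 1 , 0)) (col0∉ {i ∸ 1})) (stairR-col0 n {i ∸ 1}))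

  stairL-row0 : ∀ n {j} → length-skewPart (stairL n (0 , j)) ≡ 0
  stairL-row0 zero = refl
  stairL-row0 (suc n) {j} = trans (skewPart-out {0 , j} _ (row0∉ {j})) (trans (skewPart-out {0 , j ∸ 1} _ (row0∉ {j ∸ 1})) (stairL-row0 n))

  stairL-col0 : ∀ n {i} → length-skewPart (stairL n (i , 0)) ≡ 0
  stairL-col0 zero = refl
  stairL-col0 (suc n) {i} = trans (skewPart-out {i , 0} ((i , 0) ∷ stairL n (i ∸ 1 , 0)) (col0∉ {i}))
    (trans (skewPart-out {i , 0} (stairL n (i ∸ 1 , 0)) (col0∉ {i})) (stairL-col0 n {i ∸ 1}))

  dg-unique : ∀ {t i j} → i ≤ L → t + i ≡ j + L → dg (i , j) ≡ t
  dg-unique {t} {i} {j} i≤L e = +-cancelʳ-≡ i _ _ (trans (dg-eq j i≤L) (sym e))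

  low-diag : ∀ {t i} → t + i ≤ L → i ≤ m t
  low-diag {t} {i} le = +-cancelˡ-≤ t i (m t) (≤-trans le (profile-≥ mu L t))

  -- The staircase meets diagonal `t` in rows `i`, `i - 1`, ... and diagonal `t + 1` one row higher,
  -- whence `i ∸ 1`. Where it stops at column `0`, the remaining rows lie inside μ.
  length-stairR : ∀ n {t i j} → i < n → i ≤ L → t + i ≡ j + L →
    length-skewPart (stairR n (i , j)) ≡ count t i + count (suc t) (i ∸ 1)
  length-stairR n {i = zero} _ _ _ = stairR-row0 n
  length-stairR n {t} {suc i} {zero} _ _ e = trans (stairR-col0 n)
    (sym (cong₂ _+_ (count-low t (low-diag (≤-reflexive e)))
      (count-low (suc t) (low-diag (≤-reflexive (trans (sym (+-suc t i)) e))))))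
  length-stairR (suc n) {t} {suc i} {suc j} (s≤s i<n) i≤L e = begin
    length-skewPart (stairR (suc n) (suc i , suc j))
      ≡⟨ skewPart-in {t} {suc i} {suc j} _ (dg-unique i≤L e) ⟩
    x + length-skewPart ((i , suc j) ∷ stairR n (i , j))
      ≡⟨ cong (x +_) (skewPart-in {suc t} {i} {suc j} _ (dg-unique (<⇒≤ i≤L) (trans (sym (+-suc t i)) e))) ⟩
    x + (y + length-skewPart (stairR n (i , j)))
      ≡⟨ cong (λ z → x + (y + z)) (length-stairR n i<n (<⇒≤ i≤L) (suc-injective (trans (sym (+-suc t i)) e))) ⟩
    x + (y + (count t i + count (suc t) (i ∸ 1)))
      ≡⟨ cong (x +_) (trans (sym (+-assoc y _ _)) (trans (cong (_+ count (suc t) (i ∸ 1)) (+-comm y (count t i))) (+-assoc (count t i) y _))) ⟩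
    x + (count t i + (y + count (suc t) (i ∸ 1)))
      ≡⟨ cong (λ z → x + (count t i + z)) (last i) ⟩
    x + (count t i + count (suc t) i)
      ≡⟨ sym (+-assoc x _ _) ⟩
    count t (suc i) + count (suc t) i ∎
    where
    open ≡-Reasoning
    x = ind (In? t (suc i))
    y = ind (In? (suc t) i)
    last : ∀ i → ind (In? (suc t) i) + count (suc t) (i ∸ 1) ≡ count (suc t) i
    last (suc i) = refl
    last zero with In? (suc t) 0
    ... | yes ()
    ... | no _ = refl

  length-stairL : ∀ n {t i j} → i < n → i ≤ L → suc t + i ≡ j + L →
    length-skewPart (stairL n (i , j)) ≡ count t i + count (suc t) i
  length-stairL n {i = zero} _ _ _ = stairL-row0 n
  length-stairL n {t} {suc i} {zero} _ _ e = trans (stairL-col0 n)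
    (sym (cong₂ _+_ (count-low t (low-diag (≤-trans (n≤1+n _) (≤-reflexive e)))) (count-low (suc t) (low-diag (≤-reflexive e)))))
  length-stairL (suc n) {t} {suc i} {suc j} (s≤s i<n) i≤L e = begin
    length-skewPart (stairL (suc n) (suc i , suc j))
      ≡⟨ skewPart-in {suc t} {suc i} {suc j} _ (dg-unique i≤L e) ⟩
    x + length-skewPart ((suc i , j) ∷ stairL n (i , j))
      ≡⟨ cong (x +_) (skewPart-in {t} {suc i} {j} _ (dg-unique i≤L (suc-injective e))) ⟩
    x + (y + length-skewPart (stairL n (i , j)))
      ≡⟨ cong (λ z → x + (y + z)) (length-stairL n i<n (<⇒≤ i≤L) (trans (sym (+-suc t i)) (suc-injective e))) ⟩
    x + (y + (count t i + count (suc t) i))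
      ≡⟨ cong (x +_) (sym (+-assoc y _ _)) ⟩
    x + (count t (suc i) + count (suc t) i)
      ≡⟨ trans (sym (+-assoc x _ _)) (trans (cong (_+ count (suc t) i) (+-comm x _)) (+-assoc (count t (suc i)) x _)) ⟩
    count t (suc i) + count (suc t) (suc i) ∎
    where
    open ≡-Reasoning
    x = ind (In? (suc t) (suc i))
    y = ind (In? t (suc i))

  -- The content j - i of the squares on diagonal `t`, which is also the index of the boundary step
  -- whose snake fills the diagonals `t` and `t + 1`.
  idx : ℕ → ℤ
  idx t = ℤ.+ t ℤ.- ℤ.+ L

  idx≡ : ∀ {a b t} → a + L ≡ t + b → ℤ.+ a ℤ.- ℤ.+ b ≡ idx t
  idx≡ {a} {b} {t} e = begin
    ℤ.+ a ℤ.- ℤ.+ b          ≡⟨ ℤ.[+m]-[+n]≡m⊖n a b ⟩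
    a ⊖ b                ≡⟨ sym (ℤ.+-cancelˡ-⊖ L a b) ⟩
    (L + a) ⊖ (L + b)    ≡⟨ cong₂ _⊖_ (trans (+-comm L a) (trans e (+-comm t b))) (+-comm L b) ⟩
    (b + t) ⊖ (b + L)    ≡⟨ ℤ.+-cancelˡ-⊖ b t L ⟩
    t ⊖ L                ≡⟨ sym (ℤ.[+m]-[+n]≡m⊖n t L) ⟩
    idx t ∎
    where open ≡-Reasoning

  idx-< : ∀ {s t} → s < t → idx s ℤ.< idx t
  idx-< p = ℤ.+-monoˡ-< (ℤ.- ℤ.+ L) (ℤ.+<+ p)

  idx-inj : ∀ {s t} → idx s ≡ idx t → s ≡ t
  idx-inj {s} {t} e with <-cmp s t
  ... | tri≈ _ p _ = p
  ... | tri< p _ _ = contradiction (idx-< p) (ℤ.<-irrefl e)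
  ... | tri> _ _ p = contradiction (idx-< p) (ℤ.<-irrefl (sym e))

  idx-<⁻ : ∀ {s t} → idx s ℤ.< idx t → s < t
  idx-<⁻ {s} {t} p with s <? t
  ... | yes q = q
  ... | no q = contradiction (ℤ.<-≤-trans p (ℤ.+-monoˡ-≤ (ℤ.- ℤ.+ L) (ℤ.+≤+ (≮⇒≥ q)))) (ℤ.<-irrefl refl)

  idx-diff : ∀ {s t} → s ≤ t → ℤ.∣ idx t ℤ.- idx s ∣ ≡ t ∸ s
  idx-diff {s} {t} s≤t = cong ℤ.∣_∣ (begin
    idx t ℤ.- idx s      ≡⟨ solve 3 (λ a b c → (a :- c) :- (b :- c) := a :- b) refl (ℤ.+ t) (ℤ.+ s) (ℤ.+ L) ⟩
    ℤ.+ t ℤ.- ℤ.+ s      ≡⟨ ℤ.[+m]-[+n]≡m⊖n t s ⟩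
    t ⊖ s                ≡⟨ ℤ.⊖-≥ s≤t ⟩
    ℤ.+ (t ∸ s) ∎)
    where
    open ≡-Reasoning
    open ℤ.+-*-Solver

  -- Left and right snakes in terms of the profiles

  rightSnake⁻ : ∀ {i} → RightSnakeRow la mu i → ∃ λ t → IsRight t × l t ≡ i × t + i ≡ part la i + L
  rightSnake⁻ {i} (1≤i , ne , odd) = t , (m≡ , l≡) , lt≡ , teq
    where
    j = part la i
    t = dg (i , j)
    in-skew : Tr (inSkew la mu (i , j))
    in-skew = inSkew⁺ la mu {i} (≤∧≢⇒< (con i) ne) ≤-refl
    i≤L : i ≤ L
    i≤L = proj₂ (inSkew-pos la mu {i} {j} in-skew)
    i∈ : In t i
    i∈ = skew⁻ {i} {j} in-skew
    teq : t + i ≡ j + L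
    teq = dg-eq j i≤L
    lt≡ : l t ≡ i
    lt≡ with m≤n⇒m<n∨m≡n (proj₂ i∈)
    ... | inj₂ e = sym e
    ... | inj₁ i<l = contradiction (profile⁻ pl {L} {t} {suc i} (s≤s z≤n) i<l)
            (<⇒≱ (+-mono-≤-< (part-mono pl 1≤i (n≤1+n i)) (∸-monoʳ-< (n<1+n i) (≤-trans i<l (profile-≤ la L t)))))
    l≡ : l t ≡ suc (l (suc t))
    l≡ with l-step t
    ... | inj₂ e = e
    ... | inj₁ e = contradiction (profile⁻ pl {L} {suc t} {i} 1≤i (≤-reflexive (trans (sym lt≡) e))) 1+n≰n
    len : length (snakeR la mu i) ≡ (l t ∸ m t) + (l (suc t) ∸ m (suc t))
    len = trans (length-stairR (suc i) {t} {i} {j} ≤-refl i≤L teq)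
      (cong₂ _+_ (count-full t (sym lt≡)) (count-full (suc t) (cong (_∸ 1) (trans (sym lt≡) l≡))))
    -- If μ dropped as well, both diagonals would have equally many squares and the snake would have
    -- even size.
    m≡ : m t ≡ m (suc t)
    m≡ with m-step t
    ... | inj₁ e = e
    ... | inj₂ e = contradiction (trans (sym odd) (trans (cong (_% 2) (trans len
            (cong (_+ (l (suc t) ∸ m (suc t))) (cong₂ _∸_ l≡ e)))) (double-even (l (suc t) ∸ m (suc t))))) λ ()

  right-row : ∀ {t} → IsRight t → t + l t ≡ part la (l t) + L
  right-row {t} (m≡ , l≡) = trans (cong (_+ l t) eq) (dg-eq (part la (l t)) (profile-≤ la L t))
    where
    1≤l : 1 ≤ l t
    1≤l = subst (1 ≤_) (sym l≡) (s≤s z≤n)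
    eq : t ≡ dg (l t , part la (l t))
    eq = ≤-antisym (profile⁻ pl {L} {t} {l t} 1≤l ≤-refl)
      (s≤s⁻¹ (≰⇒> λ q → contradiction (profile⁺ la {L} {suc t} {l t} 1≤l (profile-≤ la L t) q) (<⇒≱ (≤-reflexive (sym l≡)))))

  length-snakeR : ∀ {t} → IsRight t → length (snakeR la mu (l t)) ≡ suc ((l (suc t) ∸ m (suc t)) + (l (suc t) ∸ m (suc t)))
  length-snakeR {t} R@(m≡ , l≡) = trans (length-stairR (suc (l t)) {t} {l t} {part la (l t)} ≤-refl (profile-≤ la L t) (right-row R))
    (cong₂ _+_ (trans (count-full t refl) (trans (cong₂ _∸_ l≡ m≡) (+-∸-assoc 1 (m≤l (suc t))))) (count-full (suc t) (cong (_∸ 1) l≡)))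

  rightSnake⁺ : ∀ {t} → IsRight t → RightSnakeRow la mu (l t)
  rightSnake⁺ {t} R@(m≡ , l≡) = subst (1 ≤_) (sym l≡) (s≤s z≤n) , ne , trans (cong (_% 2) (length-snakeR R)) (double+1-odd (l (suc t) ∸ m (suc t)))
    where
    ne : part mu (l t) ≢ part la (l t)
    ne e = contradiction (profile⁺ mu {L} {t} {l t} (subst (1 ≤_) (sym l≡) (s≤s z≤n)) (profile-≤ la L t)
        (≤-trans (profile⁻ pl {L} {t} (subst (1 ≤_) (sym l≡) (s≤s z≤n)) ≤-refl) (+-monoˡ-≤ (L ∸ l t) (≤-reflexive (sym e)))))
      (<⇒≱ (<-≤-trans (s≤s (≤-trans (≤-reflexive m≡) (m≤l (suc t)))) (≤-reflexive (sym l≡))))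

  rightAt⁻ : ∀ {k} → RightSnakeAt la mu k → ∃ λ t → IsRight t × k ≡ idx t
  rightAt⁻ (i , rs , refl) with rightSnake⁻ rs
  ... | t , R , _ , e = t , R , idx≡ (sym e)

  rightAt⁺ : ∀ {t} → IsRight t → RightSnakeAt la mu (idx t)
  rightAt⁺ {t} R = l t , rightSnake⁺ R , idx≡ (sym (right-row R))

  leftAt⁻ : ∀ {k} → LeftSnakeAt la mu k → ∃ λ t → IsLeft t × k ≡ idx t
  leftAt⁻ (suc j , (_ , ne , odd) , refl) = t , (m≡ , l≡) , idx≡ {suc j} {suc i} {t} (trans (cong suc (sym teq)) (sym (+-suc t i)))
    where
    i = conj la (suc j)
    i≤L : i ≤ L
    i≤L = conj-≤-length la (suc j)
    -- The square above the horizontal step is `(i , suc j)`, on the second diagonal of the snake;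
    -- its left neighbour `(i , j)` gives the first one.
    t = dg (i , j)
    teq : t + i ≡ j + L
    teq = dg-eq j i≤L
    i≤l : i ≤ l (suc t)
    i≤l = lem i refl
      where
      lem : ∀ k → k ≡ i → k ≤ l (suc t)
      lem zero _ = z≤n
      lem (suc k) e = profile⁺ la (s≤s z≤n) (subst (_≤ L) (sym e) i≤L)
        (≤-trans (≤-reflexive (cong (λ z → suc j + (L ∸ z)) (sym e))) (+-monoˡ-≤ (L ∸ suc k) (conj⁻ pl {suc k} {suc j} (s≤s z≤n) (≤-reflexive e))))
    l≤i : l t ≤ i
    l≤i = ≮⇒≥ λ i<l → contradiction
      (conj⁺ pl {suc i} {suc j} (s≤s z≤n) (s≤s z≤n) (+-cancelʳ-≤ (L ∸ suc i) (suc j) (part la (suc i))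
        (subst (_≤ part la (suc i) + (L ∸ suc i)) (down-dg {i} j (≤-trans i<l (profile-≤ la L t)))
          (profile⁻ pl {L} {t} {suc i} (s≤s z≤n) i<l)))) 1+n≰n
    l≡ : l t ≡ l (suc t)
    l≡ with l-step t
    ... | inj₁ e = e
    ... | inj₂ e = contradiction (≤-trans (≤-reflexive (sym e)) (≤-trans l≤i i≤l)) 1+n≰n
    lt≡ : i ≡ l t
    lt≡ = ≤-antisym (≤-trans i≤l (≤-reflexive (sym l≡))) l≤i
    len : length (snakeL la mu (suc j)) ≡ (l t ∸ m t) + (l (suc t) ∸ m (suc t))
    len = trans (length-stairL (suc i) {t} {i} {suc j} ≤-refl i≤L (cong suc teq))
      (cong₂ _+_ (count-full t lt≡) (count-full (suc t) (trans lt≡ l≡)))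
    m≡ : m t ≡ suc (m (suc t))
    m≡ with m-step t
    ... | inj₂ e = e
    ... | inj₁ e = contradiction (trans (sym odd) (trans (cong (_% 2) (trans len
            (cong (_+ (l (suc t) ∸ m (suc t))) (cong₂ _∸_ l≡ e)))) (double-even (l (suc t) ∸ m (suc t))))) λ ()

  leftAt⁺ : ∀ {t} → IsLeft t → LeftSnakeAt la mu (idx t)
  leftAt⁺ {t} (m≡ , l≡) = suc j , (s≤s z≤n , ne , trans (cong (_% 2) len) odd) , idx≡ {suc j} {suc (conj la (suc j))} {t} ieq
    where
    i = l t
    j = (t + i) ∸ L
    i≤L : i ≤ L
    i≤L = profile-≤ la L t
    L≤ : L ≤ t + i
    L≤ = profile-≥ la L t
    teq : t + i ≡ j + L
    teq = sym (m∸n+n≡m L≤)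
    dgt : dg (i , j) ≡ t
    dgt = dg-unique i≤L teq
    1≤i : 1 ≤ i
    1≤i = ≤-trans (subst (1 ≤_) (sym m≡) (s≤s z≤n)) (m≤l t)
    conj≡ : conj la (suc j) ≡ i
    conj≡ = ≤-antisym upper (conj⁺ pl 1≤i (s≤s z≤n) (+-cancelʳ-≤ (L ∸ i) (suc j) (part la i)
      (subst (_≤ part la i + (L ∸ i)) (cong suc (sym dgt)) (profile⁻ pl {L} {suc t} {i} 1≤i (≤-reflexive l≡)))))
      where
      upper : conj la (suc j) ≤ i
      upper = ≮⇒≥ λ i<c → contradiction
        (profile⁺ la {L} {t} {suc i} (s≤s z≤n) (≤-trans i<c (conj-≤-length la (suc j)))
          (subst (_≤ part la (suc i) + (L ∸ suc i)) (trans (sym (down-dg j (≤-trans i<c (conj-≤-length la (suc j))))) dgt)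
            (+-monoˡ-≤ (L ∸ suc i) (conj⁻ pl {suc i} {suc j} (s≤s z≤n) i<c)))) 1+n≰n
    ne : conj mu (suc j) ≢ conj la (suc j)
    ne e = contradiction (profile⁺ mu {L} {suc t} {i} 1≤i i≤L
        (subst (_≤ part mu i + (L ∸ i)) (cong suc dgt)
          (+-monoˡ-≤ (L ∸ i) (conj⁻ pm {i} {suc j} 1≤i (≤-reflexive (sym (trans e conj≡)))))))
      (<⇒≱ (≤-trans (≤-reflexive (sym m≡)) (m≤l t)))
    ieq : suc j + L ≡ t + suc (conj la (suc j))
    ieq = trans (cong suc (trans (sym teq) (cong (t +_) (sym conj≡)))) (sym (+-suc t _))
    k = l t ∸ m t
    len : length (snakeL la mu (suc j)) ≡ suc (k + k)
    len = trans (length-stairL (suc (conj la (suc j))) {t} {conj la (suc j)} {suc j} ≤-refl (conj-≤-length la (suc j))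
            (cong suc (trans (cong (t +_) conj≡) teq)))
      (trans (cong₂ _+_ (count-full t conj≡) (trans (count-full (suc t) (trans conj≡ l≡)) more)) (+-suc k k))
      where
      more : l (suc t) ∸ m (suc t) ≡ suc k
      more = trans (cong (_∸ m (suc t)) (sym l≡)) (trans (suc∸ (m (suc t)) (l t) (≤-trans (≤-reflexive (sym m≡)) (m≤l t))) (cong (λ z → suc (l t ∸ z)) (sym m≡)))
    odd : suc (k + k) % 2 ≡ 1
    odd = double+1-odd k

  -- The links fixed in a right snake

  stairR-dg : ∀ n {t i j c} → i ≤ L → t + i ≡ j + L → c ∈ stairR n (i , j) → Tr (inSkew la mu c) →
    dg c ≡ t ⊎ dg c ≡ suc t
  stairR-dg (suc n) i≤L e (here refl) _ = inj₁ (dg-unique i≤L e)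
  stairR-dg (suc n) {i = zero} {j} i≤L e (there (here refl)) s = contradiction s (row0∉ {j})
  stairR-dg (suc n) {t} {suc i} {j} i≤L e (there (here refl)) _ = inj₂ (dg-unique (<⇒≤ i≤L) (trans (sym (+-suc t i)) e))
  stairR-dg (suc n) {t} {zero} {j} i≤L e (there (there p)) s = contradiction s (all-row0 n p)
    where
    all-row0 : ∀ n {j c} → c ∈ stairR n (0 , j) → ¬ Tr (inSkew la mu c)
    all-row0 (suc n) {j} (here refl) = row0∉ {j}
    all-row0 (suc n) {j} (there (here refl)) = row0∉ {j}
    all-row0 (suc n) {j} (there (there p)) = all-row0 n p
  stairR-dg (suc n) {t} {suc i} {zero} i≤L e (there (there p)) s = contradiction s (all-col0 n p)
    where
    all-col0 : ∀ n {i c} → c ∈ stairR n (i , 0) → ¬ Tr (inSkew la mu c)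
    all-col0 (suc n) {i} (here refl) = col0∉ {i}
    all-col0 (suc n) {i} (there (here refl)) = col0∉ {i ∸ 1}
    all-col0 (suc n) {i} (there (there p)) = all-col0 n p
  stairR-dg (suc n) {t} {suc i} {suc j} i≤L e (there (there p)) s =
    stairR-dg n (<⇒≤ i≤L) (suc-injective (trans (sym (+-suc t i)) e)) p s

  -- Named after the move of a strip from diagonal `t` to `t + 1`. The pairs are ordered as in
  -- `Adj`, so an up link lists its square on the second diagonal first.
  stayLink upLink : ℕ → ℕ → Link
  stayLink t i = cellAt t i , cellAt (suc t) i
  upLink t i = cellAt (suc t) i , cellAt t (suc i)

  LinkView : ℕ → Link → Set
  LinkView t x = ∃ λ i → In (suc t) i × (x ≡ stayLink t i × In t i ⊎ x ≡ upLink t i × In t (suc i))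

  module RightLinks {t : ℕ} (R : IsRight t) {FS : List Link} (good : GoodLinkSet (snakeR la mu (l t)) FS) where

    private
      unique-FS = proj₁ good
      links = proj₁ (proj₂ good)
      count-FS = proj₁ (proj₂ (proj₂ good))
      apart = proj₂ (proj₂ (proj₂ good))

    snake-view : ∀ {c} → c ∈ snakeR la mu (l t) → In (dg c) (proj₁ c) × (dg c ≡ t ⊎ dg c ≡ suc t) × proj₁ c ≤ L
    snake-view {i , j} p with ∈-filter⁻ (λ c → T? (inSkew la mu c)) {i , j} {stairR (suc (l t)) (l t , part la (l t))} p
    ... | q , s = skew⁻ {i} {j} s , stairR-dg (suc (l t)) (profile-≤ la L t) (right-row R) q s , proj₂ (inSkew-pos la mu {i} {j} s)

    at-diagonal : ∀ {s i j} → dg (i , j) ≡ s → i ≤ L → (i , j) ≡ cellAt s i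
    at-diagonal refl le = sym (cellAt-dg le)

    view : ∀ {x} → x ∈ FS → LinkView t x
    view {(i , j) , c′} x∈ with All.lookup links x∈
    ... | c∈ , c′∈ , adj with snake-view c∈ | snake-view c′∈
    view {(i , j) , _} x∈ | c∈ , c′∈ , inj₁ refl | in₁ , dg₁ , le | in₂ , dg₂ , _ = go dg₁ dg₂
      where
      go : dg (i , j) ≡ t ⊎ dg (i , j) ≡ suc t → suc (dg (i , j)) ≡ t ⊎ suc (dg (i , j)) ≡ suc t → LinkView t ((i , j) , (i , suc j))
      go (inj₁ e) _ = i , subst (λ s → In (suc s) i) e in₂ ,
        inj₁ (cong₂ _,_ (at-diagonal e le) (at-diagonal {suc t} {i} {suc j} (cong suc e) le) , subst (λ s → In s i) e in₁)
      go (inj₂ e) (inj₁ e′) = contradiction (trans (sym e′) (cong suc e)) (<⇒≢ (m<n⇒m<1+n (n<1+n t)))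
      go (inj₂ e) (inj₂ e′) = contradiction (trans (sym (cong suc e)) e′) 1+n≢n
    view {(i , j) , _} x∈ | c∈ , c′∈ , inj₂ refl | in₁ , dg₁ , le | in₂ , dg₂ , le′ = go dg₁ dg₂
      where
      go : dg (i , j) ≡ t ⊎ dg (i , j) ≡ suc t → dg (suc i , j) ≡ t ⊎ dg (suc i , j) ≡ suc t → LinkView t ((i , j) , (suc i , j))
      go _ (inj₁ e) = i , subst (λ s → In s i) e′ in₁ ,
        inj₂ (cong₂ _,_ (at-diagonal e′ le) (at-diagonal e le′) , subst (λ s → In s (suc i)) e in₂)
        where
        e′ : dg (i , j) ≡ suc t
        e′ = trans (down-dg j le′) (cong suc e)
      go (inj₁ e) (inj₂ e′) = contradiction (trans (sym e) (trans (down-dg j le′) (cong suc e′))) (<⇒≢ (m<n⇒m<1+n (n<1+n t)))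
      go (inj₂ e) (inj₂ e′) = contradiction (trans (cong suc (sym e′)) (trans (sym (down-dg j le′)) e)) 1+n≢n

    -- In both kinds of links this is the row of the square on the second diagonal.
    rowOf : Link → ℕ
    rowOf ((i , _) , _) = i

    shared⇒≡ : ∀ {x y} → x ∈ FS → y ∈ FS → SharesSquare x y → x ≡ y
    shared⇒≡ {x} {y} x∈ y∈ sh with x ≟L y
    ... | yes p = p
    ... | no p = contradiction sh (apart x y x∈ y∈ p)

    rowOf-inj : ∀ {x y} → x ∈ FS → y ∈ FS → rowOf x ≡ rowOf y → x ≡ y
    rowOf-inj x∈ y∈ e with view x∈ | view y∈
    ... | _ , _ , inj₁ (refl , _) | _ , _ , inj₁ (refl , _) = cong (stayLink t) e
    ... | _ , _ , inj₁ (refl , _) | _ , _ , inj₂ (refl , _) = shared⇒≡ x∈ y∈ (inj₂ (inj₂ (inj₁ (cong (cellAt (suc t)) e))))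
    ... | _ , _ , inj₂ (refl , _) | _ , _ , inj₁ (refl , _) = shared⇒≡ x∈ y∈ (inj₂ (inj₁ (cong (cellAt (suc t)) e)))
    ... | _ , _ , inj₂ (refl , _) | _ , _ , inj₂ (refl , _) = cong (upLink t) e

    -- Links without common squares use different squares of the second diagonal, and by the length
    -- of the snake there are as many links as such squares.
    covered : ∀ {i} → In (suc t) i → stayLink t i ∈ FS ⊎ upLink t i ∈ FS
    covered {i} (a , b) with ∈-map⁻ rowOf (unique-⊆-≥⇒⊇ (unique-map⁺-local rowOf-inj unique-FS) sub len (∈-rows⁺ a b))
      where
      sub : ∀ {r} → r ∈ map rowOf FS → r ∈ rows (m (suc t)) (l (suc t))
      sub p with ∈-map⁻ rowOf p
      ... | x , x∈ , refl with view x∈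
      ... | i , (c , d) , inj₁ (refl , _) = ∈-rows⁺ c d
      ... | i , (c , d) , inj₂ (refl , _) = ∈-rows⁺ c d
      len : length (rows (m (suc t)) (l (suc t))) ≤ length (map rowOf FS)
      len = ≤-reflexive (trans (length-rows (m (suc t)) (l (suc t))) (sym (trans (length-map rowOf FS)
        (trans count-FS (trans (cong (λ z → ⌊ (z ∸ 1) /2⌋) (length-snakeR R)) (half-double (l (suc t) ∸ m (suc t))))))))
    ... | x , x∈ , refl with view x∈
    ... | _ , _ , inj₁ (refl , _) = inj₁ x∈
    ... | _ , _ , inj₂ (refl , _) = inj₂ x∈

    stay≢up : ∀ {i} → In t i → stayLink t i ≢ upLink t i
    stay≢up {i} i∈ e = contradiction (trans (sym (dg-cellAt {suc t} {i} (in-≤L {t} i∈) (<⇒≤ (m<n⇒m<1+n (in-> {t} i∈)))))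
      (trans (cong (dg ∘ proj₁) (sym e)) (dg-in {t} i∈))) 1+n≢n

    abstract
      turning : ∃ λ c → m (suc t) ≤ c × c ≤ l (suc t) ×
        (∀ i → m (suc t) < i → i ≤ c → stayLink t i ∈ FS) × (∀ i → c < i → i ≤ l (suc t) → upLink t i ∈ FS)
      turning = threshold (λ i → stayLink t i ∈ FS) (λ i → upLink t i ∈ FS) (m (suc t)) (l (suc t)) (m≤l (suc t))
        (λ i a b → covered (a , b))
        -- An up link in row `i` and a stay link in row `i + 1` would share the square of diagonal
        -- `t` in row `i + 1`.
        (λ i a b q p → contradiction (cong rowOf (shared⇒≡ q p (inj₂ (inj₂ (inj₁ refl))))) (1+n≢n ∘ sym))

    -- Stay links take the rows of diagonal `t` up to the switch and up links those from two after
    -- it on; the row in between remains free, so a strip ends there.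
    q : ℕ
    q = suc (proj₁ turning)

    q-in : In t q
    q-in = let (c , a , b , _) = turning in
      s≤s (≤-trans (≤-reflexive (proj₁ R)) a) , ≤-trans (s≤s b) (≤-reflexive (sym (proj₂ R)))

    stay⁺ : ∀ {i} → In t i → i < q → stayLink t i ∈ FS
    stay⁺ {i} (a , _) (s≤s i≤) = proj₁ (proj₂ (proj₂ (proj₂ turning))) i (≤-trans (s≤s (≤-reflexive (sym (proj₁ R)))) a) i≤

    up⁺ : ∀ {i} → In t (suc i) → q < suc i → upLink t i ∈ FS
    up⁺ {i} (_ , b) (s≤s q≤i) = proj₂ (proj₂ (proj₂ (proj₂ turning))) i q≤i (s≤s⁻¹ (≤-trans b (≤-reflexive (proj₂ R))))

    -- The decompositions to be constructed must use every link of F, so there must be no links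
    -- besides those determined by `q`.
    classify : ∀ {x} → x ∈ FS → ∃ λ i →
      (x ≡ stayLink t i × In t i × i < q) ⊎ (x ≡ upLink t i × In t (suc i) × q < suc i)
    classify x∈ with view x∈
    ... | i , i∈ , inj₁ (refl , i∈t) with i <? q
    ... | yes p = i , inj₁ (refl , i∈t , p)
    ... | no p = contradiction (rowOf-inj x∈ (proj₂ (proj₂ (proj₂ (proj₂ turning))) i (≮⇒≥ p) (proj₂ i∈)) refl) (stay≢up i∈t)
    classify x∈ | i , i∈ , inj₂ (refl , i∈t) with q <? suc i
    ... | yes p = i , inj₂ (refl , i∈t , p)
    ... | no p = contradiction (rowOf-inj (proj₁ (proj₂ (proj₂ (proj₂ turning))) i (proj₁ i∈) (s≤s⁻¹ (≮⇒≥ p))) x∈ refl)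
          (stay≢up (subst (_< i) (sym (proj₁ R)) (proj₁ i∈) , ≤-trans (proj₂ i∈) (≤-trans (n≤1+n _) (≤-reflexive (sym (proj₂ R))))))

  -- The rank counts the left snakes

  skew-true : ∀ {t i j} → dg (i , j) ≡ t → In t i → inSkew la mu (i , j) ≡ true
  skew-true {_} {i} {j} refl p = Tr⇒true (skew⁺ {i} {j} p)

  skew-false : ∀ {t i j} → dg (i , j) ≡ t → ¬ In t i → inSkew la mu (i , j) ≡ false
  skew-false {_} {i} {j} refl p = ¬Tr⇒false (p ∘ skew⁻ {i} {j})

  -- Whether the boundary path of μ has a vertical step between the diagonals `t` and `t + 1`.
  V : ℕ → Bool
  V t = does (m t ≟ suc (m (suc t)))

  V-true : ∀ t → m t ≡ suc (m (suc t)) → V t ≡ true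
  V-true t = dec-true (m t ≟ suc (m (suc t)))

  V-false : ∀ t → m t ≢ suc (m (suc t)) → V t ≡ false
  V-false t = dec-false (m t ≟ suc (m (suc t)))

  D : ℕ → ℕ
  D t = l t ∸ m t

  module Square {t i j : ℕ} (i<L : suc i ≤ L) (e : dg (suc i , suc j) ≡ t) where

    up : dg (i , suc j) ≡ suc t
    up = trans (down-dg (suc j) i<L) (cong suc e)

    upLeft : dg (i , j) ≡ t
    upLeft = suc-injective up

    lower-square : ∀ {s} → t ≡ suc s → dg (suc i , j) ≡ s
    lower-square refl = suc-injective e

  cellAt-suc : ∀ {t i} → In t i → ∃ λ i′ → ∃ λ j′ → i ≡ suc i′ × cellAt t i ≡ (suc i′ , suc j′) × suc i′ ≤ L × dg (suc i′ , suc j′) ≡ t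
  cellAt-suc {t} {suc i} i∈ with (t + suc i) ∸ L in eq
  ... | zero = contradiction (subst (0 <_) eq (m<n⇒0<n∸m (in-> {t} i∈))) (<-irrefl refl)
  ... | suc j = i , j , refl , refl , in-≤L {t} i∈ , trans (cong (_+ (L ∸ suc i)) (sym eq)) (dg-in {t} i∈)

  l-antitone : ∀ t → l (suc t) ≤ l t
  l-antitone = profile-antitone pl L

  l-drop : ∀ t → l t ≤ suc (l (suc t))
  l-drop = profile-drop≤1 pl L

  m-antitone : ∀ t → m (suc t) ≤ m t
  m-antitone = profile-antitone pm L

  -- Below the first square of a diagonal, both the upper and the upper left neighbour are squares
  -- of λ/μ. The former excludes an outside corner, the latter an inside corner.
  nontop : ∀ {t i} → suc (m t) < i → i ≤ l t → outsideTop la mu (cellAt t i) ≡ false × insideTop la mu (cellAt t i) ≡ false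
  nontop {t} {i} lt le with cellAt-suc {t} {i} (<-trans (n<1+n _) lt , le)
  ... | i′ , j′ , refl , eq , i<L , dgt = trans (cong (outsideTop la mu) eq) out , trans (cong (insideTop la mu) eq) ins
    where
    open Square i<L dgt
    up∈ : inSkew la mu (i′ , suc j′) ≡ true
    up∈ = skew-true up (≤-<-trans (m-antitone t) (s≤s⁻¹ lt) , s≤s⁻¹ (≤-trans le (l-drop t)))
    ul∈ : inSkew la mu (i′ , j′) ≡ true
    ul∈ = skew-true upLeft (s≤s⁻¹ lt , <⇒≤ le)
    out : outsideTop la mu (suc i′ , suc j′) ≡ false
    out = trans (cong (λ b → inSkew la mu (suc i′ , suc j′) ∧ᵇ not b ∧ᵇ not (inSkew la mu (suc i′ , j′))) up∈)
      (∧-zeroʳ (inSkew la mu (suc i′ , suc j′)))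
    ins : insideTop la mu (suc i′ , suc j′) ≡ false
    ins = trans (cong (λ b → inSkew la mu (suc i′ , suc j′) ∧ᵇ inSkew la mu (i′ , suc j′) ∧ᵇ inSkew la mu (suc i′ , j′) ∧ᵇ not b) ul∈)
      (trans (cong (λ b → inSkew la mu (suc i′ , suc j′) ∧ᵇ inSkew la mu (i′ , suc j′) ∧ᵇ b) (∧-zeroʳ (inSkew la mu (suc i′ , j′))))
        (trans (cong (inSkew la mu (suc i′ , suc j′) ∧ᵇ_) (∧-zeroʳ (inSkew la mu (i′ , suc j′))))
          (∧-zeroʳ (inSkew la mu (suc i′ , suc j′)))))

  -- For the first square of a diagonal, the upper neighbour is present iff μ steps vertically after
  -- `t`, the left one iff μ does not step vertically before `t`, and the upper left one lies in μ.
  top : ∀ {s} → let t = suc s in m t < l t →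
    outsideTop la mu (cellAt t (suc (m t))) ≡ not (V t) ∧ᵇ V s × insideTop la mu (cellAt t (suc (m t))) ≡ V t ∧ᵇ not (V s)
  top {s} m<l with cellAt-suc {suc s} {suc (m (suc s))} (≤-refl , m<l)
  ... | i′ , j′ , refl , eq , i<L , dgt = trans (cong (outsideTop la mu) eq) out , trans (cong (insideTop la mu) eq) ins
    where
    t = suc s
    open Square i<L dgt
    self : inSkew la mu (suc (m t) , suc j′) ≡ true
    self = skew-true {t} dgt (≤-refl , m<l)
    up≡ : inSkew la mu (m t , suc j′) ≡ V t
    up≡ = go (m t ≟ suc (m (suc t)))
      where
      go : Dec (m t ≡ suc (m (suc t))) → inSkew la mu (m t , suc j′) ≡ V t
      go (yes p) = trans (skew-true up (≤-reflexive (sym p) , s≤s⁻¹ (≤-trans m<l (l-drop t)))) (sym (V-true t p))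
      go (no p) = trans (skew-false up λ (x , _) → p (≤-antisym (profile-drop≤1 pm L t) x)) (sym (V-false t p))
    left≡ : inSkew la mu (suc (m t) , j′) ≡ not (V s)
    left≡ = go (m s ≟ suc (m t))
      where
      go : Dec (m s ≡ suc (m t)) → inSkew la mu (suc (m t) , j′) ≡ not (V s)
      go (yes p) = trans (skew-false (lower-square refl) λ (x , _) → <-irrefl p x) (cong not (sym (V-true s p)))
      go (no p) = trans (skew-true (lower-square refl) (≤∧≢⇒< (profile-drop≤1 pm L s) p , ≤-trans m<l (l-antitone s)))
        (cong not (sym (V-false s p)))
    ul≡ : inSkew la mu (m t , j′) ≡ false
    ul≡ = skew-false upLeft λ (x , _) → <-irrefl refl x
    not-not : ∀ b → not (not b) ≡ b
    not-not true = refl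
    not-not false = refl
    out : outsideTop la mu (suc (m t) , suc j′) ≡ not (V t) ∧ᵇ V s
    out = trans (cong₂ _∧ᵇ_ self (cong₂ (λ a b → not a ∧ᵇ not b) up≡ left≡)) (cong (not (V t) ∧ᵇ_) (not-not (V s)))
    ins : insideTop la mu (suc (m t) , suc j′) ≡ V t ∧ᵇ not (V s)
    ins = trans (cong₂ _∧ᵇ_ self (cong₂ _∧ᵇ_ up≡ (cong₂ (λ a b → a ∧ᵇ not b) left≡ ul≡)))
      (cong (V t ∧ᵇ_) (∧-identityʳ (not (V s))))

  diagLen-top : ∀ {t} → m t < l t → diagLen la mu (cellAt t (suc (m t))) ≡ D t
  diagLen-top {t} m<l = trans (↭-length (unique-set⇒↭ (Unique.filter⁺ (λ c → T? (inSkew la mu c)) uniq) uniq′ to from))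
    (trans (length-map (cellAt t) (rows (m t) (l t))) (length-rows (m t) (l t)))
    where
    i₀ = suc (m t)
    i₀∈ : In t i₀
    i₀∈ = ≤-refl , m<l
    j₀ = (t + i₀) ∸ L
    at : ℕ → Cell
    at p = i₀ + p , j₀ + p
    j₀+L : j₀ + L ≡ t + i₀
    j₀+L = m∸n+n≡m (<⇒≤ (in-> {t} i₀∈))
    uniq : Unique (map at (upTo (suc L)))
    uniq = Unique.map⁺ (λ e → +-cancelˡ-≡ i₀ _ _ (cong proj₁ e)) (upTo⁺ (suc L))
    uniq′ : Unique (map (cellAt t) (rows (m t) (l t)))
    uniq′ = Unique.map⁺ (cong proj₁) (rows-unique (m t) (l t))
    at-col : ∀ p → t + (i₀ + p) ≡ (j₀ + p) + L
    at-col p = trans (sym (+-assoc t i₀ p)) (trans (cong (_+ p) (sym j₀+L))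
      (trans (+-assoc j₀ L p) (trans (cong (j₀ +_) (+-comm L p)) (sym (+-assoc j₀ p L)))))
    to : ∀ {c} → c ∈ filter (λ c → T? (inSkew la mu c)) (map at (upTo (suc L))) → c ∈ map (cellAt t) (rows (m t) (l t))
    to {c} c∈ with ∈-filter⁻ (λ c → T? (inSkew la mu c)) {c} {map at (upTo (suc L))} c∈
    ... | q , s with ∈-map⁻ at q
    ... | p , _ , refl = subst (_∈ map (cellAt t) (rows (m t) (l t))) cell≡ (∈-map⁺ (cellAt t) (∈-rows⁺ (proj₁ r∈) (proj₂ r∈)))
      where
      le : i₀ + p ≤ L
      le = proj₂ (inSkew-pos la mu {i₀ + p} {j₀ + p} s)
      dg≡ : dg (i₀ + p , j₀ + p) ≡ t
      dg≡ = dg-unique le (at-col p)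
      r∈ : In t (i₀ + p)
      r∈ = subst (λ s → In s (i₀ + p)) dg≡ (skew⁻ {i₀ + p} {j₀ + p} s)
      cell≡ : cellAt t (i₀ + p) ≡ at p
      cell≡ = cong (i₀ + p ,_) (trans (cong (_∸ L) (at-col p)) (m+n∸n≡m (j₀ + p) L))
    from : ∀ {c} → c ∈ map (cellAt t) (rows (m t) (l t)) → c ∈ filter (λ c → T? (inSkew la mu c)) (map at (upTo (suc L)))
    from c∈ with ∈-map⁻ (cellAt t) c∈
    ... | r , r∈ , refl = ∈-filter⁺ (λ c → T? (inSkew la mu c))
        (subst (_∈ map at (upTo (suc L))) cell≡ (∈-map⁺ at (∈-upTo⁺ (s≤s (≤-trans (m∸n≤m r i₀) (in-≤L {t} inr))))))
        (cellAt-skew {t} inr)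
      where
      inr : In t r
      inr = ∈-rows⁻ (m t) (l t) r∈
      p = r ∸ i₀
      r≡ : i₀ + p ≡ r
      r≡ = m+[n∸m]≡n (proj₁ inr)
      cell≡ : at p ≡ cellAt t r
      cell≡ = cong₂ _,_ r≡ (trans (sym (m+n∸n≡m (j₀ + p) L)) (cong (_∸ L) (trans (sym (at-col p)) (cong (t +_) r≡))))

  outW inW : Cell → ℕ
  outW c = if outsideTop la mu c then diagLen la mu c else 0
  inW c = if insideTop la mu c then diagLen la mu c else 0

  diagSum : ∀ (w : Cell → ℕ) (b : Bool) {t} →
    (∀ {i} → suc (m t) < i → i ≤ l t → w (cellAt t i) ≡ 0) →
    (m t < l t → w (cellAt t (suc (m t))) ≡ when b (D t)) →
    sum (map (w ∘ cellAt t) (rows (m t) (l t))) ≡ when b (D t)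
  diagSum w b {t} z e with m t <? l t
  ... | yes p = trans (sum-rows (w ∘ cellAt t) z p) (e p)
  ... | no p = trans (cong (λ xs → sum (map (w ∘ cellAt t) xs)) (rows-[] (≮⇒≥ p)))
    (sym (trans (cong (when b) (m≤n⇒m∸n≡0 (≮⇒≥ p))) (when-0 b)))

  outSum : ∀ s → let t = suc s in sum (map (outW ∘ cellAt t) (rows (m t) (l t))) ≡ when (not (V t) ∧ᵇ V s) (D t)
  outSum s = diagSum outW (not (V t) ∧ᵇ V s) {t}
    (λ {i} x y → cong (λ b → if b then diagLen la mu (cellAt t i) else 0) (proj₁ (nontop {t} x y)))
    (λ p → cong₂ when (proj₁ (top p)) (diagLen-top {t} p))
    where t = suc s

  inSum : ∀ s → let t = suc s in sum (map (inW ∘ cellAt t) (rows (m t) (l t))) ≡ when (V t ∧ᵇ not (V s)) (D t)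
  inSum s = diagSum inW (V t ∧ᵇ not (V s)) {t}
    (λ {i} x y → cong (λ b → if b then diagLen la mu (cellAt t i) else 0) (proj₂ (nontop {t} x y)))
    (λ p → cong₂ when (proj₂ (top p)) (diagLen-top {t} p))
    where t = suc s

  total : (Cell → ℕ) → ℕ → ℕ → ℕ
  total w n t = sum (map w (map (uncurry cellAt) (diagPairs n t)))

  total-suc : ∀ w n t → total w (suc n) t ≡ sum (map (w ∘ cellAt t) (rows (m t) (l t))) + total w n (suc t)
  total-suc w n t = trans (cong sum (trans (sym (map-∘ (diagPairs (suc n) t))) (trans (map-++ f (map (t ,_) (rows (m t) (l t))) (diagPairs n (suc t)))
      (cong₂ _++_ (sym (map-∘ (rows (m t) (l t)))) (map-∘ (diagPairs n (suc t)))))))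
    (sum-++ (map (w ∘ cellAt t) (rows (m t) (l t))) _)
    where
    f : ℕ × ℕ → ℕ
    f = w ∘ uncurry cellAt

  D-suc : ∀ {t} → m t ≡ suc (m (suc t)) → D (suc t) ≡ D t + when (does (left? t)) 1
  D-suc {t} m≡ with left? t | l-step t
  ... | yes (_ , l≡) | _ = trans (cong (_∸ m (suc t)) (sym l≡)) (trans (suc∸ (m (suc t)) (l t) (≤-trans (≤-reflexive (sym m≡)) (m≤l t)))
      (trans (cong (λ z → suc (l t ∸ z)) (sym m≡)) (+-comm 1 (D t))))
  ... | no ¬L | inj₁ l≡ = contradiction (m≡ , l≡) ¬L
  ... | no ¬L | inj₂ l≡ = sym (trans (+-identityʳ (D t)) (cong₂ _∸_ l≡ m≡))

  length-lefts : ∀ n t → length (lefts (suc n) t) ≡ when (does (left? t)) 1 + length (lefts n (suc t))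
  length-lefts n t with left? t
  ... | yes _ = refl
  ... | no _ = refl

  left⇒V : ∀ t → V t ≡ false → when (does (left? t)) 1 ≡ 0
  left⇒V t ¬V with left? t
  ... | no _ = refl
  ... | yes (p , _) = contradiction (trans (sym (V-true t p)) ¬V) λ ()

  V⇒ : ∀ t → V t ≡ true → m t ≡ suc (m (suc t))
  V⇒ t e = go (m t ≟ suc (m (suc t)))
    where
    go : Dec (m t ≡ suc (m (suc t))) → m t ≡ suc (m (suc t))
    go (yes p) = p
    go (no p) = contradiction (trans (sym e) (V-false t p)) λ ()

  -- The corner of diagonal `t` contributes `(V s - V t) D t` to the rank, Booleans read as 0 and 1.
  -- Moving the difference onto `D` leaves `V t (D (suc t) - D t)`, which is 1 at a left snake and 0
  -- elsewhere.
  local : ∀ s → let t = suc s in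
    when (not (V t) ∧ᵇ V s) (D t) + when (V t) (D (suc t)) ≡ when (V t ∧ᵇ not (V s)) (D t) + (when (does (left? t)) 1 + when (V s) (D t))
  local s = local-sum (V (suc s)) (V s) (λ e → D-suc (V⇒ (suc s) e)) (left⇒V (suc s))

  -- Summation by parts along the diagonals.
  abel : ∀ n s → n + suc s ≡ T →
    total outW n (suc s) ≡ total inW n (suc s) + (length (lefts n (suc s)) + when (V s) (D (suc s)))
  abel zero s eq = sym (trans (cong (when (V s)) (trans (cong (_∸ m (suc s)) (trans (cong l eq) end)) (0∸n≡0 (m (suc s))))) (when-0 (V s)))
  abel (suc n) s eq = begin
    total outW (suc n) t
      ≡⟨ trans (total-suc outW n t) (cong₂ _+_ (outSum s) (abel n t (trans (+-suc n t) eq))) ⟩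
    a + (I + (k + v′))
      ≡⟨ shuffle a I k v′ ⟩
    (a + v′) + (I + k)
      ≡⟨ cong (_+ (I + k)) (local s) ⟩
    (b + (x + v)) + (I + k)
      ≡⟨ shuffle′ b x v I k ⟩
    (b + I) + ((x + k) + v)
      ≡⟨ sym (cong₂ _+_ (trans (total-suc inW n t) (cong (_+ I) (inSum s))) (cong (_+ v) (length-lefts n t))) ⟩
    total inW (suc n) t + (length (lefts (suc n) t) + v) ∎
    where
    open ≡-Reasoning
    t = suc s
    a = when (not (V t) ∧ᵇ V s) (D t)
    b = when (V t ∧ᵇ not (V s)) (D t)
    I = total inW n (suc t)
    k = length (lefts n (suc t))
    v = when (V s) (D t)
    v′ = when (V t) (D (suc t))
    x = when (does (left? t)) 1
    shuffle : ∀ a I k v → a + (I + (k + v)) ≡ (a + v) + (I + k)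
    shuffle = solve 4 (λ a I k v → a :+ (I :+ (k :+ v)) := (a :+ v) :+ (I :+ k)) refl
      where open +-*-Solver
    shuffle′ : ∀ b x v I k → (b + (x + v)) + (I + k) ≡ (b + I) + ((x + k) + v)
    shuffle′ = solve 5 (λ b x v I k → (b :+ (x :+ v)) :+ (I :+ k) := (b :+ I) :+ ((x :+ k) :+ v)) refl
      where open +-*-Solver

  total₀ : ∀ w n → total w (suc n) 0 ≡ total w n 1
  total₀ w n = trans (total-suc w n 0) (cong (λ xs → sum (map (w ∘ cellAt 0) xs) + total w n 1) (rows-[] (≤-reflexive start)))

  first : when (V 0) (D 1) ≡ when (does (left? 0)) 1
  first = first-sum (V 0)
    (λ e → trans (D-suc (V⇒ 0 e)) (cong (_+ when (does (left? 0)) 1) (trans (cong (_∸ m 0) start) (n∸n≡0 (m 0)))))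
    (left⇒V 0)
    where
    first-sum : ∀ a {d x} → (a ≡ true → d ≡ x) → (a ≡ false → x ≡ 0) → when a d ≡ x
    first-sum true f _ = f refl
    first-sum false _ g = sym (g refl)

  abel₀ : ∀ n → n ≡ T → total outW n 0 ≡ total inW n 0 + length (lefts n 0)
  abel₀ zero _ = refl
  abel₀ (suc n) eq = trans (total₀ outW n) (trans (abel n 0 (trans (+-comm n 1) eq))
    (cong₂ _+_ (sym (total₀ inW n)) (trans (+-comm (length (lefts n 1)) _) (trans (cong (_+ length (lefts n 1)) first) (sym (length-lefts n 0))))))

  rank≡lefts : rank la mu ≡ ℤ.+ length (lefts T 0)
  rank≡lefts = begin
    ℤ.+ sum (map outW (cells la mu)) ℤ.- ℤ.+ sum (map inW (cells la mu))
      ≡⟨ cong₂ (λ x y → ℤ.+ x ℤ.- ℤ.+ y) (sum-↭ (map⁺ outW cells↭)) (sum-↭ (map⁺ inW cells↭)) ⟩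
    ℤ.+ total outW T 0 ℤ.- ℤ.+ b
      ≡⟨ cong (λ x → ℤ.+ x ℤ.- ℤ.+ b) (abel₀ T refl) ⟩
    ℤ.+ (b + k) ℤ.- ℤ.+ b
      ≡⟨ ℤ.[+m]-[+n]≡m⊖n (b + k) b ⟩
    (b + k) ⊖ b
      ≡⟨ ℤ.⊖-≥ (m≤m+n b k) ⟩
    ℤ.+ (b + k ∸ b)
      ≡⟨ cong ℤ.+_ (m+n∸m≡n b k) ⟩
    ℤ.+ k ∎
    where
    open ≡-Reasoning
    b = total inW T 0
    k = length (lefts T 0)

  -- The two bijections

  module Bijections (F : ℕ → List Link)
    (good : (i : ℕ) → RightSnakeRow la mu i → GoodLinkSet (snakeR la mu i) (F i)) where

    RightSpec : ℕ → ℕ → Set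
    RightSpec t q = In t q × (∀ {i} → In t i → i < q → stayLink t i ∈ F (l t)) ×
      (∀ {i} → In t (suc i) → q < suc i → upLink t i ∈ F (l t)) ×
      (∀ {x} → x ∈ F (l t) → ∃ λ i → (x ≡ stayLink t i × In t i × i < q) ⊎ (x ≡ upLink t i × In t (suc i) × q < suc i))

    abstract
      fixedRow : ∀ t → IsRight t → ∃ (RightSpec t)
      fixedRow t R = X.q , X.q-in , X.stay⁺ , X.up⁺ , X.classify
        where module X = RightLinks R (good (l t) (rightSnake⁺ R))

    fq : ℕ → ℕ
    fq t with right? t
    ... | yes R = proj₁ (fixedRow t R)
    -- A filler; only the values of `fq` at right snakes enter.
    ... | no _ = 0

    fq-spec : ∀ t → IsRight t → RightSpec t (fq t)
    fq-spec t R with right? t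
    ... | yes R′ = proj₂ (fixedRow t R′)
    ... | no ¬R = contradiction R ¬R

    open Threads T m-step l-step start end fq (λ t R → proj₁ (fq-spec t R))

    labelOf : List ℕ → Cell → ℕ
    labelOf cs c = E (drop (dg c) cs) (dg c) (proj₁ c)

    decomposition : List ℕ → List ℕ
    decomposition cs = canon (map (labelOf cs) (cells la mu))

    -- The name of the strip through `c` replaced by its rank of first appearance in the row order
    -- of the squares, as restricted growth strings require.
    block : List ℕ → Cell → ℕ
    block cs c = age (seen [] (map (labelOf cs) (cells la mu))) (labelOf cs c)

    decomposition≡ : ∀ cs → decomposition cs ≡ map (block cs) (cells la mu)
    decomposition≡ cs = sym (map-∘ (cells la mu))

    block-inj : ∀ cs {c c′} → c ∈ cells la mu → c′ ∈ cells la mu → block cs c ≡ block cs c′ → labelOf cs c ≡ labelOf cs c′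
    block-inj cs p p′ = canon-inj (map (labelOf cs) (cells la mu)) (∈-map⁺ (labelOf cs) p) (∈-map⁺ (labelOf cs) p′)

    labelOf-at : ∀ {cs} (va : Valid 0 cs) {t i} → In t i → labelOf cs (cellAt t i) ≡ label va t i
    labelOf-at {cs} va {t} {i} i∈ = cong (λ s → E (drop s cs) s i) (dg-in {t} i∈)

    rightTimes : List ℕ
    rightTimes = filter right? (upTo T)

    right<T : ∀ {t} → IsRight t → t < T
    right<T {t} R = in⇒<T {t} (proj₁ (fq-spec t R))

    labels⊆rights : ∀ {cs} → Valid 0 cs → ∀ {v} → v ∈ map (labelOf cs) (cells la mu) → v ∈ rightTimes
    labels⊆rights {cs} va v∈ with ∈-map⁻ (labelOf cs) v∈
    ... | c , c∈ , refl = ∈-filter⁺ right? (∈-upTo⁺ (right<T R)) R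
      where
      R : IsRight (labelOf cs c)
      R = label-right va (proj₁ (cells-view c∈))

    -- The lower bound on the number of strips

    module Decomposition (f : Cell → ℕ) (bsd : IsBSD la mu (map f (cells la mu))) where

      d : List ℕ
      d = map f (cells la mu)

      f< : ∀ {c} → c ∈ cells la mu → f c < nblocks d
      f< p = ∈⇒<nblocks (∈-map⁺ f p)

      strips : ∀ {c} → c ∈ cells la mu → IsBorderStrip (λ c′ → c′ ∈ cells la mu × f c′ ≡ f c)
      strips {c} p = strip-resp (λ q → let (a , b) = ∈-zip-map⁻ f (cells la mu) q in a , sym b)
        (λ {c′} (a , b) → subst (λ z → InBlock la mu d z c′) b (∈-zip-map⁺ f a)) (proj₂ (proj₂ bsd) (f c) (f< p))

      open Blocks f strips public
      open Labelling lab lab-thin lab-linked public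

      lab< : ∀ {t i} → In t i → lab t i < nblocks d
      lab< {t} i∈ = f< (cellAt∈ {t} i∈)

      nblocks-≥ : length rightTimes ≤ nblocks d
      nblocks-≥ = rights≤ m≤l (nblocks d) lab<

    image : ∀ {d} → IsBSD la mu d → ∃ λ f → d ≡ map f (cells la mu)
    image {d} bsd = Unique⇒image _≟C_ (cells-unique la mu) d (proj₁ bsd)

    rights≤nblocks : ∀ {d} → IsBSD la mu d → length rightTimes ≤ nblocks d
    rights≤nblocks {d} bsd = go (proj₁ (image bsd)) (proj₂ (image bsd)) bsd
      where
      go : ∀ f → d ≡ map f (cells la mu) → IsBSD la mu d → length rightTimes ≤ nblocks d
      go f refl bsd = Decomposition.nblocks-≥ f bsd

    -- The choices give elements of Q_F

    decomposition-BSD : ∀ {cs} → Valid 0 cs → IsBSD la mu (decomposition cs)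
    decomposition-BSD {cs} va = trans (length-map _ (map (labelOf cs) (cells la mu))) (length-map (labelOf cs) (cells la mu)) ,
      canon-RGS (map (labelOf cs) (cells la mu)) , strips
      where
      open Classes (label va) (label-thin va) (label-linked va)
      strips : ∀ b → b < nblocks (decomposition cs) → IsBorderStrip (InBlock la mu (decomposition cs) b)
      strips b b< with ∈-map⁻ (block cs) (subst (b ∈_) (decomposition≡ cs) (RGS⇒onto (canon-RGS (map (labelOf cs) (cells la mu))) b<))
      ... | c , c∈ , refl = strip-resp to from (class-strip (c , c∈ , refl))
        where
        to : ∀ {c′} → Class (labelOf cs c) c′ → InBlock la mu (decomposition cs) (block cs c) c′
        to {c′} (c′∈ , e) = subst₂ (λ z b → (c′ , b) ∈ zip (cells la mu) z) (sym (decomposition≡ cs))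
          (cong (age (seen [] (map (labelOf cs) (cells la mu)))) e) (∈-zip-map⁺ (block cs) c′∈)
        from : ∀ {c′} → InBlock la mu (decomposition cs) (block cs c) c′ → Class (labelOf cs c) c′
        from {c′} p with ∈-zip-map⁻ (block cs) (cells la mu) (subst (λ z → (c′ , block cs c) ∈ zip (cells la mu) z) (decomposition≡ cs) p)
        ... | c′∈ , e = c′∈ , block-inj cs c′∈ c∈ (sym e)

    decomposition-nblocks : ∀ {cs} → Valid 0 cs → nblocks (decomposition cs) ≤ length rightTimes
    decomposition-nblocks {cs} va = nblocks-canon≤ (map (labelOf cs) (cells la mu)) rightTimes (labels⊆rights va)

    decomposition-uses : ∀ {cs} (va : Valid 0 cs) {c c′} → c ∈ cells la mu → c′ ∈ cells la mu →
      labelOf cs c ≡ labelOf cs c′ → Uses la mu (decomposition cs) (c , c′)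
    decomposition-uses {cs} va {c} {c′} p p′ e = block cs c ,
      subst (λ z → (c , block cs c) ∈ zip (cells la mu) z) (sym (decomposition≡ cs)) (∈-zip-map⁺ (block cs) p) ,
      subst₂ (λ z b → (c′ , b) ∈ zip (cells la mu) z) (sym (decomposition≡ cs))
        (cong (age (seen [] (map (labelOf cs) (cells la mu)))) (sym e)) (∈-zip-map⁺ (block cs) p′)

    decomposition-InQF : ∀ {cs} → Valid 0 cs → InQF la mu F (decomposition cs)
    decomposition-InQF {cs} va = (decomposition-BSD va , minimal) , uses
      where
      minimal : ∀ d′ → IsBSD la mu d′ → nblocks (decomposition cs) ≤ nblocks d′
      -- The names are right snakes, so their number cannot exceed the bound that holds for every
      -- decomposition.
      minimal d′ bsd′ = ≤-trans (decomposition-nblocks va) (rights≤nblocks bsd′)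
      uses : ∀ i → RightSnakeRow la mu i → ∀ x → x ∈ F i → Uses la mu (decomposition cs) x
      uses i rs x x∈ with rightSnake⁻ rs
      ... | t , R , refl , _ with proj₂ (proj₂ (proj₂ (fq-spec t R))) x∈ | choice va (right<T R)
      ... | i , inj₁ (refl , i∈ , i<q) | q , e , ok , _ =
        decomposition-uses va (cellAt∈ {t} i∈) (cellAt∈ {suc t} i∈′)
          (trans (labelOf-at va {t} i∈) (trans (label-just va e n) (sym (labelOf-at va {suc t} i∈′))))
        where
        n : nxt (kind t) q i ≡ just i
        n = nxt-stay (kind t) ok R i<q
        i∈′ : In (suc t) i
        i∈′ = proj₁ (nxt-in (kind t) ok i∈ n)
      ... | i , inj₂ (refl , i∈ , q<i) | q , e , ok , _ =
        decomposition-uses va (cellAt∈ {suc t} i∈′) (cellAt∈ {t} i∈)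
          (trans (labelOf-at va {suc t} i∈′) (trans (sym (label-just va e n)) (sym (labelOf-at va {t} i∈))))
        where
        n : nxt (kind t) q (suc i) ≡ just i
        n = nxt-up (kind t) ok R q<i
        i∈′ : In (suc t) i
        i∈′ = proj₁ (nxt-in (kind t) ok i∈ n)

    -- Every element of Q_F comes from choices

    module Onto (f : Cell → ℕ) (inQF : InQF la mu F (map f (cells la mu))) where

      open Decomposition f (proj₁ (proj₁ inQF))

      few : nblocks d ≤ length rightTimes
      -- Minimality is used by comparison with one decomposition whose strips are bounded in number
      -- by the right snakes.
      few = let (cs₀ , va₀) = someValid m≤l T 0 (+-identityʳ T) in
        ≤-trans (proj₂ (proj₁ inQF) (decomposition cs₀) (decomposition-BSD va₀)) (decomposition-nblocks va₀)

      linked⇒≡ : ∀ {t x} → IsRight t → x ∈ F (l t) → f (proj₁ x) ≡ f (proj₂ x)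
      linked⇒≡ {t} {x} R x∈ = let (b , p , q) = proj₂ inQF (l t) (rightSnake⁺ R) x x∈ in
        trans (sym (proj₂ (∈-zip-map⁻ f (cells la mu) p))) (proj₂ (∈-zip-map⁻ f (cells la mu) q))

      fixed< : ∀ {t i} → IsRight t → In t i → i < fq t → lab (suc t) i ≡ lab t i
      fixed< {t} {i} R i∈ lt = sym (linked⇒≡ {t} {stayLink t i} R (proj₁ (proj₂ (fq-spec t R)) i∈ lt))

      fixed> : ∀ {t i} → IsRight t → In t i → fq t < i → lab (suc t) (pred i) ≡ lab t i
      fixed> {t} {suc i} R i∈ gt = linked⇒≡ {t} {upLink t i} R (proj₁ (proj₂ (proj₂ (fq-spec t R))) i∈ gt)

      contin : ∀ {t i} → ¬ IsRight t → In t i →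
        ∃ λ i′ → In (suc t) i′ × lab (suc t) i′ ≡ lab t i × (i′ ≡ i ⊎ i ≡ suc i′)
      contin = continues m≤l (nblocks d) lab< few

      cs : List ℕ
      cs = follow m≤l contin fixed< fixed> T 0

      va : Valid 0 cs
      va = chosen-valid m≤l contin fixed< fixed>

      kernel : SameKernel f (block cs) (cells la mu)
      kernel {x} {y} p q =
        let (x∈ , ex , _) = cells-view p
            (y∈ , ey , _) = cells-view q
            (to , from) = sameKernel m≤l contin fixed< fixed> x∈ y∈
        in (λ e → cong (age (seen [] (map (labelOf cs) (cells la mu)))) (to (trans (cong f ex) (trans e (sym (cong f ey)))))) ,
           (λ e → trans (sym (cong f ex)) (trans (from (block-inj cs p q e)) (cong f ey)))

      eq : map f (cells la mu) ≡ map (block cs) (cells la mu)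
      eq = RGS-unique f (block cs) (cells la mu) (proj₁ (proj₂ (proj₁ (proj₁ inQF))))
        (subst IsRGS (decomposition≡ cs) (canon-RGS (map (labelOf cs) (cells la mu)))) kernel

    decomposition-onto : ∀ {d} → InQF la mu F d → ∃ λ cs → Valid 0 cs × d ≡ decomposition cs
    decomposition-onto {d} inQF = go (proj₁ im) (proj₂ im) inQF
      where
      im = image (proj₁ (proj₁ inQF))
      go : ∀ f → d ≡ map f (cells la mu) → InQF la mu F d → ∃ λ cs → Valid 0 cs × d ≡ decomposition cs
      go f refl inQF = cs , va , trans eq (sym (decomposition≡ cs))
        where open Onto f inQF

    decomposition-inj : ∀ {cs cs′} → Valid 0 cs → Valid 0 cs′ → decomposition cs ≡ decomposition cs′ → cs ≡ cs′
    decomposition-inj {cs} {cs′} va va′ eq = label-inj va va′ λ {t} {i} {t′} {i′} i∈ i′∈ e →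
      trans (sym (labelOf-at va {t} i∈)) (trans
        (block-inj cs (cellAt∈ {t} i∈) (cellAt∈ {t′} i′∈) (trans (same (cellAt∈ {t} i∈)) (trans
          (cong (age (seen [] (map (labelOf cs′) (cells la mu)))) (trans (labelOf-at va′ {t} i∈) (trans e (sym (labelOf-at va′ {t′} i′∈)))))
          (sym (same (cellAt∈ {t′} i′∈))))))
        (labelOf-at va {t′} i′∈))
      where
      same : ∀ {c} → c ∈ cells la mu → block cs c ≡ block cs′ c
      same = map-≡⁻ (trans (sym (decomposition≡ cs)) (trans eq (decomposition≡ cs′)))

    -- Interval sets from choices

    offset : ℕ × ℕ → ℤ × ℤ
    offset (u , v) = idx u , idx v

    intervalSet : List ℕ → List (ℤ × ℤ)
    intervalSet cs = map offset (intervals cs 0)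

    offset-inj : ∀ {p q} → offset p ≡ offset q → p ≡ q
    offset-inj e = cong₂ _,_ (idx-inj (cong proj₁ e)) (idx-inj (cong proj₂ e))

    valid-T : ∀ {cs} → Valid 0 cs → length cs ≡ T
    valid-T va = trans (sym (+-identityʳ _)) (valid-length va)

    firsts≡ : ∀ {cs} → Valid 0 cs → map proj₁ (intervals cs 0) ≡ lefts T 0
    firsts≡ va = trans (intervals-firsts va) (cong (λ n → lefts n 0) (valid-T va))

    map-proj₁-offset : ∀ I → map proj₁ (map offset I) ≡ map idx (map proj₁ I)
    map-proj₁-offset I = trans (sym (map-∘ I)) (map-∘ I)

    map-proj₂-offset : ∀ I → map proj₂ (map offset I) ≡ map idx (map proj₂ I)
    map-proj₂-offset I = trans (sym (map-∘ I)) (map-∘ I)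

    intervalSet-is : ∀ {cs} → Valid 0 cs → IsIntervalSet la mu (intervalSet cs)
    intervalSet-is {cs} va = sorted , len , unique , AllP.map⁺ (All.map ok (intervals-are va))
      where
      I = intervals cs 0
      sorted₁ : AllPairs _<_ (map proj₁ I)
      sorted₁ = subst (AllPairs _<_) (sym (firsts≡ va)) (lefts-sorted T 0)
      sorted : AllPairs (λ p q → proj₁ p ℤ.< proj₁ q) (map offset I)
      sorted = AllPairsP.map⁺ (AllPairs.map idx-< (AllPairsP.map⁻ sorted₁))
      len : ℤ.+ length (map offset I) ≡ rank la mu
      len = trans (cong ℤ.+_ (trans (length-map offset I) (trans (sym (length-map proj₁ I)) (cong length (firsts≡ va))))) (sym rank≡lefts)
      differ : ∀ {x y} → x ∈ map proj₁ (map offset I) → y ∈ map proj₂ (map offset I) → x ≢ y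
      differ {x} {y} p q refl with ∈-map⁻ idx (subst (x ∈_) (map-proj₁-offset I) p) | ∈-map⁻ idx (subst (y ∈_) (map-proj₂-offset I) q)
      ... | a , a∈ , ea | b , b∈ , eb with ∈-map⁻ proj₁ a∈ | ∈-map⁻ proj₂ b∈
      ... | p₁ , p₁∈ , refl | p₂ , p₂∈ , refl with All.lookup (intervals-are va) p₁∈ | All.lookup (intervals-are va) p₂∈
      ... | _ , _ , La , _ | _ , _ , _ , Rb = left⇒¬right La (subst IsRight (sym (idx-inj (trans (sym ea) eb))) Rb)
      unique : Unique (flatten (map offset I))
      unique = flatten-unique⁺ (map offset I)
        (subst Unique (sym (map-proj₁-offset I)) (Unique.map⁺ idx-inj (sorted⇒unique sorted₁)))
        (subst Unique (sym (map-proj₂-offset I)) (Unique.map⁺ idx-inj (intervals-seconds-unique va))) differ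
      ok : ∀ {p} → IsInterval 0 p → idx (proj₁ p) ℤ.< idx (proj₂ p) × LeftSnakeAt la mu (idx (proj₁ p)) × RightSnakeAt la mu (idx (proj₂ p))
      ok (_ , u<v , Lu , Rv) = idx-< u<v , leftAt⁺ Lu , rightAt⁺ Rv

    left<T : ∀ {t} → IsLeft t → t < T
    left<T {t} (p , _) with t <? T
    ... | yes q = q
    ... | no q = contradiction (≤-trans (≤-reflexive (sym p)) (≤-trans (m≤l t) (≤-reflexive (l-end (≮⇒≥ q))))) n≮0

    intervalSet-onto : ∀ {I} → IsIntervalSet la mu I → ∃ λ cs → Valid 0 cs × I ≡ intervalSet cs
    intervalSet-onto {I} (sorted , len , unique , all) with preimages {Q = λ (u , v) → u < v × IsLeft u × IsRight v} offset pre all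
      where
      pre : ∀ {p} → proj₁ p ℤ.< proj₂ p × LeftSnakeAt la mu (proj₁ p) × RightSnakeAt la mu (proj₂ p) →
        ∃ λ (uv : ℕ × ℕ) → p ≡ offset uv × (proj₁ uv < proj₂ uv × IsLeft (proj₁ uv) × IsRight (proj₂ uv))
      pre {_ , _} (lt , ls , rs) with leftAt⁻ ls | rightAt⁻ rs
      ... | u , Lu , refl | v , Rv , refl = (u , v) , refl , idx-<⁻ lt , Lu , Rv
    ... | J , refl , ps = found
      where
      sorted₁ : AllPairs _<_ (map proj₁ J)
      sorted₁ = AllPairsP.map⁺ (AllPairs.map idx-<⁻ (AllPairsP.map⁻ sorted))
      sub : ∀ {u} → u ∈ map proj₁ J → u ∈ lefts T 0
      sub p with ∈-map⁻ proj₁ p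
      ... | (u , v) , uv∈ , refl with All.lookup ps uv∈
      ... | _ , Lu , _ = ∈-lefts⁺ T 0 z≤n (subst (u <_) (sym (+-identityʳ T)) (left<T Lu)) Lu
      firsts : map proj₁ J ≡ lefts T 0
      -- The size of an interval set is the rank, hence the number of left snakes; so its first
      -- entries are all left snakes, in increasing order.
      firsts = sorted-⊆-length⇒≡ sorted₁ (lefts-sorted T 0) sub
        (≤-reflexive (trans (sym (ℤ.+-injective (trans len rank≡lefts))) (trans (length-map offset J) (sym (length-map proj₁ J)))))
      seconds : Unique (map proj₂ J)
      seconds = Unique.map⁻ (subst Unique (map-proj₂-offset J) (flatten-unique₂ (map offset J) unique))
      found : ∃ λ cs → Valid 0 cs × map offset J ≡ intervalSet cs
      found with intervals-onto T 0 J (+-identityʳ T) firsts (All.map (λ (a , _ , b) → a , b) ps) seconds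
      ... | cs , va , e , _ = cs , va , cong (map offset) (sym e)

    intervalSet-inj : ∀ {cs cs′} → Valid 0 cs → Valid 0 cs′ → intervalSet cs ≡ intervalSet cs′ → cs ≡ cs′
    intervalSet-inj va va′ e = intervals-inj va va′ (map-injective offset-inj e)

    -- Comparison of types and the final count

    labels↭ : ∀ {cs} → Valid 0 cs → map (labelOf cs) (cells la mu) ↭ labels cs 0
    labels↭ {cs} va = ↭-trans (map⁺ (labelOf cs) cells↭) (subst (map (labelOf cs) (map (uncurry cellAt) (diagPairs T 0)) ↭_) eq ↭-refl)
      where
      eq : map (labelOf cs) (map (uncurry cellAt) (diagPairs T 0)) ≡ labels cs 0
      eq = trans (sym (map-∘ (diagPairs T 0))) (trans
        (map-cong-local (All.tabulate λ {(t , i)} p → labelOf-at va {t} {i} (proj₂ (∈-diagPairs⁻ T 0 p))))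
        (labels-drop va T 0 (+-identityʳ T)))

    intervalType : List (ℤ × ℤ) → List ℕ
    intervalType = map (λ p → ℤ.∣ proj₂ p ℤ.- proj₁ p ∣)

    -- The blocks correspond to the second entries `v` of the intervals, and `v` names as many
    -- squares as the length of its interval.
    type↭ : ∀ {cs} → Valid 0 cs →
      map (λ b → countL b (decomposition cs)) (upTo (nblocks (decomposition cs))) ↭ intervalType (intervalSet cs)
    type↭ {cs} va = ↭-trans (canon-blocks es (map proj₂ I) (intervals-seconds-unique va) to from)
      (subst (map (λ v → countL v es) (map proj₂ I) ↭_) eq ↭-refl)
      where
      es = map (labelOf cs) (cells la mu)
      I = intervals cs 0
      to : ∀ {v} → v ∈ map proj₂ I → v ∈ es
      to p = ∈-resp-↭ (↭-sym (labels↭ va)) (seconds⊆labels va p)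
      from : ∀ {v} → v ∈ es → v ∈ map proj₂ I
      from p with labels-cover va (∈-resp-↭ (labels↭ va) p)
      ... | inj₁ (i , i∈ , _) = contradiction i∈ in-start
      ... | inj₂ q = q
      size-of : ∀ {p} → p ∈ I → countL (proj₂ p) es ≡ ℤ.∣ idx (proj₂ p) ℤ.- idx (proj₁ p) ∣
      size-of {u , v} p = trans (↭-length (filter-↭ (v ≟_) (labels↭ va)))
        (trans (trans (sym (m+n∸n≡m _ u)) (cong (_∸ u) (count-interval va p)))
          (sym (idx-diff (<⇒≤ (proj₁ (proj₂ (All.lookup (intervals-are va) p)))))))
      eq : map (λ v → countL v es) (map proj₂ I) ≡ intervalType (intervalSet cs)
      eq = trans (sym (map-∘ I)) (trans (map-cong-local (All.tabulate size-of)) (map-∘ I))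

    counted : ∀ σ → Σ ℕ λ n → HasCard (λ d → InQF la mu F d × HasType d σ) n × HasCard (IntervalSetOfType la mu σ) n
    counted σ =
      length chosen ,
      HasCard-image chosen decomposition unique
        (λ p q → decomposition-inj (valid p) (valid q))
        (λ p → decomposition-InQF (valid p) , ↭-trans (type↭ (valid p)) (typed p))
        (λ (inQ , ty) → let (cs , va , eq) = decomposition-onto inQ in
          cs , chosen⁺ va (↭-trans (↭-sym (type↭ va)) (subst (λ d → HasType d σ) eq ty)) , eq) ,
      HasCard-image chosen intervalSet unique
        (λ p q → intervalSet-inj (valid p) (valid q))
        (λ p → intervalSet-is (valid p) , typed p)
        (λ (is , ty) → let (cs , va , eq) = intervalSet-onto is in
          cs , chosen⁺ va (subst (λ I → intervalType I ↭ σ) eq ty) , eq)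
      where
      type? = λ cs → intervalType (intervalSet cs) ↭? σ
      chosen : List (List ℕ)
      chosen = filter type? (choices T 0)
      unique : Unique chosen
      unique = Unique.filter⁺ type? (choices-unique T 0)
      valid : ∀ {cs} → cs ∈ chosen → Valid 0 cs
      valid p = ∈-choices⁻ T 0 (+-identityʳ T) (proj₁ (∈-filter⁻ type? {xs = choices T 0} p))
      typed : ∀ {cs} → cs ∈ chosen → intervalType (intervalSet cs) ↭ σ
      typed p = proj₂ (∈-filter⁻ type? {xs = choices T 0} p)
      chosen⁺ : ∀ {cs} → Valid 0 cs → intervalType (intervalSet cs) ↭ σ → cs ∈ chosen
      chosen⁺ {cs} va ty = ∈-filter⁺ type? (subst (λ n → cs ∈ choices n 0) (valid-T va) (∈-choices⁺ va)) ty

theorem4p10 : (la mu : List ℕ) → IsPartition la → IsPartition mu → Contains la mu →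
    (F : ℕ → List Link) →
    ((i : ℕ) → RightSnakeRow la mu i → GoodLinkSet (snakeR la mu i) (F i)) →
    (σ : List ℕ) → IsPartition σ → sum σ ≡ size la mu →
    Σ ℕ (λ n → HasCard (λ d → InQF la mu F d × HasType d σ) n
    × HasCard (IntervalSetOfType la mu σ) n)
theorem4p10 la mu pl pm con F good σ _ _ = Skew.Bijections.counted la mu pl pm con F good σ
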